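{- Fix integers $t \geq 2$ and $d \ge 1$. There is a constant $C = C(t,d)$ such that the following holds. Let $q$ be an even power of an odd prime with $d \mid q-1$, and let $a \leq h$ be positive integers with $ha = \frac{q-1}{d}$. Then \[ f\!\left(q^{t-1} a,\; K_{t,(t-1)!\, d^{t-1} + 1}\right) \leq a + h + C h^{2/5}, \] i.e. $f(q^{t-1}a, K_{t,(t-1)!d^{t-1}+1}) \le a + h + O(h^{2/5})$.
   Context: Let $r,k$ be positive integers. A graph $G$ is an $(r,k)$-graph if $V(G)$ can be partitioned into sets $V_1,\dots,V_r$ with $|V_i| \le k$ for all $i$ such that for every pair $i \neq j$ in $[r]$ there is an edge of $G$ with one endpoint in $V_i$ and the other in $V_j$. For a graph $H$, $f(r,H)$ is the minimum $k$ such that there exists an $H$-free $(r,k)$-graph. $K_{s,t}$ is the complete bipartite graph with parts of sizes $s$ and $t$. -}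

module Defs where

open import Level using (0ℓ)
open import Data.Nat using (ℕ; zero; suc; _+_; _*_; _∸_; _^_; _≤_; _<_)
open import Data.Nat.Divisibility using (_∣_)
open import Data.Nat.Primality using (Prime)
open import Data.Fin using (Fin)
open import Data.Fin.Properties using (_≟_)
open import Data.List using (length; filter)
open import Data.List.Base using (allFin)
open import Data.Product using (Σ; _×_; ∃; ∃-syntax)
open import Relation.Binary.PropositionalEquality using (_≡_; _≢_)
open import Relation.Nullary using (¬_)
open import Function.Definitions using (Injective)

record SimpleGraph (n : ℕ) : Set₁ where
  field
    Adj   : Fin n → Fin n → Set
    sym   : ∀ {u v} → Adj u v → Adj v u
    irrefl : ∀ {v} → ¬ Adj v v
open SimpleGraph public

partSize : ∀ {n r} → (Fin n → Fin r) → Fin r → ℕ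
partSize {n} part i = length (filter (λ v → part v ≟ i) (allFin n))

IsRKPartition : ∀ {n} → SimpleGraph n → (r k : ℕ) → (Fin n → Fin r) → Set
IsRKPartition G r k part =
  (∀ i → partSize part i ≤ k) ×
  (∀ i j → i ≢ j → ∃[ u ] ∃[ v ] (part u ≡ i × part v ≡ j × Adj G u v))

ContainsK : ∀ {n} → SimpleGraph n → (s t : ℕ) → Set
ContainsK {n} G s t =
  Σ (Fin s → Fin n) λ A → Σ (Fin t → Fin n) λ B →
    Injective _≡_ _≡_ A × Injective _≡_ _≡_ B ×
    (∀ i j → A i ≢ B j) × (∀ i j → Adj G (A i) (B j))

KFree : ∀ {n} → SimpleGraph n → (s t : ℕ) → Set
KFree G s t = ¬ ContainsK G s t

ExistsKFreeRK : (r k s t : ℕ) → Set₁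
ExistsKFreeRK r k s t =
  ∃[ n ] Σ (SimpleGraph n) λ G → Σ (Fin n → Fin r) λ part →
    IsRKPartition G r k part × KFree G s t

-- f(r, K_{s,t}) ≤ k  (f is the least k admitting such a graph; since being
-- an (r,k)-graph is monotone in k, this is equivalent to the existence of one).
fK≤ : (r s t k : ℕ) → Set₁
fK≤ r s t k = ∃[ k' ] (k' ≤ k × ExistsKFreeRK r k' s t)

EvenPowerOfOddPrime : ℕ → Set
EvenPowerOfOddPrime q =
  ∃[ p ] ∃[ m ] (Prime p × ¬ (2 ∣ p) × 1 ≤ m × q ≡ p ^ (2 * m))

-- The parts are the pairs (A, i) with A in F_Q, where Q = q^(t-1), and i < a.  In the projective norm graph,
-- with edges (A, x) ~ (B, z) when N(A - B)^d = γ^(x+z) for an element γ of order h a, a part owns a coset of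
-- the subgroup of order h as left vertices and an interval of length a as right vertices.  A coset and an
-- interval sum to the whole cyclic group, so parts with different A are joined by h + a vertices each.  Parts
-- with the same A are joined by copies of a C₄-free graph with a parts of size O(a^(1/3)): the same
-- construction over a field with Z² elements, Z a power of 2, where Z² - 1 = (Z + 1)(Z - 1), and a matching.
--
-- Freeness reduces, by inverting about one vertex, to t - 1 equations ∏_j (X^(q^j) - C_i^(q^j)) = y_i in which
-- y_i^d is constant.  On the solution set let V be spanned by the monomials of degrees below 1, t - 1, …, 3, 2
-- in the conjugates X, X^q, X^(q^2), … and below d in each y_i.  Lagrange interpolation shows that X V ⊆ V.  As X separates the
-- solutions, V consists of all functions, so there are at most dim V ≤ (t-1)! d^(t-1) solutions.
--
-- F_Q is the quotient of the group ring of the cyclic group of order Q - 1 over F_p by the annihilator of an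
-- idempotent v, chosen so that the generator keeps its order; it exists because y^Q = y in the group ring.
module Submission where

open import Defs hiding (sym; irrefl)
open import Level using (0ℓ)
open import Algebra.Bundles using (CommutativeRing)
open import Algebra.Structures using (IsAbelianGroup)
import Algebra.Properties.CommutativeSemiring.Exp
import Algebra.Properties.Semiring.Exp
import Algebra.Properties.Semiring.Mult
import Algebra.Properties.Semiring.Sum
open import Data.Fin using (Fin; zero; suc; toℕ; combine; remQuot)
open import Data.Nat using (ℕ; zero; suc)
open import Data.Nat.Divisibility using (_∣_)
open import Data.Nat.Primality using (Prime)
open import Data.Product using (Σ; ∃-syntax; _×_; _,_; proj₁; proj₂)
open import Data.Sum using (_⊎_; inj₁; inj₂)
open import Function.Definitions using (Injective)
open import Relation.Binary.Definitions using (Decidable)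
open import Relation.Binary.PropositionalEquality using (_≡_; _≢_)
open import Relation.Nullary using (¬_)

-- The vertices are exponents, so F_Q is needed together with a generator of its multiplicative
-- group. The group ring supplies the generator from the outset; the danger is that its order drops
-- in a quotient. The order stays N = Q - 1 if every 1 - ζ^(N/ℓ), with ℓ a prime divisor of N,
-- remains invertible. Hence `v` is chosen inside the unit part of the product of these elements,
-- and the crucial point is that this product is nonzero in the group ring. That the field has no
-- elements besides zero and the powers of ζ is the dimension bound once more, for the single
-- equation X^N = 1.
--
-- The graph joining parts with the same A decides the error term. Powers of 2 are dense enough up
-- to a constant factor, so nothing about gaps between primes enters. Its parts have size O(Z) with
-- Z^3 of order h, and the exponent 2/5 is reached by bounding Z^5 by Z^6, the square of Z^3.

-- Ring solver with integer coefficients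

module IntegerSolver (R : CommutativeRing 0ℓ 0ℓ) where
  open CommutativeRing R hiding (zero)
  open import Algebra.Properties.Ring ring
    using (-‿distribˡ-*; -‿distribʳ-*; -‿involutive; -0#≈0#; -‿+-comm)
  open import Algebra.Solver.Ring.AlmostCommutativeRing
    using (AlmostCommutativeRing; _-Raw-AlmostCommutative⟶_)
    renaming (fromCommutativeRing to almostCommutative)
  open import Relation.Binary.Reasoning.Setoid setoid
  open import Algebra.Properties.CommutativeSemigroup +-commutativeSemigroup
    using (interchange)
  open import Data.Nat as ℕ using (ℕ; zero; suc)
  open import Data.Integer as ℤ using (ℤ; +_; -[1+_]; _⊖_)
  import Data.Integer.Properties as ℤ
  open import Data.Maybe using (Maybe; just; nothing)
  open import Relation.Nullary using (yes; no)
  import Relation.Binary.PropositionalEquality as ≡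

  -- The separate clause at 1 makes the value definitionally `1#`, so that `con (+ 1)` matches `1#`
  -- in solver goals and `1-homo` is `refl`.
  nat : ℕ → Carrier
  nat 0 = 0#
  nat 1 = 1#
  nat (suc n@(suc _)) = 1# + nat n

  nat-suc : ∀ n → nat (suc n) ≈ 1# + nat n
  nat-suc zero = sym (+-identityʳ 1#)
  nat-suc (suc n) = refl

  nat-+ : ∀ m n → nat (m ℕ.+ n) ≈ nat m + nat n
  nat-+ zero n = sym (+-identityˡ _)
  nat-+ (suc m) n = begin
    nat (suc (m ℕ.+ n)) ≈⟨ nat-suc (m ℕ.+ n) ⟩
    1# + nat (m ℕ.+ n) ≈⟨ +-congˡ (nat-+ m n) ⟩
    1# + (nat m + nat n) ≈⟨ +-assoc _ _ _ ⟨
    1# + nat m + nat n ≈⟨ +-congʳ (nat-suc m) ⟨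
    nat (suc m) + nat n ∎

  nat-* : ∀ m n → nat (m ℕ.* n) ≈ nat m * nat n
  nat-* zero n = sym (zeroˡ _)
  nat-* (suc m) n = begin
    nat (n ℕ.+ m ℕ.* n) ≈⟨ nat-+ n (m ℕ.* n) ⟩
    nat n + nat (m ℕ.* n) ≈⟨ +-cong (sym (*-identityˡ _)) (nat-* m n) ⟩
    1# * nat n + nat m * nat n ≈⟨ distribʳ _ _ _ ⟨
    (1# + nat m) * nat n ≈⟨ *-congʳ (nat-suc m) ⟨
    nat (suc m) * nat n ∎

  int : ℤ → Carrier
  int (+ n) = nat n
  int -[1+ n ] = - nat (suc n)

  int-neg : ∀ i → int (ℤ.- i) ≈ - int i
  int-neg (+ zero) = sym -0#≈0#
  int-neg (+ suc n) = refl
  int-neg -[1+ n ] = sym (-‿involutive _)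

  int-⊖ : ∀ m n → int (m ⊖ n) ≈ nat m + - nat n
  int-⊖ zero zero = sym (-‿inverseʳ 0#)
  int-⊖ zero (suc n) = sym (+-identityˡ _)
  int-⊖ (suc m) zero = sym (trans (+-congˡ -0#≈0#) (+-identityʳ _))
  int-⊖ (suc m) (suc n) = begin
    int (suc m ⊖ suc n) ≡⟨ ≡.cong int (ℤ.[1+m]⊖[1+n]≡m⊖n m n) ⟩
    int (m ⊖ n) ≈⟨ int-⊖ m n ⟩
    nat m + - nat n ≈⟨ +-identityˡ _ ⟨
    0# + (nat m + - nat n) ≈⟨ +-congʳ (-‿inverseʳ 1#) ⟨
    1# + - 1# + (nat m + - nat n) ≈⟨ interchange _ _ _ _ ⟩
    1# + nat m + (- 1# + - nat n) ≈⟨ +-cong (sym (nat-suc m)) (trans (-‿+-comm _ _) (-‿cong (sym (nat-suc n)))) ⟩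
    nat (suc m) + - nat (suc n) ∎

  int-+ : ∀ i j → int (i ℤ.+ j) ≈ int i + int j
  int-+ (+ m) (+ n) = nat-+ m n
  int-+ (+ m) -[1+ n ] = int-⊖ m (suc n)
  int-+ -[1+ m ] (+ n) = trans (int-⊖ n (suc m)) (+-comm _ _)
  int-+ -[1+ m ] -[1+ n ] = begin
    - nat (suc (suc (m ℕ.+ n))) ≡⟨ ≡.cong (λ k → - nat (suc k)) (≡.sym (ℕ.+-suc m n)) ⟩
    - nat (suc m ℕ.+ suc n) ≈⟨ -‿cong (nat-+ (suc m) (suc n)) ⟩
    - (nat (suc m) + nat (suc n)) ≈⟨ -‿+-comm _ _ ⟨
    - nat (suc m) + - nat (suc n) ∎
    where import Data.Nat.Properties as ℕ

  int-+* : ∀ m j → int (+ m ℤ.* j) ≈ nat m * int j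
  int-+* m (+ n) = begin
    int (+ m ℤ.* + n) ≡⟨ ≡.cong int (ℤ.pos-* m n) ⟨
    nat (m ℕ.* n) ≈⟨ nat-* m n ⟩
    nat m * nat n ∎
  int-+* m -[1+ n ] = begin
    int (+ m ℤ.* -[1+ n ]) ≡⟨ ≡.cong int (ℤ.neg-distribʳ-* (+ m) (+ suc n)) ⟨
    int (ℤ.- (+ m ℤ.* + suc n)) ≈⟨ int-neg (+ m ℤ.* + suc n) ⟩
    - int (+ m ℤ.* + suc n) ≈⟨ -‿cong (int-+* m (+ suc n)) ⟩
    - (nat m * nat (suc n)) ≈⟨ -‿distribʳ-* _ _ ⟩
    nat m * - nat (suc n) ∎

  int-* : ∀ i j → int (i ℤ.* j) ≈ int i * int j
  int-* (+ m) j = int-+* m j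
  int-* -[1+ m ] j = begin
    int (-[1+ m ] ℤ.* j) ≡⟨ ≡.cong int (ℤ.neg-distribˡ-* (+ suc m) j) ⟨
    int (ℤ.- (+ suc m ℤ.* j)) ≈⟨ int-neg (+ suc m ℤ.* j) ⟩
    - int (+ suc m ℤ.* j) ≈⟨ -‿cong (int-+* (suc m) j) ⟩
    - (nat (suc m) * int j) ≈⟨ -‿distribˡ-* _ _ ⟩
    - nat (suc m) * int j ∎

  int-homomorphism : ℤ.+-*-rawRing -Raw-AlmostCommutative⟶ almostCommutative R
  int-homomorphism = record
    { ⟦_⟧ = int ; +-homo = int-+ ; *-homo = int-* ; -‿homo = int-neg
    ; 0-homo = refl ; 1-homo = refl }

  int-≟ : ∀ i j → Maybe (int i ≈ int j)
  int-≟ i j with i ℤ.≟ j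
  ... | yes i≡j = just (reflexive (≡.cong int i≡j))
  ... | no _ = nothing

  open import Algebra.Solver.Ring ℤ.+-*-rawRing (almostCommutative R) int-homomorphism int-≟
    using (solve; _:=_; _:+_; _:*_; :-_; _:-_; con) public

-- Polynomial functions over a field

record IsField (R : CommutativeRing 0ℓ 0ℓ) : Set where
  open CommutativeRing R
  field
    _≈?_ : Decidable _≈_
    1≉0 : ¬ 1# ≈ 0#
    inverse : ∀ x → ¬ x ≈ 0# → ∃[ y ] x * y ≈ 1#

module FieldProperties (R : CommutativeRing 0ℓ 0ℓ) (isField : IsField R) where
  open CommutativeRing R hiding (zero)
  open IsField isField public
  open IntegerSolver R
  open import Relation.Binary.Reasoning.Setoid setoid
  open import Algebra.Properties.Semiring.Sum semiring public
    using (sum; sum-cong-≋; sum-remove; ∑-distrib-+; *-distribˡ-sum; sum-replicate-zero)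
  open import Algebra.Properties.CommutativeMonoid.Sum *-commutativeMonoid public
    using () renaming (sum to product; sum-remove to product-remove; sum-cong-≋ to product-cong)
  open import Data.Nat using (zero; suc)
  open import Data.Integer using (+_)
  open import Data.Fin using (Fin; zero; suc; punchIn)
  open import Data.Fin.Properties using (any?)
  open import Data.Product using (Σ; _×_; _,_)
  open import Data.Vec.Functional using (insertAt)
  open import Data.Vec.Functional.Properties using (insertAt-lookup; insertAt-punchIn)
  open import Function using (_∘_)
  open import Relation.Nullary using (yes; no; ¬?)
  open import Relation.Nullary.Decidable using (decidable-stable)
  import Relation.Binary.PropositionalEquality as ≡

  x-y≈0⇒x≈y : ∀ {x y} → x - y ≈ 0# → x ≈ y
  x-y≈0⇒x≈y {x} {y} x-y≈0 = begin
    x ≈⟨ solve 2 (λ x y → x := (x :- y) :+ y) refl x y ⟩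
    (x - y) + y ≈⟨ +-congʳ x-y≈0 ⟩
    0# + y ≈⟨ +-identityˡ y ⟩
    y ∎

  x≈y⇒x-y≈0 : ∀ {x y} → x ≈ y → x - y ≈ 0#
  x≈y⇒x-y≈0 {x} {y} x≈y = trans (+-congʳ x≈y) (-‿inverseʳ y)

  *-cancelˡ-≉0 : ∀ {x y z} → ¬ x ≈ 0# → x * y ≈ x * z → y ≈ z
  *-cancelˡ-≉0 {x} {y} {z} x≉0 xy≈xz with inverse x x≉0
  ... | x⁻¹ , xx⁻¹≈1 = begin
    y ≈⟨ *-identityˡ y ⟨
    1# * y ≈⟨ *-congʳ xx⁻¹≈1 ⟨
    x * x⁻¹ * y ≈⟨ swap x x⁻¹ y ⟩
    x⁻¹ * (x * y) ≈⟨ *-congˡ xy≈xz ⟩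
    x⁻¹ * (x * z) ≈⟨ swap x x⁻¹ z ⟨
    x * x⁻¹ * z ≈⟨ *-congʳ xx⁻¹≈1 ⟩
    1# * z ≈⟨ *-identityˡ z ⟩
    z ∎
    where
    swap : ∀ a b c → a * b * c ≈ b * (a * c)
    swap = solve 3 (λ a b c → a :* b :* c := b :* (a :* c)) refl

  *-≉0 : ∀ {x y} → ¬ x ≈ 0# → ¬ y ≈ 0# → ¬ x * y ≈ 0#
  *-≉0 {x} x≉0 y≉0 xy≈0 = y≉0 (*-cancelˡ-≉0 x≉0 (trans xy≈0 (sym (zeroʳ x))))

  product-≉0 : ∀ {n} (f : Fin n → Carrier) → (∀ i → ¬ f i ≈ 0#) → ¬ product f ≈ 0#
  product-≉0 {zero} f f≉0 = 1≉0
  product-≉0 {suc n} f f≉0 = *-≉0 (f≉0 zero) (product-≉0 (f ∘ suc) (f≉0 ∘ suc))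

  sum-zero : ∀ {n} {f : Fin n → Carrier} → (∀ i → f i ≈ 0#) → sum f ≈ 0#
  sum-zero {n} f≈0 = trans (sum-cong-≋ f≈0) (sum-replicate-zero n)

  private
    -- For a zero row `v = 0` satisfies the same identity, so the elimination below need not ask
    -- whether the row has a nonzero entry.
    pivot : ∀ {n} (r : Fin (suc n) → Carrier) →
      ∃[ j ] ∃[ v ] ∀ s → v * r j * r s ≈ r s
    pivot r with any? (λ j → ¬? (r j ≈? 0#))
    ... | yes (j , rj≉0) with inverse (r j) rj≉0
    ...   | v , rjv≈1 = j , v , λ s →
            trans (*-congʳ (trans (*-comm v (r j)) rjv≈1)) (*-identityˡ (r s))
    pivot r | no all-zero = zero , 0# , λ s →
      trans (*-congʳ (zeroˡ (r zero))) (trans (zeroˡ (r s)) (sym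
        (decidable-stable (r s ≈? 0#) (λ rs≉0 → all-zero (s , rs≉0)))))

  -- Gaussian elimination of one unknown: row zero clears column `j` in the other rows, the smaller
  -- system is solved, and the value at `j` is then forced by row zero. Nontriviality is inherited
  -- from the smaller solution.
  underdetermined : ∀ n (A : Fin n → Fin (suc n) → Carrier) →
    Σ (Fin (suc n) → Carrier) λ μ → (∃[ i ] ¬ μ i ≈ 0#) × (∀ k → sum (λ s → μ s * A k s) ≈ 0#)
  underdetermined zero A = (λ _ → 1#) , (zero , 1≉0) , λ ()
  underdetermined (suc n) A with pivot (A zero)
  ... | j , v , pivotal
    with underdetermined n (λ k s → A (suc k) (punchIn j s) - A (suc k) j * v * A zero (punchIn j s))
  ...   | ν , (i , νi≉0) , ν-solves = μ , (punchIn j i , μ≉0) , μ-solves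
    where
    entry : Fin (suc n) → Fin (suc n) → Carrier
    entry k s = ν s * A k (punchIn j s)

    Σ′ : Carrier
    Σ′ = sum (entry zero)

    μ : Fin (suc (suc n)) → Carrier
    μ = insertAt ν j (- (v * Σ′))

    μ≉0 : ¬ μ (punchIn j i) ≈ 0#
    μ≉0 = νi≉0 ∘ trans (reflexive (≡.sym (insertAt-punchIn ν j _ i)))

    expand : ∀ k → sum (λ s → μ s * A k s) ≈
      - (v * Σ′) * A k j + sum (entry k)
    expand k = begin
      sum (λ s → μ s * A k s)
        ≈⟨ sum-remove {i = j} (λ s → μ s * A k s) ⟩
      μ j * A k j + sum (λ s → μ (punchIn j s) * A k (punchIn j s))
        ≈⟨ +-cong (*-congʳ (reflexive (insertAt-lookup ν j _)))
             (sum-cong-≋ (λ s → *-congʳ {A k (punchIn j s)} (reflexive (insertAt-punchIn ν j (- (v * Σ′)) s)))) ⟩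
      - (v * Σ′) * A k j + sum (entry k) ∎

    μ-solves : ∀ k → sum (λ s → μ s * A k s) ≈ 0#
    μ-solves zero = begin
      sum (λ s → μ s * A zero s)
        ≈⟨ expand zero ⟩
      - (v * Σ′) * A zero j + Σ′
        ≈⟨ solve 3 (λ v S a → :- (v :* S) :* a :+ S := (:- (v :* a)) :* S :+ S) refl v Σ′ (A zero j) ⟩
      - (v * A zero j) * Σ′ + Σ′
        ≈⟨ +-congʳ (*-distribˡ-sum (- (v * A zero j)) (entry zero)) ⟩
      sum (λ s → - (v * A zero j) * entry zero s) + Σ′
        ≈⟨ ∑-distrib-+ (λ s → - (v * A zero j) * entry zero s) (entry zero) ⟨
      sum (λ s → - (v * A zero j) * entry zero s + entry zero s)
        ≈⟨ sum-zero (λ s → begin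
             - (v * A zero j) * entry zero s + entry zero s
               ≈⟨ solve 4 (λ v a n r → (:- (v :* a)) :* (n :* r) :+ n :* r := n :* (r :- v :* a :* r))
                    refl v (A zero j) (ν s) (A zero (punchIn j s)) ⟩
             ν s * (A zero (punchIn j s) - v * A zero j * A zero (punchIn j s))
               ≈⟨ *-congˡ (x≈y⇒x-y≈0 (sym (pivotal (punchIn j s)))) ⟩
             ν s * 0# ≈⟨ zeroʳ _ ⟩
             0# ∎) ⟩
      0# ∎
    μ-solves (suc k) = begin
      sum (λ s → μ s * A (suc k) s)
        ≈⟨ expand (suc k) ⟩
      - (v * Σ′) * A (suc k) j + sum (entry (suc k))
        ≈⟨ +-congʳ (solve 3 (λ v S a → :- (v :* S) :* a := (:- (a :* v)) :* S) refl v Σ′ (A (suc k) j)) ⟩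
      - (A (suc k) j * v) * Σ′ + sum (entry (suc k))
        ≈⟨ +-congʳ (*-distribˡ-sum (- (A (suc k) j * v)) (entry zero)) ⟩
      sum (λ s → - (A (suc k) j * v) * entry zero s) + sum (entry (suc k))
        ≈⟨ ∑-distrib-+ (λ s → - (A (suc k) j * v) * entry zero s) (entry (suc k)) ⟨
      sum (λ s → - (A (suc k) j * v) * entry zero s + entry (suc k) s)
        ≈⟨ sum-cong-≋ (λ s → solve 5 (λ a v n r b → (:- (a :* v)) :* (n :* r) :+ n :* b := n :* (b :- a :* v :* r))
             refl (A (suc k) j) v (ν s) (A zero (punchIn j s)) (A (suc k) (punchIn j s))) ⟩
      sum (λ s → ν s * (A (suc k) (punchIn j s) - A (suc k) j * v * A zero (punchIn j s)))
        ≈⟨ ν-solves k ⟩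
      0# ∎

module PolynomialSpaces (R : CommutativeRing 0ℓ 0ℓ) (isField : IsField R) (Point : Set) where
  open CommutativeRing R hiding (zero)
  open FieldProperties R isField
  open IntegerSolver R
  open import Relation.Binary.Reasoning.Setoid setoid
  open import Algebra.Properties.Semiring.Exp semiring using (_^_)
  open import Data.Nat as ℕ using (ℕ; zero; suc)
  open import Data.Fin using (Fin; zero; suc; punchIn)
  open import Data.Fin.Properties using (suc-injective; punchIn-injective)
  open import Data.Product using (_×_; _,_)
  open import Function using (_∘_)
  open import Relation.Binary.PropositionalEquality as ≡ using (_≡_; _≢_)

  Fn : Set
  Fn = Point → Carrier

  infix 4 _≋_
  infixl 6 _⊕_
  infixl 7 _⊗_

  _≋_ : Fn → Fn → Set
  f ≋ g = ∀ s → f s ≈ g s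

  _⊕_ _⊗_ : Fn → Fn → Fn
  (f ⊕ g) s = f s + g s
  (f ⊗ g) s = f s * g s

  const : Carrier → Fn
  const c _ = c

  linear : Fn → Carrier → Fn
  linear x a s = x s - a

  record Subspace (M : Fn → Set) : Set where
    field
      resp : ∀ {f g} → f ≋ g → M f → M g
      zero∈ : M (const 0#)
      ⊕-closed : ∀ {f g} → M f → M g → M (f ⊕ g)
      scale : ∀ c {f} → M f → M (const c ⊗ f)

  -- Combinations of 1, x, …, x^(e-1) with coefficients in M, in Horner form.
  data Poly (M : Fn → Set) (x : Fn) : ℕ → Fn → Set where
    nil : ∀ {f} → f ≋ const 0# → Poly M x 0 f
    horner : ∀ {e f g f′} → M g → Poly M x e f′ → f ≋ g ⊕ x ⊗ f′ → Poly M x (suc e) f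

  Poly-map : ∀ {M M′ : Fn → Set} {x} y → (∀ {g} → M g → M′ (y ⊗ g)) →
    ∀ {e f} → Poly M x e f → Poly M′ x e (y ⊗ f)
  Poly-map y y-maps (nil f≋0) = nil (λ s → trans (*-congˡ (f≋0 s)) (zeroʳ _))
  Poly-map {x = x} y y-maps (horner {g = g} {f′ = f′} Mg Pf′ f≋) =
    horner (y-maps Mg) (Poly-map y y-maps Pf′) (λ s → trans (*-congˡ (f≋ s))
      (solve 4 (λ y g x f → y :* (g :+ x :* f) := y :* g :+ x :* (y :* f)) refl (y s) (g s) (x s) (f′ s)))

  module _ {M : Fn → Set} (S : Subspace M) {x : Fn} where
    open Subspace S

    Poly-resp : ∀ {e f g} → f ≋ g → Poly M x e f → Poly M x e g
    Poly-resp f≋g (nil f≋0) = nil (λ s → trans (sym (f≋g s)) (f≋0 s))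
    Poly-resp f≋g (horner Mg Pf f≋) = horner Mg Pf (λ s → trans (sym (f≋g s)) (f≋ s))

    Poly-zero : ∀ e → Poly M x e (const 0#)
    Poly-zero zero = nil (λ s → refl)
    Poly-zero (suc e) = horner zero∈ (Poly-zero e) (λ s → sym (trans (+-identityˡ _) (zeroʳ _)))

    Poly-⊕ : ∀ {e f g} → Poly M x e f → Poly M x e g → Poly M x e (f ⊕ g)
    Poly-⊕ (nil f≋0) (nil g≋0) = nil (λ s → trans (+-cong (f≋0 s) (g≋0 s)) (+-identityˡ 0#))
    Poly-⊕ (horner {g = a} {f′ = u} Ma Pu f≋) (horner {g = b} {f′ = v} Mb Pv g≋) =
      horner (⊕-closed Ma Mb) (Poly-⊕ Pu Pv) (λ s → trans (+-cong (f≋ s) (g≋ s))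
        (solve 5 (λ a b x u v → (a :+ x :* u) :+ (b :+ x :* v) := (a :+ b) :+ x :* (u :+ v))
          refl (a s) (b s) (x s) (u s) (v s)))

    Poly-subspace : ∀ e → Subspace (Poly M x e)
    Poly-subspace e = record
      { resp = Poly-resp ; zero∈ = Poly-zero e ; ⊕-closed = Poly-⊕
      ; scale = λ c → Poly-map (const c) (scale c) }

    Poly-raise : ∀ {e f} → Poly M x e f → Poly M x (suc e) f
    Poly-raise (nil f≋0) = Poly-resp (λ s → sym (f≋0 s)) (Poly-zero 1)
    Poly-raise (horner Mg Pf f≋) = horner Mg (Poly-raise Pf) f≋

    Poly-shift : ∀ {e f} → Poly M x e f → Poly M x (suc e) (x ⊗ f)
    Poly-shift Pf = horner zero∈ Pf (λ s → sym (+-identityˡ _))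

    Poly-linear : ∀ a {e f} → Poly M x e f → Poly M x (suc e) (linear x a ⊗ f)
    Poly-linear a {f = f} Pf = Poly-resp
      (λ s → solve 3 (λ x a f → x :* f :+ (:- a) :* f := (x :- a) :* f) refl (x s) a (f s))
      (Poly-⊕ (Poly-shift Pf) (Poly-raise (Poly-map (const (- a)) (scale (- a)) Pf)))

    Poly-const : ∀ {e g} → M g → Poly M x (suc e) g
    Poly-const {e} Mg = horner Mg (Poly-zero e)
      (λ s → sym (trans (+-congˡ (zeroʳ _)) (+-identityʳ _)))

    -- Synthetic division. The node `a` is a scalar while the coefficients are functions, so closure
    -- of `M` under addition and scaling is enough.
    Poly-divide : ∀ a {m f} → Poly M x (suc m) f →
      ∃[ c ] ∃[ u ] M c × Poly M x m u × f ≋ c ⊕ linear x a ⊗ u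
    Poly-divide a (horner {g = g} {f′ = f′} Mg (nil f′≋0) f≋) =
      g , const 0# , Mg , nil (λ s → refl) , λ s → begin
        _ ≈⟨ f≋ s ⟩
        g s + x s * f′ s ≈⟨ +-congˡ (trans (*-congˡ (f′≋0 s)) (trans (zeroʳ _) (sym (zeroʳ _)))) ⟩
        g s + (x s - a) * 0# ∎
    Poly-divide a (horner {g = g} {f′ = f′} Mg Pf′@(horner _ _ _) f≋) with Poly-divide a Pf′
    ... | c , u , Mc , Pu , f′≋ =
      g ⊕ const a ⊗ c , c ⊕ x ⊗ u , ⊕-closed Mg (scale a Mc) , horner Mc Pu (λ s → refl) , λ s → begin
        _ ≈⟨ f≋ s ⟩
        g s + x s * f′ s ≈⟨ +-congˡ (*-congˡ (f′≋ s)) ⟩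
        g s + x s * (c s + (x s - a) * u s)
          ≈⟨ solve 5 (λ g x c a u → g :+ x :* (c :+ (x :- a) :* u) := (g :+ a :* c) :+ (x :- a) :* (c :+ x :* u))
               refl (g s) (x s) (c s) a (u s) ⟩
        (g s + a * c s) + (x s - a) * (c s + x s * u s) ∎

    -- Modulo `x - a` a product of linear factors may be replaced by its value at `a`; the induction
    -- keeps track of the degree of the quotient.
    linearProduct-divide : ∀ a {m} (b : Fin m → Carrier) {c} → M c → ∃[ u ] Poly M x m u ×
      (∀ s → c s * product (λ k → x s - b k) ≈ c s * product (λ k → a - b k) + (x s - a) * u s)
    linearProduct-divide a {zero} b Mc = const 0# , nil (λ s → refl) ,
      λ s → sym (trans (+-congˡ (zeroʳ _)) (+-identityʳ _))
    linearProduct-divide a {suc m} b {c} Mc with linearProduct-divide a (b ∘ suc) Mc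
    ... | u , Pu , c∏≈ =
      const w ⊗ c ⊕ linear x (b zero) ⊗ u , Poly-⊕ (Poly-const (scale w Mc)) (Poly-linear (b zero) Pu) ,
      λ s → begin
        c s * ((x s - b zero) * product (λ k → x s - b (suc k)))
          ≈⟨ solve 3 (λ c l p → c :* (l :* p) := l :* (c :* p)) refl (c s) (x s - b zero) _ ⟩
        (x s - b zero) * (c s * product (λ k → x s - b (suc k)))
          ≈⟨ *-congˡ (c∏≈ s) ⟩
        (x s - b zero) * (c s * w + (x s - a) * u s)
          ≈⟨ solve 6 (λ x b c w a u → (x :- b) :* (c :* w :+ (x :- a) :* u)
               := c :* ((a :- b) :* w) :+ (x :- a) :* (w :* c :+ (x :- b) :* u))
               refl (x s) (b zero) (c s) w a (u s) ⟩
        c s * ((a - b zero) * w) + (x s - a) * (w * c s + (x s - b zero) * u s) ∎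
      where w = product (λ k → a - b (suc k))

    -- Subtracting the multiple of the product that has the same remainder modulo `x - a` leaves a
    -- multiple of `x - a`. The scaling exists because the product does not vanish at `a`.
    newton-step : ∀ a {m} (b : Fin m → Carrier) → (∀ k → ¬ a ≈ b k) → ∀ {f} → Poly M x (suc m) f →
      ∃[ c ] ∃[ v ] M c × Poly M x m v ×
        (∀ s → f s ≈ c s * product (λ k → x s - b k) + (x s - a) * v s)
    newton-step a {m} b a≉b {f} Pf =
      let w = product (λ k → a - b k)
          w⁻¹ , ww⁻¹≈1 = inverse w (product-≉0 (λ k → a - b k) (λ k a-b≈0 → a≉b k (x-y≈0⇒x≈y a-b≈0)))
          c , u , Mc , Pu , f≋ = Poly-divide a Pf
          v , Pv , split = linearProduct-divide a b (scale w⁻¹ Mc)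
      in const w⁻¹ ⊗ c , u ⊕ const (- 1#) ⊗ v , scale w⁻¹ Mc ,
         Poly-⊕ Pu (Poly-map (const (- 1#)) (scale (- 1#)) Pv) ,
         λ s → sym (begin
           w⁻¹ * c s * product (λ k → x s - b k) + (x s - a) * (u s + - 1# * v s)
             ≈⟨ +-congʳ (split s) ⟩
           w⁻¹ * c s * w + (x s - a) * v s + (x s - a) * (u s + - 1# * v s)
             ≈⟨ cancel (w⁻¹ * c s * w) (x s - a) (v s) (u s) ⟩
           w⁻¹ * c s * w + (x s - a) * u s
             ≈⟨ +-congʳ (rotate w⁻¹ (c s) w) ⟩
           w * w⁻¹ * c s + (x s - a) * u s
             ≈⟨ +-congʳ (trans (*-congʳ ww⁻¹≈1) (*-identityˡ _)) ⟩
           c s + (x s - a) * u s ≈⟨ f≋ s ⟨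
           f s ∎)
      where
      open import Data.Integer using (+_)
      cancel : ∀ e l v u → e + l * v + l * (u + - 1# * v) ≈ e + l * u
      cancel = solve 4 (λ e l v u → e :+ l :* v :+ l :* (u :+ :- con (+ 1) :* v) := e :+ l :* u) refl
      rotate : ∀ w′ c w → w′ * c * w ≈ w * w′ * c
      rotate = solve 3 (λ w′ c w → w′ :* c :* w := w :* w′ :* c) refl

    -- Lagrange interpolation, phrased as an elimination into a closed predicate W.
    lagrange : ∀ {m} (a : Fin (suc m) → Carrier) → (∀ i j → i ≢ j → ¬ a i ≈ a j) →
      (W : Fn → Set) → (∀ {f g} → f ≋ g → W f → W g) → (∀ {f g} → W f → W g → W (f ⊕ g)) →
      (∀ i {g} → M g → W (λ s → g s * product (λ k → x s - a (punchIn i k)))) →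
      ∀ {f} → Poly M x (suc m) f → W f
    lagrange {zero} a distinct W W-resp W-⊕ W-gen (horner {g = g} {f′ = f′} Mg (nil f′≋0) f≋) =
      W-resp (λ s → begin
        g s * 1# ≈⟨ *-identityʳ _ ⟩
        g s ≈⟨ +-identityʳ _ ⟨
        g s + 0# ≈⟨ +-congˡ (trans (*-congˡ (f′≋0 s)) (zeroʳ _)) ⟨
        g s + x s * f′ s ≈⟨ f≋ s ⟨
        _ ∎) (W-gen zero Mg)
    lagrange {suc m} a distinct W W-resp W-⊕ W-gen {f} Pf =
      -- The tail `v` carries the factor `x - a zero`, so the induction runs on `W′`, which absorbs
      -- that factor; it is also the factor that the generators of the shorter node list lack.
      let c , v , Mc , Pv , f≋ = newton-step (a zero) (a ∘ suc) (λ k → distinct zero (suc k) (λ ())) Pf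
          tail∈W = lagrange (a ∘ suc) (λ i j i≢j → distinct (suc i) (suc j) (i≢j ∘ suc-injective)) W′
            (λ f≋g → W-resp (λ s → *-congˡ (f≋g s)))
            (λ Wf Wg → W-resp (λ s → sym (distribˡ _ _ _)) (W-⊕ Wf Wg))
            generators Pv
      in W-resp (λ s → sym (f≋ s)) (W-⊕ (W-gen zero Mc) tail∈W)
      where
      W′ : Fn → Set
      W′ g = W (linear x (a zero) ⊗ g)
      swap : ∀ g l p → g * (l * p) ≈ l * (g * p)
      swap = solve 3 (λ g l p → g :* (l :* p) := l :* (g :* p)) refl
      generators : ∀ i {g} → M g → W′ (λ s → g s * product (λ k → x s - a (suc (punchIn i k))))
      generators i {g} Mg = W-resp
        (λ s → swap (g s) (x s - a zero) (product (λ k → x s - a (suc (punchIn i k)))))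
        (W-gen (suc i) Mg)

    Poly-linearProduct : ∀ {m} (b : Fin m → Carrier) {g} → M g →
      Poly M x (suc m) (λ s → g s * product (λ k → x s - b k))
    Poly-linearProduct {zero} b Mg = Poly-const (resp (λ s → sym (*-identityʳ _)) Mg)
    Poly-linearProduct {suc m} b {g} Mg = Poly-resp
      (λ s → solve 3 (λ l g p → l :* (g :* p) := g :* (l :* p)) refl (x s - b zero) (g s) _)
      (Poly-linear (b zero) (Poly-linearProduct (b ∘ suc) Mg))

    Poly-split-top : ∀ {e f} → Poly M x (suc e) f →
      ∃[ u ] ∃[ g ] Poly M x e u × M g × (∀ s → f s ≈ u s + x s ^ e * g s)
    Poly-split-top (horner {g = g} {f′ = f′} Mg (nil f′≋0) f≋) =
      const 0# , g , nil (λ s → refl) , Mg , λ s → begin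
        _ ≈⟨ f≋ s ⟩
        g s + x s * f′ s ≈⟨ +-cong (sym (*-identityˡ _)) (trans (*-congˡ (f′≋0 s)) (zeroʳ _)) ⟩
        1# * g s + 0# ≈⟨ +-comm _ _ ⟩
        0# + 1# * g s ∎
    Poly-split-top (horner {g = g} {f′ = f′} Mg Pf′@(horner {e} _ _ _) f≋) with Poly-split-top Pf′
    ... | u , h , Pu , Mh , f′≋ = g ⊕ x ⊗ u , h , horner Mg Pu (λ s → refl) , Mh , λ s → begin
        _ ≈⟨ f≋ s ⟩
        g s + x s * f′ s ≈⟨ +-congˡ (*-congˡ (f′≋ s)) ⟩
        g s + x s * (u s + x s ^ e * h s)
          ≈⟨ solve 5 (λ g x u p h → g :+ x :* (u :+ p :* h) := g :+ x :* u :+ x :* p :* h)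
               refl (g s) (x s) (u s) (x s ^ e) (h s) ⟩
        g s + x s * u s + x s * x s ^ e * h s ∎

    -- The only power pushed out of range is `x ^ suc d`, which is constant and so returns in degree
    -- zero.
    Poly-power-closed : ∀ d {c} → (∀ s → x s ^ suc d ≈ c) →
      ∀ {f} → Poly M x (suc d) f → Poly M x (suc d) (x ⊗ f)
    Poly-power-closed d {c} x^d≈c {f} Pf with Poly-split-top Pf
    ... | u , g , Pu , Mg , f≋ = Poly-resp (λ s → sym (begin
        x s * f s ≈⟨ *-congˡ (f≋ s) ⟩
        x s * (u s + x s ^ d * g s)
          ≈⟨ solve 4 (λ x u p g → x :* (u :+ p :* g) := x :* u :+ x :* p :* g) refl (x s) (u s) (x s ^ d) (g s) ⟩
        x s * u s + x s ^ suc d * g s ≈⟨ +-congˡ (*-congʳ (x^d≈c s)) ⟩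
        x s * u s + c * g s ∎))
      (Poly-⊕ (Poly-shift Pu) (Poly-const (scale c Mg)))

  Poly-mono : ∀ {M M′ : Fn → Set} {x} → (∀ {g} → M g → M′ g) → ∀ {e f} → Poly M x e f → Poly M′ x e f
  Poly-mono M⊆M′ (nil f≋0) = nil f≋0
  Poly-mono M⊆M′ (horner Mg Pf f≋) = horner (M⊆M′ Mg) (Poly-mono M⊆M′ Pf) f≋

  -- Staircase degrees: the j-th variable counted from the end has degree below j + b.
  Staircase : ∀ {m} → (Fn → Set) → (Fin m → Fn) → ℕ → Fn → Set
  Staircase {zero} M x b = M
  Staircase {suc m} M x b = Poly (Staircase M (x ∘ suc) b) (x zero) (b ℕ.+ suc m)

  Distinct : ∀ {m n} → (Fin m → Fin n → Carrier) → Set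
  Distinct a = ∀ j i k → i ≢ k → ¬ a j i ≈ a j k

  rowProduct : ∀ {m n} → (Fin m → Fn) → (Fin m → Fin n → Carrier) → Fin n → Fn
  rowProduct x a i s = product (λ j → x j s - a j i)

  Staircase-map : ∀ {M M′ : Fn → Set} y → (∀ {g} → M g → M′ (y ⊗ g)) →
    ∀ {m} (x : Fin m → Fn) b {f} → Staircase M x b f → Staircase M′ x b (y ⊗ f)
  Staircase-map y y-maps {zero} x b Mf = y-maps Mf
  Staircase-map y y-maps {suc m} x b Pf = Poly-map y (Staircase-map y y-maps (x ∘ suc) b) Pf

  module _ {M : Fn → Set} (S : Subspace M) where

    Staircase-subspace : ∀ {m} (x : Fin m → Fn) b → Subspace (Staircase M x b)
    Staircase-subspace {zero} x b = S
    Staircase-subspace {suc m} x b = Poly-subspace (Staircase-subspace (x ∘ suc) b) (b ℕ.+ suc m)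

    Staircase-base : ∀ {m} (x : Fin m → Fn) {g} → M g → Staircase M x 1 g
    Staircase-base {zero} x Mg = Mg
    Staircase-base {suc m} x Mg =
      Poly-const (Staircase-subspace (x ∘ suc) 1) (Staircase-base (x ∘ suc) Mg)

    Staircase-raise : ∀ {m} (x : Fin m → Fn) {g} → Staircase M x 0 g → Staircase M x 1 g
    Staircase-raise {zero} x Mg = Mg
    Staircase-raise {suc m} x Pg =
      Poly-raise (Staircase-subspace (x ∘ suc) 1) (Poly-mono (Staircase-raise (x ∘ suc)) Pg)

    -- Each linear factor raises the degree in its own variable by one, which is exactly the gap
    -- between the staircases 0 and 1.
    Staircase-rowProduct : ∀ {m n} (x : Fin m → Fn) (a : Fin m → Fin n → Carrier) i {h} →
      Staircase M x 0 h → Staircase M x 1 (rowProduct x a i ⊗ h)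
    Staircase-rowProduct {zero} x a i Mh = Subspace.resp S (λ s → sym (*-identityˡ _)) Mh
    Staircase-rowProduct {suc m} x a i {h} Ph =
      Poly-resp S′ (λ s → sym (*-assoc (x zero s - a zero i) (rowProduct (x ∘ suc) (a ∘ suc) i s) (h s)))
        (Poly-linear S′ (a zero i)
          (Poly-map (rowProduct (x ∘ suc) (a ∘ suc) i) (Staircase-rowProduct (x ∘ suc) (a ∘ suc) i) Ph))
      where S′ = Staircase-subspace (x ∘ suc) 1

    -- Interpolating in the first variable leaves coefficients in the other variables, which are expanded
    -- along the rows other than the omitted node; each of these rows recovers its missing linear factor
    -- from the interpolation product.
    rowProducts-generate : ∀ {m} (x : Fin m → Fn) (a : Fin m → Fin (suc m) → Carrier) → Distinct a →
      (W : Fn → Set) → (∀ {f g} → f ≋ g → W f → W g) → (∀ {f g} → W f → W g → W (f ⊕ g)) →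
      (∀ i {h} → Staircase M x 0 h → W (rowProduct x a i ⊗ h)) →
      ∀ {g} → Staircase M x 1 g → W g
    rowProducts-generate {zero} x a distinct W W-resp W-⊕ W-gen Mg =
      W-resp (λ s → *-identityˡ _) (W-gen zero Mg)
    rowProducts-generate {suc m} x a distinct W W-resp W-⊕ W-gen =
      lagrange (Staircase-subspace (x ∘ suc) 1) (a zero) (distinct zero) W W-resp W-⊕ interpolate
      where
      omitting : Fin (suc (suc m)) → Fn
      omitting i s = product (λ k → x zero s - a zero (punchIn i k))

      interpolate : ∀ i {g} → Staircase M (x ∘ suc) 1 g → W (g ⊗ omitting i)
      interpolate i = rowProducts-generate (x ∘ suc) (λ j k → a (suc j) (punchIn i k))
        (λ j k l k≢l → distinct (suc j) (punchIn i k) (punchIn i l) (k≢l ∘ punchIn-injective i k l))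
        (λ u → W (u ⊗ omitting i))
        (λ f≋g → W-resp (λ s → *-congʳ (f≋g s)))
        (λ Wf Wg → W-resp (λ s → sym (distribʳ _ _ _)) (W-⊕ Wf Wg))
        generator
        where
        generator : ∀ k {h} → Staircase M (x ∘ suc) 0 h →
          W (rowProduct (x ∘ suc) (λ j k → a (suc j) (punchIn i k)) k ⊗ h ⊗ omitting i)
        -- The nodes other than `i` and `punchIn i k` number `m`, so the product over them has
        -- degree `m` in the first variable, just within the staircase 0.
        generator k {h} Th = W-resp eq (W-gen (punchIn i k)
          (Poly-linearProduct (Staircase-subspace (x ∘ suc) 0) (λ l → a zero (punchIn i (punchIn k l))) Th))
          where
          regroup : ∀ l p h r → l * p * (h * r) ≈ p * h * (l * r)
          regroup = solve 4 (λ l p h r → l :* p :* (h :* r) := p :* h :* (l :* r)) refl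
          eq : rowProduct x a (punchIn i k) ⊗ (λ s → h s * product (λ l → x zero s - a zero (punchIn i (punchIn k l))))
            ≋ rowProduct (x ∘ suc) (λ j k → a (suc j) (punchIn i k)) k ⊗ h ⊗ omitting i
          eq s = trans
            (regroup (x zero s - a zero (punchIn i k)) (rowProduct (x ∘ suc) (λ j k → a (suc j) (punchIn i k)) k s)
              (h s) (product (λ l → x zero s - a zero (punchIn i (punchIn k l)))))
            (*-congˡ (sym (product-remove {i = k} (λ k → x zero s - a zero (punchIn i k)))))

    module _ {m} (x₀ : Fn) (x : Fin m → Fn) (a₀ : Fin (suc m) → Carrier) (a : Fin m → Fin (suc m) → Carrier)
      (y : Fin (suc m) → Fn) (distinct : Distinct a)
      (y≋ : ∀ i → y i ≋ linear x₀ (a₀ i) ⊗ rowProduct x a i)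
      (M-closed : ∀ i {g} → M g → M (y i ⊗ g)) where

      private
        V : Fn → Set
        V = Staircase M x 1
        module V = Subspace (Staircase-subspace x 1)

      -- It suffices to multiply the generators `P ⊗ h` by `x₀`, where `P` is a row product. There
      -- `x₀ P = y + a₀ P`: the first term gives `y h`, which stays in `V` because `M` absorbs `y`,
      -- and the second is a scalar multiple of the generator.
      Staircase-x₀-closed : ∀ {g} → V g → V (x₀ ⊗ g)
      Staircase-x₀-closed = rowProducts-generate x a distinct (λ u → V (x₀ ⊗ u))
        (λ f≋g → V.resp (λ s → *-congˡ (f≋g s)))
        (λ Vf Vg → V.resp (λ s → sym (distribˡ _ _ _)) (V.⊕-closed Vf Vg))
        (λ i {h} Th → V.resp (eq i h) (V.⊕-closed
          (Staircase-map (y i) (M-closed i) x 1 (Staircase-raise x Th))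
          (V.scale (a₀ i) (Staircase-rowProduct x a i Th))))
        where
        expand : ∀ x a p h → (x - a) * p * h + a * (p * h) ≈ x * (p * h)
        expand = solve 4 (λ x a p h → (x :- a) :* p :* h :+ a :* (p :* h) := x :* (p :* h)) refl
        eq : ∀ i h → y i ⊗ h ⊕ const (a₀ i) ⊗ (rowProduct x a i ⊗ h) ≋ x₀ ⊗ (rowProduct x a i ⊗ h)
        eq i h s = trans (+-congʳ (*-congʳ (y≋ i s))) (expand (x₀ s) (a₀ i) (rowProduct x a i s) (h s))

      Staircase-linearProduct : M (const 1#) → ∀ {n} (b : Fin n → Carrier) →
        V (λ s → product (λ k → x₀ s - b k))
      Staircase-linearProduct M1 {zero} b = Staircase-base x M1
      Staircase-linearProduct M1 {suc n} b =
        V.resp (λ s → eq (x₀ s) (b zero) (product (λ k → x₀ s - b (suc k))))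
          (V.⊕-closed (Staircase-x₀-closed ih) (V.scale (- b zero) ih))
        where
        ih = Staircase-linearProduct M1 (b ∘ suc)
        eq : ∀ x b p → x * p + (- b) * p ≈ (x - b) * p
        eq = solve 3 (λ x b p → x :* p :+ (:- b) :* p := (x :- b) :* p) refl

  Powers : ∀ {n} → ℕ → (Fin n → Fn) → Fn → Set
  Powers {zero} d y f = ∃[ c ] f ≋ const c
  Powers {suc n} d y = Poly (Powers d (y ∘ suc)) (y zero) d

  Powers-subspace : ∀ {n} d (y : Fin n → Fn) → Subspace (Powers d y)
  Powers-subspace {zero} d y = record
    { resp = λ { f≋g (c , f≋c) → c , λ s → trans (sym (f≋g s)) (f≋c s) }
    ; zero∈ = 0# , λ s → refl
    ; ⊕-closed = λ { (c , f≋c) (c′ , g≋c′) → c + c′ , λ s → +-cong (f≋c s) (g≋c′ s) }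
    ; scale = λ { c (c′ , f≋c′) → c * c′ , λ s → *-congˡ (f≋c′ s) } }
  Powers-subspace {suc n} d y = Poly-subspace (Powers-subspace d (y ∘ suc)) d

  Powers-closed : ∀ d {n} (y : Fin n → Fn) → (∀ i → ∃[ c ] (∀ s → y i s ^ suc d ≈ c)) →
    ∀ i {f} → Powers (suc d) y f → Powers (suc d) y (y i ⊗ f)
  Powers-closed d y y^d≈ zero =
    let c , y^d≈c = y^d≈ zero in Poly-power-closed (Powers-subspace (suc d) (y ∘ suc)) d y^d≈c
  Powers-closed d y y^d≈ (suc i) = Poly-map (y (suc i)) (Powers-closed d (y ∘ suc) (y^d≈ ∘ suc) i)

  Powers-one : ∀ d {n} (y : Fin n → Fn) → Powers (suc d) y (const 1#)
  Powers-one d {zero} y = 1# , λ s → refl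
  Powers-one d {suc n} y = Poly-const (Powers-subspace (suc d) (y ∘ suc)) (Powers-one d (y ∘ suc))

-- Bounding the number of solutions by a dimension

module FiberBound (R : CommutativeRing 0ℓ 0ℓ) (isField : IsField R) where
  open CommutativeRing R hiding (zero)
  open FieldProperties R isField
  open IntegerSolver R
  open import Relation.Binary.Reasoning.Setoid setoid
  open import Algebra.Properties.Semiring.Exp semiring using (_^_)
  open import Data.Nat as ℕ using (ℕ; zero; suc; _!)
  import Data.Nat.Properties
  open import Data.Fin using (Fin; zero; suc; toℕ; punchIn; combine; remQuot)
  open import Data.Fin.Properties using (punchInᵢ≢i; remQuot-combine)
  open import Data.Product using (Σ; _×_; _,_; proj₁; proj₂)
  open import Function using (_∘_)
  open import Relation.Binary.PropositionalEquality as ≡ using (_≡_; _≢_)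

  product-zero : ∀ {n} (f : Fin n → Carrier) i → f i ≈ 0# → product f ≈ 0#
  product-zero f zero f₀≈0 = trans (*-congʳ f₀≈0) (zeroˡ _)
  product-zero f (suc i) fᵢ≈0 = trans (*-congˡ (product-zero (f ∘ suc) i fᵢ≈0)) (zeroʳ _)

  module _ {L : ℕ} where
    open PolynomialSpaces R isField (Fin L)

    Kills : Fn → Fn → Set
    Kills μ f = sum (λ s → μ s * f s) ≈ 0#

    Kills-resp : ∀ {μ f g} → f ≋ g → Kills μ f → Kills μ g
    Kills-resp {μ} {f} {g} f≋g μf≈0 =
      trans (sum-cong-≋ {L} {λ s → μ s * g s} {λ s → μ s * f s} (λ s → *-congˡ (sym (f≋g s)))) μf≈0

    -- Spanning is stated dually, through functionals vanishing on the `N` functions. No linear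
    -- combinations have to be exhibited, and `underdetermined` supplies precisely such a
    -- functional.
    SpannedBy : (Fn → Set) → ℕ → Set
    SpannedBy M N = Σ (Fin N → Fn) λ B → ∀ μ → (∀ k → Kills μ (B k)) → ∀ {f} → M f → Kills μ f

    Poly-killed : ∀ {M N} (sp : SpannedBy M N) x e μ →
      (∀ (i : Fin e) k → Kills μ (λ s → x s ^ toℕ i * proj₁ sp k s)) →
      ∀ {f} → Poly M x e f → Kills μ f
    Poly-killed sp x zero μ _ (nil f≋0) = sum-zero (λ s → trans (*-congˡ (f≋0 s)) (zeroʳ _))
    Poly-killed sp x (suc e) μ kills {f} (horner {g = g} {f′ = f′} Mg Pf′ f≋) = begin
      sum (λ s → μ s * f s)
        ≈⟨ sum-cong-≋ {L} (λ s → trans (*-congˡ (f≋ s)) (expand (μ s) (g s) (x s) (f′ s))) ⟩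
      sum (λ s → μ s * g s + μ s * x s * f′ s)
        ≈⟨ ∑-distrib-+ (λ s → μ s * g s) (λ s → μ s * x s * f′ s) ⟩
      sum (λ s → μ s * g s) + sum (λ s → μ s * x s * f′ s)
        ≈⟨ +-cong
             (proj₂ sp μ (λ k → Kills-resp {μ} (λ s → CommutativeRing.*-identityˡ R _) (kills zero k)) Mg)
             -- The factor `x` moves from the function into the functional, which lowers every
             -- exponent in the hypothesis by one.
             (Poly-killed sp x e (μ ⊗ x) (λ i k →
               trans (sum-cong-≋ {L} (λ s → regroup (μ s) (x s) (x s ^ toℕ i) (proj₁ sp k s))) (kills (suc i) k)) Pf′) ⟩
      0# + 0# ≈⟨ +-identityˡ 0# ⟩
      0# ∎
      where
      expand : ∀ m g x f → m * (g + x * f) ≈ m * g + m * x * f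
      expand = solve 4 (λ m g x f → m :* (g :+ x :* f) := m :* g :+ m :* x :* f) refl
      regroup : ∀ m x p b → m * x * (p * b) ≈ m * (x * p * b)
      regroup = solve 4 (λ m x p b → m :* x :* (p :* b) := m :* (x :* p :* b)) refl

    Poly-spanned : ∀ {M N} x e → SpannedBy M N → SpannedBy (Poly M x e) (e ℕ.* N)
    Poly-spanned {M} {N} x e sp = (λ ik → basis (remQuot N ik)) , λ μ kills →
      Poly-killed sp x e μ (λ i k → ≡.subst (λ ik → Kills μ (basis ik)) (remQuot-combine i k) (kills (combine i k)))
      where
      basis : Fin e × Fin N → Fn
      basis (i , k) s = x s ^ toℕ i * proj₁ sp k s

    Powers-spanned : ∀ {n} d (y : Fin n → Fn) → SpannedBy (Powers d y) (d ℕ.^ n)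
    Powers-spanned {zero} d y = (λ _ → const 1#) , λ { μ kills {f} (c , f≋c) → begin
      sum (λ s → μ s * f s)
        ≈⟨ sum-cong-≋ {L} (λ s → trans (*-congˡ (f≋c s)) (trans (*-comm _ _) (*-congˡ (sym (*-identityʳ _))))) ⟩
      sum (λ s → c * (μ s * 1#)) ≈⟨ *-distribˡ-sum {L} c (λ s → μ s * 1#) ⟨
      c * sum (λ s → μ s * 1#) ≈⟨ *-congˡ (kills zero) ⟩
      c * 0# ≈⟨ zeroʳ c ⟩
      0# ∎ }
    Powers-spanned {suc n} d y = Poly-spanned (y zero) d (Powers-spanned d (y ∘ suc))

    Staircase-spanned : ∀ {M N m} (x : Fin m → Fn) → SpannedBy M N →
      SpannedBy (Staircase M x 1) ((suc m) ! ℕ.* N)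
    Staircase-spanned {M} {N} {zero} x sp = ≡.subst (SpannedBy M) (≡.sym (Data.Nat.Properties.*-identityˡ N)) sp
    Staircase-spanned {M} {N} {suc m} x sp =
      ≡.subst (SpannedBy (Staircase M x 1)) (≡.sym (Data.Nat.Properties.*-assoc (suc (suc m)) (suc m !) N))
        (Poly-spanned (x zero) (suc (suc m)) (Staircase-spanned (x ∘ suc) sp))

  -- A functional vanishing on V vanishes on every product of x₀ - x₀(s′) over all s′ ≠ s, so it is zero;
  -- hence V cannot be spanned by fewer functions than there are points.
  fiber-bound : ∀ {m} d → let L = suc ((suc m) ! ℕ.* suc d ℕ.^ suc m) in
    let open PolynomialSpaces R isField (Fin L) in
    (x₀ : Fn) (x : Fin m → Fn) (a₀ : Fin (suc m) → Carrier) (a : Fin m → Fin (suc m) → Carrier)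
    (y : Fin (suc m) → Fn) → Distinct a →
    (∀ i → y i ≋ linear x₀ (a₀ i) ⊗ rowProduct x a i) →
    (∀ i → ∃[ c ] (∀ s → y i s ^ suc d ≈ c)) →
    ¬ (∀ s s′ → s ≢ s′ → ¬ x₀ s ≈ x₀ s′)
  fiber-bound {m} d x₀ x a₀ a y distinct y≋ y^d≈ x₀-distinct =
    let B , span = Staircase-spanned x (Powers-spanned (suc d) y)
        μ , (s₀ , μ≉0) , solves = underdetermined _ B
        killed = span μ solves (V-omitting s₀)
    in *-≉0 μ≉0 (product-≉0 _ (λ k x-x≈0 →
         x₀-distinct s₀ (punchIn s₀ k) (≡.≢-sym (punchInᵢ≢i s₀ k)) (x-y≈0⇒x≈y x-x≈0)))
       (begin
         μ s₀ * omitting s₀ s₀ ≈⟨ +-identityʳ _ ⟨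
         μ s₀ * omitting s₀ s₀ + 0# ≈⟨ +-congˡ (sum-zero (λ k →
           trans (*-congˡ {μ (punchIn s₀ k)} (product-zero _ k (-‿inverseʳ _))) (zeroʳ _))) ⟨
         μ s₀ * omitting s₀ s₀ + sum (λ k → μ (punchIn s₀ k) * omitting s₀ (punchIn s₀ k))
           ≈⟨ sum-remove {i = s₀} (λ s → μ s * omitting s₀ s) ⟨
         sum (λ s → μ s * omitting s₀ s) ≈⟨ killed ⟩
         0# ∎)
    where
    open PolynomialSpaces R isField (Fin (suc ((suc m) ! ℕ.* suc d ℕ.^ suc m)))
    omitting : Fin (suc ((suc m) ! ℕ.* suc d ℕ.^ suc m)) → Fn
    omitting s₀ s = product (λ k → x₀ s - x₀ (punchIn s₀ k))
    V-omitting : ∀ s₀ → Staircase (Powers (suc d) y) x 1 (omitting s₀)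
    V-omitting s₀ = Staircase-linearProduct (Powers-subspace (suc d) y) x₀ x a₀ a y distinct y≋
      (Powers-closed d y y^d≈) (Powers-one d y) (x₀ ∘ punchIn s₀)

-- Finite fields

module BinomialDivisibility where
  open import Data.Nat
  open import Data.Nat.Properties
  open import Data.Nat.Divisibility using (_∣_; divides; ∣⇒≤)
  open import Data.Nat.Primality using (euclidsLemma)
  open import Data.Nat.Combinatorics using (_C_; nC1≡n; nCk+nC[k+1]≡[n+1]C[k+1]; k>n⇒nCk≡0)
  open import Data.Nat.Solver using (module +-*-Solver)
  open import Data.Sum using (inj₁; inj₂)
  open import Data.Empty using (⊥-elim)
  open import Relation.Binary.PropositionalEquality
  open +-*-Solver using (solve; _:=_; _:+_; _:*_; con)

  C-absorption : ∀ n k → suc k * (suc n C suc k) ≡ suc n * (n C k)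
  C-absorption n zero rewrite nC1≡n (suc n) = cong suc (trans (+-identityʳ n) (sym (*-identityʳ n)))
  C-absorption zero (suc k)
    rewrite k>n⇒nCk≡0 {1} {suc (suc k)} (s≤s (s≤s z≤n)) | k>n⇒nCk≡0 {0} {suc k} (s≤s z≤n) = *-zeroʳ k
  C-absorption (suc n) (suc k) = begin
    suc (suc k) * (suc (suc n) C suc (suc k))
      ≡⟨ cong (suc (suc k) *_) (nCk+nC[k+1]≡[n+1]C[k+1] (suc n) (suc k)) ⟨
    suc (suc k) * (a + b)
      ≡⟨ solve 3 (λ k a b → (con 2 :+ k) :* (a :+ b) := (con 1 :+ k) :* a :+ a :+ (con 2 :+ k) :* b) refl k a b ⟩
    suc k * a + a + suc (suc k) * b
      ≡⟨ cong₂ (λ u v → u + a + v) (C-absorption n k) (C-absorption n (suc k)) ⟩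
    suc n * c + a + suc n * (n C suc k)
      ≡⟨ solve 4 (λ n c a e → (con 1 :+ n) :* c :+ a :+ (con 1 :+ n) :* e := a :+ (con 1 :+ n) :* (c :+ e))
           refl n c a (n C suc k) ⟩
    a + suc n * (c + n C suc k) ≡⟨ cong (λ u → a + suc n * u) (nCk+nC[k+1]≡[n+1]C[k+1] n k) ⟩
    suc (suc n) * a ∎
    where
    open ≡-Reasoning
    a = suc n C suc k
    b = suc n C suc (suc k)
    c = n C k

  -- By absorption the prime divides the binomial coefficient times `suc k`, and `suc k` is positive
  -- and too small to be divisible by it.
  prime∣C : ∀ {n} k → Prime (suc n) → k < n → suc n ∣ suc n C suc k
  prime∣C {n} k p-prime k<n with euclidsLemma (suc k) (suc n C suc k) p-prime
    (divides (n C k) (trans (C-absorption n k) (*-comm (suc n) (n C k))))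
  ... | inj₁ n+1∣k+1 = ⊥-elim (<⇒≱ k<n (s≤s⁻¹ (∣⇒≤ n+1∣k+1)))
  ... | inj₂ n+1∣C = n+1∣C

-- The Frobenius map

module Frobenius (R : CommutativeRing 0ℓ 0ℓ) where
  open CommutativeRing R hiding (zero)
  open IntegerSolver R
  open BinomialDivisibility
  open import Relation.Binary.Reasoning.Setoid setoid
  open import Algebra.Properties.Semiring.Exp semiring using (_^_; ^-congˡ; ^-assocʳ)
  open import Algebra.Properties.Semiring.Mult semiring using (×-assoc-*; ×-assocˡ; ×-congˡ; ×-congʳ; ×-homo-1) renaming (_×_ to _×ᴿ_)
  open import Algebra.Properties.Semiring.Sum semiring using (sum; sum-cong-≋; sum-replicate-zero; sum-init-last)
  open import Algebra.Properties.CommutativeSemiring.Binomial commutativeSemiring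
    using (binomialTerm; theorem)
  open import Data.Nat as ℕ using (ℕ; zero; suc)
  open import Data.Nat.Divisibility using (_∣_; divides)
  open import Data.Nat.Combinatorics using (_C_; nCn≡1)
  import Data.Nat.Properties as ℕ
  open import Data.Fin using (Fin; zero; suc; toℕ; fromℕ; inject₁)
  open import Data.Fin.Properties using (toℕ-fromℕ; toℕ-inject₁; toℕ<n)
  open import Data.Nat.Primality using (¬prime[0])
  open import Data.Empty using (⊥-elim)
  open import Relation.Binary.PropositionalEquality as ≡ using (_≡_)

  ×-zero : ∀ {p} n x → p ×ᴿ 1# ≈ 0# → p ∣ n → n ×ᴿ x ≈ 0#
  ×-zero {p} n x p≈0 (divides k n≡kp) = begin
    n ×ᴿ x ≈⟨ ×-congˡ (≡.trans n≡kp (ℕ.*-comm k p)) ⟩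
    (p ℕ.* k) ×ᴿ x ≈⟨ ×-assocˡ x p k ⟨
    p ×ᴿ (k ×ᴿ x) ≈⟨ trans (×-assoc-* p 1# _) (×-congʳ p (*-identityˡ _)) ⟨
    (p ×ᴿ 1#) * (k ×ᴿ x) ≈⟨ *-congʳ p≈0 ⟩
    0# * (k ×ᴿ x) ≈⟨ zeroˡ _ ⟩
    0# ∎

  frobenius-+ : ∀ {p} → Prime p → p ×ᴿ 1# ≈ 0# → ∀ x y → (x + y) ^ p ≈ x ^ p + y ^ p
  frobenius-+ {zero} p-prime _ x y = ⊥-elim (¬prime[0] p-prime)
  frobenius-+ {suc n} p-prime p≈0 x y = begin
    (x + y) ^ suc n ≈⟨ theorem (suc n) x y ⟩
    term zero + sum (λ i → term (suc i)) ≈⟨ +-congˡ (sum-init-last (λ i → term (suc i))) ⟩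
    term zero + (sum (λ i → term (suc (inject₁ i))) + term (suc (fromℕ n)))
      ≈⟨ +-cong first (+-cong (trans (sum-cong-≋ {n} middle) (sum-replicate-zero n)) last) ⟩
    y ^ suc n + (0# + x ^ suc n) ≈⟨ +-congˡ (+-identityˡ _) ⟩
    y ^ suc n + x ^ suc n ≈⟨ +-comm _ _ ⟩
    x ^ suc n + y ^ suc n ∎
    where
    term = binomialTerm x y (suc n)
    first : term zero ≈ y ^ suc n
    first = trans (×-homo-1 _) (*-identityˡ _)
    middle : ∀ i → term (suc (inject₁ i)) ≈ 0#
    middle i = ×-zero (suc n C suc (toℕ (inject₁ i))) _ p≈0
      (prime∣C (toℕ (inject₁ i)) p-prime (≡.subst (ℕ._< n) (≡.sym (toℕ-inject₁ i)) (toℕ<n i)))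
    last : term (suc (fromℕ n)) ≈ x ^ suc n
    last rewrite toℕ-fromℕ n | nCn≡1 (suc n) | ℕ.n∸n≡0 n = trans (×-homo-1 _) (*-identityʳ _)

  module _ {p} (p-prime : Prime p) (p≈0 : p ×ᴿ 1# ≈ 0#) where

    frobenius^-+ : ∀ e x y → (x + y) ^ (p ℕ.^ e) ≈ x ^ (p ℕ.^ e) + y ^ (p ℕ.^ e)
    frobenius^-+ zero x y = trans (*-identityʳ _) (sym (+-cong (*-identityʳ x) (*-identityʳ y)))
    frobenius^-+ (suc e) x y = begin
      (x + y) ^ (p ℕ.* q) ≈⟨ ^-assocʳ (x + y) p q ⟨
      ((x + y) ^ p) ^ q ≈⟨ ^-congˡ q (frobenius-+ p-prime p≈0 x y) ⟩
      (x ^ p + y ^ p) ^ q ≈⟨ frobenius^-+ e (x ^ p) (y ^ p) ⟩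
      (x ^ p) ^ q + (y ^ p) ^ q ≈⟨ +-cong (^-assocʳ x p q) (^-assocʳ y p q) ⟩
      x ^ (p ℕ.* q) + y ^ (p ℕ.* q) ∎
      where q = p ℕ.^ e

    -- Additivity is applied to `(x - y) + y`, so the sign `(-1)^q` need not be computed.
    frobenius^-sub : ∀ e x y → (x - y) ^ (p ℕ.^ e) ≈ x ^ (p ℕ.^ e) - y ^ (p ℕ.^ e)
    frobenius^-sub e x y = begin
      (x - y) ^ q ≈⟨ solve 2 (λ u v → u := u :+ v :- v) refl ((x - y) ^ q) (y ^ q) ⟩
      (x - y) ^ q + y ^ q - y ^ q ≈⟨ +-congʳ (frobenius^-+ e (x - y) y) ⟨
      (x - y + y) ^ q - y ^ q ≈⟨ +-congʳ (^-congˡ q (solve 2 (λ x y → x :- y :+ y := x) refl x y)) ⟩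
      x ^ q - y ^ q ∎
      where q = p ℕ.^ e

module Quotient (R : CommutativeRing 0ℓ 0ℓ) (J : CommutativeRing.Carrier R → Set)
  (J-resp : ∀ {x y} → CommutativeRing._≈_ R x y → J x → J y)
  (J-zero : J (CommutativeRing.0# R))
  (J-+ : ∀ {x y} → J x → J y → J (CommutativeRing._+_ R x y))
  (J-* : ∀ x {y} → J y → J (CommutativeRing._*_ R x y)) where
  open CommutativeRing R hiding (zero)
  open IntegerSolver R
  open import Data.Product using (_,_)

  infix 4 _∼_
  _∼_ : Carrier → Carrier → Set
  x ∼ y = J (x - y)

  ≈⇒∼ : ∀ {x y} → x ≈ y → x ∼ y
  ≈⇒∼ x≈y = J-resp (sym (trans (+-congʳ x≈y) (-‿inverseʳ _))) J-zero

  J-neg : ∀ {x y} → x ≈ - y → J y → J x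
  J-neg {y = y} x≈-y Jy = J-resp (trans (-1*x≈-x y) (sym x≈-y)) (J-* (- 1#) Jy)
    where open import Algebra.Properties.Ring ring using (-1*x≈-x)

  quotient : CommutativeRing 0ℓ 0ℓ
  quotient = record
    { Carrier = Carrier ; _≈_ = _∼_ ; _+_ = _+_ ; _*_ = _*_ ; -_ = -_ ; 0# = 0# ; 1# = 1#
    ; isCommutativeRing = record
      { isRing = record
        { +-isAbelianGroup = record
          { isGroup = record
            { isMonoid = record
              { isSemigroup = record
                { isMagma = record
                  { isEquivalence = record
                    { refl = ≈⇒∼ refl
                    ; sym = λ {x} {y} → J-neg (solve 2 (λ x y → y :- x := :- (x :- y)) refl x y)
                    ; trans = λ {x} {y} {z} p q →
                        J-resp (solve 3 (λ x y z → x :- y :+ (y :- z) := x :- z) refl x y z) (J-+ p q) }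
                  ; ∙-cong = λ {x} {y} {u} {v} p q →
                      J-resp (solve 4 (λ x y u v → x :- y :+ (u :- v) := x :+ u :- (y :+ v)) refl x y u v) (J-+ p q) }
                ; assoc = λ x y z → ≈⇒∼ (+-assoc x y z) }
              ; identity = (λ x → ≈⇒∼ (+-identityˡ x)) , (λ x → ≈⇒∼ (+-identityʳ x)) }
            ; inverse = (λ x → ≈⇒∼ (-‿inverseˡ x)) , (λ x → ≈⇒∼ (-‿inverseʳ x))
            ; ⁻¹-cong = λ {x} {y} → J-neg (solve 2 (λ x y → :- x :- (:- y) := :- (x :- y)) refl x y) }
          ; comm = λ x y → ≈⇒∼ (+-comm x y) }
        ; *-cong = λ {x} {y} {u} {v} p q → J-resp
            (solve 4 (λ x y u v → u :* (x :- y) :+ y :* (u :- v) := x :* u :- y :* v) refl x y u v)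
            (J-+ (J-* u p) (J-* y q))
        ; *-assoc = λ x y z → ≈⇒∼ (*-assoc x y z)
        ; *-identity = (λ x → ≈⇒∼ (*-identityˡ x)) , (λ x → ≈⇒∼ (*-identityʳ x))
        ; distrib = (λ x y z → ≈⇒∼ (distribˡ x y z)) , (λ x y z → ≈⇒∼ (distribʳ x y z)) }
      ; *-comm = λ x y → ≈⇒∼ (*-comm x y) } }

-- Cyclic groups and group rings

module CyclicGroup (n : ℕ) where
  open import Data.Nat using (_+_; _∸_; _%_)
  open import Data.Nat.Properties using (+-assoc; +-comm; m∸n+n≡m; <⇒≤)
  open import Data.Nat.DivMod using (_mod_; m%n<n; m<n⇒m%n≡m; %-distribˡ-+; m%n%n≡m%n; n%n≡0)
  open import Data.Fin using (toℕ)
  open import Data.Fin.Properties using (toℕ-fromℕ<; toℕ-injective; toℕ<n)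
  open import Data.Product using (_,_)
  open import Relation.Binary.PropositionalEquality
  open ≡-Reasoning

  N = suc n

  infixl 6 _∙_
  _∙_ : Fin N → Fin N → Fin N
  i ∙ j = (toℕ i + toℕ j) mod N

  _⁻¹ : Fin N → Fin N
  i ⁻¹ = (N ∸ toℕ i) mod N

  toℕ-mod : ∀ m → toℕ (m mod N) ≡ m % N
  toℕ-mod m = toℕ-fromℕ< (m%n<n m N)

  %-absorbˡ : ∀ a b → (a % N + b) % N ≡ (a + b) % N
  %-absorbˡ a b = begin
    (a % N + b) % N ≡⟨ %-distribˡ-+ (a % N) b N ⟩
    (a % N % N + b % N) % N ≡⟨ cong (λ c → (c + b % N) % N) (m%n%n≡m%n a N) ⟩
    (a % N + b % N) % N ≡⟨ %-distribˡ-+ a b N ⟨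
    (a + b) % N ∎

  %-absorbʳ : ∀ a b → (a + b % N) % N ≡ (a + b) % N
  %-absorbʳ a b = begin
    (a + b % N) % N ≡⟨ cong (_% N) (+-comm a (b % N)) ⟩
    (b % N + a) % N ≡⟨ %-absorbˡ b a ⟩
    (b + a) % N ≡⟨ cong (_% N) (+-comm b a) ⟩
    (a + b) % N ∎

  toℕ-∙ : ∀ i j → toℕ (i ∙ j) ≡ (toℕ i + toℕ j) % N
  toℕ-∙ i j = toℕ-mod (toℕ i + toℕ j)

  ∙-comm : ∀ i j → i ∙ j ≡ j ∙ i
  ∙-comm i j = cong (_mod N) (+-comm (toℕ i) (toℕ j))

  ∙-identityˡ : ∀ i → zero ∙ i ≡ i
  ∙-identityˡ i = toℕ-injective (trans (toℕ-mod (toℕ i)) (m<n⇒m%n≡m (toℕ<n i)))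

  ∙-assoc : ∀ i j k → (i ∙ j) ∙ k ≡ i ∙ (j ∙ k)
  ∙-assoc i j k = toℕ-injective (begin
    toℕ (i ∙ j ∙ k) ≡⟨ toℕ-∙ (i ∙ j) k ⟩
    (toℕ (i ∙ j) + toℕ k) % N ≡⟨ cong (λ c → (c + toℕ k) % N) (toℕ-∙ i j) ⟩
    ((toℕ i + toℕ j) % N + toℕ k) % N ≡⟨ %-absorbˡ (toℕ i + toℕ j) (toℕ k) ⟩
    (toℕ i + toℕ j + toℕ k) % N ≡⟨ cong (_% N) (+-assoc (toℕ i) (toℕ j) (toℕ k)) ⟩
    (toℕ i + (toℕ j + toℕ k)) % N ≡⟨ %-absorbʳ (toℕ i) (toℕ j + toℕ k) ⟨
    (toℕ i + (toℕ j + toℕ k) % N) % N ≡⟨ cong (λ c → (toℕ i + c) % N) (toℕ-∙ j k) ⟨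
    (toℕ i + toℕ (j ∙ k)) % N ≡⟨ toℕ-∙ i (j ∙ k) ⟨
    toℕ (i ∙ (j ∙ k)) ∎)

  ∙-inverseˡ : ∀ i → i ⁻¹ ∙ i ≡ zero
  ∙-inverseˡ i = toℕ-injective (begin
    toℕ (i ⁻¹ ∙ i) ≡⟨ toℕ-∙ (i ⁻¹) i ⟩
    (toℕ (i ⁻¹) + toℕ i) % N ≡⟨ cong (λ c → (c + toℕ i) % N) (toℕ-mod (N ∸ toℕ i)) ⟩
    ((N ∸ toℕ i) % N + toℕ i) % N ≡⟨ %-absorbˡ (N ∸ toℕ i) (toℕ i) ⟩
    (N ∸ toℕ i + toℕ i) % N ≡⟨ cong (_% N) (m∸n+n≡m (<⇒≤ (toℕ<n i))) ⟩
    N % N ≡⟨ n%n≡0 N ⟩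
    0 ∎)

  isAbelianGroup : IsAbelianGroup _≡_ _∙_ zero _⁻¹
  isAbelianGroup = record
    { isGroup = record
      { isMonoid = record
        { isSemigroup = record
          { isMagma = record { isEquivalence = isEquivalence ; ∙-cong = cong₂ _∙_ }
          ; assoc = ∙-assoc }
        ; identity = ∙-identityˡ , λ i → trans (∙-comm i zero) (∙-identityˡ i) }
      ; inverse = ∙-inverseˡ , λ i → trans (∙-comm i (i ⁻¹)) (∙-inverseˡ i)
      ; ⁻¹-cong = cong _⁻¹ }
    ; comm = ∙-comm }

module GroupRing (A : CommutativeRing 0ℓ 0ℓ) {n : ℕ}
  {_∙_ : Fin (suc n) → Fin (suc n) → Fin (suc n)} {_⁻¹ : Fin (suc n) → Fin (suc n)}
  (isAbelianGroup : IsAbelianGroup _≡_ _∙_ zero _⁻¹) where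
  open CommutativeRing A hiding (zero)
  open import Relation.Binary.Reasoning.Setoid setoid
  open import Algebra.Properties.Semiring.Sum semiring
    using (sum; sum-cong-≋; sum-remove; ∑-distrib-+; ∑-comm; *-distribˡ-sum; *-distribʳ-sum; sum-permute; sum-replicate-zero)
  open import Algebra.Bundles using (AbelianGroup)
  open import Data.Fin using (punchIn)
  open import Data.Fin.Properties using (_≟_; punchInᵢ≢i)
  open import Data.Fin.Permutation using (Permutation; permutation)
  open import Data.Product using (_,_)
  open import Data.Empty using (⊥-elim)
  open import Relation.Nullary using (¬_; yes; no)
  import Relation.Binary.PropositionalEquality as ≡

  private
    G : AbelianGroup 0ℓ 0ℓ
    G = record { isAbelianGroup = isAbelianGroup }
    module G = AbelianGroup G
    open import Algebra.Properties.AbelianGroup G using (⁻¹-anti-homo-∙; ε⁻¹≈ε)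

  infixl 6 _∕_
  _∕_ : Fin (suc n) → Fin (suc n) → Fin (suc n)
  k ∕ i = k ∙ (i ⁻¹)

  ∕-cancel : ∀ k i → (k ∕ i) ∙ i ≡ k
  ∕-cancel k i = ≡.trans (G.assoc k (i ⁻¹) i) (≡.trans (≡.cong (k ∙_) (G.inverseˡ i)) (G.identityʳ k))

  ∙-∕-cancel : ∀ k i → (k ∙ i) ∕ i ≡ k
  ∙-∕-cancel k i = ≡.trans (G.assoc k i (i ⁻¹)) (≡.trans (≡.cong (k ∙_) (G.inverseʳ i)) (G.identityʳ k))

  ∕-involutive : ∀ k i → k ∕ (k ∕ i) ≡ i
  ∕-involutive k i = ≡.trans (≡.cong (λ j → j ∙ ((k ∕ i) ⁻¹)) (≡.sym (≡.trans (G.comm i (k ∕ i)) (∕-cancel k i))))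
    (∙-∕-cancel i (k ∕ i))

  ∕-∙ : ∀ k i j → k ∕ (i ∙ j) ≡ (k ∕ j) ∕ i
  ∕-∙ k i j = ≡.trans (≡.cong (k ∙_) (⁻¹-anti-homo-∙ i j)) (≡.sym (G.assoc k (j ⁻¹) (i ⁻¹)))

  ∕-ε : ∀ k → k ∕ zero ≡ k
  ∕-ε k = ≡.trans (≡.cong (k ∙_) ε⁻¹≈ε) (G.identityʳ k)

  Element : Set
  Element = Fin (suc n) → Carrier

  infix 4 _≋_
  _≋_ : Element → Element → Set
  f ≋ g = ∀ k → f k ≈ g k

  infixl 7 _⊛_
  _⊛_ : Element → Element → Element
  (f ⊛ g) k = sum (λ i → f i * g (k ∕ i))

  δ : Fin (suc n) → Element
  δ i j with i ≟ j
  ... | yes _ = 1#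
  ... | no _ = 0#

  δ-same : ∀ i → δ i i ≈ 1#
  δ-same i with i ≟ i
  ... | yes _ = refl
  ... | no i≢i = ⊥-elim (i≢i ≡.refl)

  δ-other : ∀ {i j} → ¬ i ≡ j → δ i j ≈ 0#
  δ-other {i} {j} i≢j with i ≟ j
  ... | yes i≡j = ⊥-elim (i≢j i≡j)
  ... | no _ = refl

  δ-⊛ : ∀ c f k → (δ c ⊛ f) k ≈ f (k ∕ c)
  δ-⊛ c f k = begin
    sum (λ i → δ c i * f (k ∕ i)) ≈⟨ sum-remove {i = c} (λ i → δ c i * f (k ∕ i)) ⟩
    δ c c * f (k ∕ c) + sum (λ i → δ c (punchIn c i) * f (k ∕ punchIn c i))
      ≈⟨ +-cong (trans (*-congʳ (δ-same c)) (*-identityˡ _))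
           (trans (sum-cong-≋ {n} (λ i → trans (*-congʳ (δ-other (λ c≡ → punchInᵢ≢i c i (≡.sym c≡)))) (zeroˡ _)))
             (sum-replicate-zero n)) ⟩
    f (k ∕ c) + 0# ≈⟨ +-identityʳ _ ⟩
    f (k ∕ c) ∎

  ⊛-cong : ∀ {f f′ g g′} → f ≋ f′ → g ≋ g′ → f ⊛ g ≋ f′ ⊛ g′
  ⊛-cong f≋f′ g≋g′ k = sum-cong-≋ {suc n} (λ i → *-cong (f≋f′ i) (g≋g′ (k ∕ i)))

  ⊛-comm : ∀ f g → f ⊛ g ≋ g ⊛ f
  ⊛-comm f g k = begin
    sum (λ i → f i * g (k ∕ i))
      ≈⟨ sum-permute (λ i → f i * g (k ∕ i)) (permutation (k ∕_) (k ∕_) (∕-involutive k) (∕-involutive k)) ⟩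
    sum (λ i → f (k ∕ i) * g (k ∕ (k ∕ i)))
      ≈⟨ sum-cong-≋ {suc n} (λ i → trans (*-comm _ _) (*-congʳ {f (k ∕ i)} (reflexive (≡.cong g (∕-involutive k i))))) ⟩
    sum (λ i → g i * f (k ∕ i)) ∎

  ⊛-assoc : ∀ f g h → (f ⊛ g) ⊛ h ≋ f ⊛ (g ⊛ h)
  ⊛-assoc f g h k = begin
    sum (λ i → sum (λ j → f j * g (i ∕ j)) * h (k ∕ i))
      ≈⟨ sum-cong-≋ {suc n} (λ i → *-distribʳ-sum (h (k ∕ i)) (λ j → f j * g (i ∕ j))) ⟩
    sum (λ i → sum (λ j → f j * g (i ∕ j) * h (k ∕ i)))
      ≈⟨ ∑-comm (λ i j → f j * g (i ∕ j) * h (k ∕ i)) ⟩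
    sum (λ j → sum (λ i → f j * g (i ∕ j) * h (k ∕ i)))
      ≈⟨ sum-cong-≋ {suc n} (λ j → begin
        sum (λ i → f j * g (i ∕ j) * h (k ∕ i))
          ≈⟨ sum-permute (λ i → f j * g (i ∕ j) * h (k ∕ i))
               (permutation (_∙ j) (_∕ j) (λ i → ∕-cancel i j) (λ i → ∙-∕-cancel i j)) ⟩
        sum (λ i → f j * g ((i ∙ j) ∕ j) * h (k ∕ (i ∙ j)))
          ≈⟨ sum-cong-≋ {suc n} (λ i → trans (*-assoc _ _ _) (*-congˡ {f j} (*-cong
               (reflexive (≡.cong g (∙-∕-cancel i j))) (reflexive (≡.cong h (∕-∙ k i j)))))) ⟩
        sum (λ i → f j * (g i * h ((k ∕ j) ∕ i)))
          ≈⟨ *-distribˡ-sum (f j) (λ i → g i * h ((k ∕ j) ∕ i)) ⟨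
        f j * sum (λ i → g i * h ((k ∕ j) ∕ i)) ∎) ⟩
    sum (λ j → f j * sum (λ i → g i * h ((k ∕ j) ∕ i))) ∎

  ⊛-identityˡ : ∀ f → δ zero ⊛ f ≋ f
  ⊛-identityˡ f k = trans (δ-⊛ zero f k) (reflexive (≡.cong f (∕-ε k)))

  ⊛-distribˡ : ∀ f g h → f ⊛ (λ k → g k + h k) ≋ (λ k → (f ⊛ g) k + (f ⊛ h) k)
  ⊛-distribˡ f g h k = begin
    sum (λ i → f i * (g (k ∕ i) + h (k ∕ i))) ≈⟨ sum-cong-≋ {suc n} (λ i → distribˡ (f i) (g (k ∕ i)) (h (k ∕ i))) ⟩
    sum (λ i → f i * g (k ∕ i) + f i * h (k ∕ i))
      ≈⟨ ∑-distrib-+ (λ i → f i * g (k ∕ i)) (λ i → f i * h (k ∕ i)) ⟩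
    (f ⊛ g) k + (f ⊛ h) k ∎

  groupRing : CommutativeRing 0ℓ 0ℓ
  groupRing = record
    { Carrier = Element ; _≈_ = _≋_ ; _+_ = λ f g k → f k + g k ; _*_ = _⊛_ ; -_ = λ f k → - f k
    ; 0# = λ _ → 0# ; 1# = δ zero
    ; isCommutativeRing = record
      { isRing = record
        { +-isAbelianGroup = record
          { isGroup = record
            { isMonoid = record
              { isSemigroup = record
                { isMagma = record
                  { isEquivalence = record
                    { refl = λ _ → refl ; sym = λ f≋g k → sym (f≋g k) ; trans = λ f≋g g≋h k → trans (f≋g k) (g≋h k) }
                  ; ∙-cong = λ p q k → +-cong (p k) (q k) }
                ; assoc = λ f g h k → +-assoc _ _ _ }
              ; identity = (λ f k → +-identityˡ _) , (λ f k → +-identityʳ _) }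
            ; inverse = (λ f k → -‿inverseˡ _) , (λ f k → -‿inverseʳ _)
            ; ⁻¹-cong = λ p k → -‿cong (p k) }
          ; comm = λ f g k → +-comm _ _ }
        ; *-cong = ⊛-cong
        ; *-assoc = ⊛-assoc
        ; *-identity = ⊛-identityˡ , λ f k → trans (⊛-comm f (δ zero) k) (⊛-identityˡ f k)
        ; distrib = ⊛-distribˡ , λ f g h k → trans (⊛-comm (λ j → g j + h j) f k)
            (trans (⊛-distribˡ f g h k) (+-cong (⊛-comm f g k) (⊛-comm f h k))) }
      ; *-comm = ⊛-comm } }

-- When every y satisfies y^(m+2) = y, the power y^(m+1) is idempotent, and multiplying an idempotent v
-- by 1 - y^(m+1) turns y into zero on the corresponding factor of the ring.
module IdempotentSplitting (R : CommutativeRing 0ℓ 0ℓ) (_≟_ : Decidable (CommutativeRing._≈_ R))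
  (m : ℕ) (y^[2+m]≈y : ∀ y → CommutativeRing._≈_ R
    (Algebra.Properties.Semiring.Exp._^_ (CommutativeRing.semiring R) y (suc (suc m))) y) where
  open CommutativeRing R hiding (zero)
  open IntegerSolver R
  open import Relation.Binary.Reasoning.Setoid setoid
  open Algebra.Properties.Semiring.Exp semiring using (_^_; ^-congˡ)
  open import Data.Integer using (+_)
  open import Function using (_∘_)
  open import Relation.Nullary using (yes; no)

  -- Seen in a product of fields, this is the idempotent that is 1 where `y` is nonzero and 0
  -- elsewhere.
  unitPart : Carrier → Carrier
  unitPart y = y ^ suc m

  *-unitPart : ∀ y → y * unitPart y ≈ y
  *-unitPart = y^[2+m]≈y

  unitPart-idem : ∀ y → unitPart y * unitPart y ≈ unitPart y
  unitPart-idem y = begin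
    y * y ^ m * unitPart y ≈⟨ solve 3 (λ y p u → y :* p :* u := p :* (y :* u)) refl y (y ^ m) (unitPart y) ⟩
    y ^ m * (y * unitPart y) ≈⟨ *-congˡ (*-unitPart y) ⟩
    y ^ m * y ≈⟨ *-comm _ _ ⟩
    y * y ^ m ∎

  -- On the factor cut out by `v`, the element `y` becomes zero in the first case and invertible in
  -- the second.
  SplitBy : Carrier → Carrier → Set
  SplitBy v y = v * y ≈ 0# ⊎ v * unitPart y ≈ v

  split-* : ∀ w {v y} → SplitBy v y → SplitBy (v * w) y
  split-* w {v} {y} (inj₁ vy≈0) =
    inj₁ (trans (solve 3 (λ v w y → v :* w :* y := w :* (v :* y)) refl v w y) (trans (*-congˡ vy≈0) (zeroʳ w)))
  split-* w {v} {y} (inj₂ vu≈v) =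
    inj₂ (trans (solve 3 (λ v w u → v :* w :* u := w :* (v :* u)) refl v w (unitPart y))
      (trans (*-congˡ vu≈v) (*-comm w v)))

  split-resp : ∀ {v y z} → y ≈ z → SplitBy v y → SplitBy v z
  split-resp y≈z (inj₁ vy≈0) = inj₁ (trans (*-congˡ (sym y≈z)) vy≈0)
  split-resp y≈z (inj₂ vu≈v) = inj₂ (trans (*-congˡ (^-congˡ (suc m) (sym y≈z))) vu≈v)

  -- Starting from the unit part of `f` keeps `f` invertible on every later factor. If `y` is not
  -- yet invertible on `v`, then `v * (1# - unitPart y)` is nonzero and kills `y`; splittings
  -- already achieved survive by `split-*`.
  splitting : ∀ {k} (Y : Fin k → Carrier) f → ¬ f ≈ 0# →
    ∃[ v ] ¬ v ≈ 0# × v * unitPart f ≈ v × (∀ i → SplitBy v (Y i))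
  splitting {zero} Y f f≉0 = unitPart f , (λ u≈0 → f≉0 (begin
    f ≈⟨ *-unitPart f ⟨
    f * unitPart f ≈⟨ *-congˡ u≈0 ⟩
    f * 0# ≈⟨ zeroʳ f ⟩
    0# ∎)) , unitPart-idem f , λ ()
  splitting {suc k} Y f f≉0 with splitting (Y ∘ suc) f f≉0
  ... | v , v≉0 , vf≈v , splits with (v * unitPart (Y zero)) ≟ v
  ...   | yes vu≈v = v , v≉0 , vf≈v , λ { zero → inj₂ vu≈v ; (suc i) → splits i }
  ...   | no vu≉v = v * w , v′≉0 , v′f≈v′ , λ { zero → inj₁ v′y≈0 ; (suc i) → split-* w (splits i) }
    where
    y = Y zero
    w = 1# - unitPart y
    v′≉0 : ¬ v * w ≈ 0#
    v′≉0 vw≈0 = vu≉v (begin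
      v * unitPart y ≈⟨ +-identityˡ _ ⟨
      0# + v * unitPart y ≈⟨ +-congʳ vw≈0 ⟨
      v * (1# - unitPart y) + v * unitPart y
        ≈⟨ solve 2 (λ v u → v :* (con (+ 1) :- u) :+ v :* u := v) refl v (unitPart y) ⟩
      v ∎)
    v′f≈v′ : v * w * unitPart f ≈ v * w
    v′f≈v′ = trans (solve 3 (λ v w u → v :* w :* u := v :* u :* w) refl v w (unitPart f)) (*-congʳ vf≈v)
    v′y≈0 : v * w * y ≈ 0#
    v′y≈0 = begin
      v * (1# - unitPart y) * y
        ≈⟨ solve 3 (λ v u y → v :* (con (+ 1) :- u) :* y := v :* (y :- y :* u)) refl v (unitPart y) y ⟩
      v * (y - y * unitPart y) ≈⟨ *-congˡ (+-congˡ (-‿cong (*-unitPart y))) ⟩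
      v * (y - y) ≈⟨ trans (*-congˡ (-‿inverseʳ y)) (zeroʳ v) ⟩
      0# ∎

  -- Modulo the annihilator of `v`, an element is zero exactly when `v` kills it, so `splits` leaves
  -- only zero and units, with `x ^ m` as the inverse of `x`.
  module LocalFactor {v} (v≉0 : ¬ v ≈ 0#) (splits : ∀ y → SplitBy v y) where
    module Factor = Quotient R (λ x → v * x ≈ 0#) (λ x≈y vx≈0 → trans (*-congˡ (sym x≈y)) vx≈0) (zeroʳ v)
      (λ vx≈0 vy≈0 → trans (distribˡ v _ _) (trans (+-cong vx≈0 vy≈0) (+-identityˡ 0#)))
      (λ x {y} vy≈0 → trans (solve 3 (λ v x y → v :* (x :* y) := x :* (v :* y)) refl v x y)
        (trans (*-congˡ vy≈0) (zeroʳ x)))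

    factor : CommutativeRing 0ℓ 0ℓ
    factor = Factor.quotient

    private module F = CommutativeRing factor

    unitPart-≈1 : ∀ x → ¬ x F.≈ 0# → unitPart x F.≈ 1#
    unitPart-≈1 x x≉0 with splits x
    ... | inj₁ vx≈0 = ⊥-elim (x≉0 (trans (*-congˡ (solve 1 (λ x → x :- con (+ 0) := x) refl x)) vx≈0))
      where open import Data.Empty using (⊥-elim)
    ... | inj₂ vu≈v = begin
      v * (unitPart x - 1#) ≈⟨ solve 2 (λ v u → v :* (u :- con (+ 1)) := v :* u :- v) refl v (unitPart x) ⟩
      v * unitPart x - v ≈⟨ +-congʳ vu≈v ⟩
      v - v ≈⟨ -‿inverseʳ v ⟩
      0# ∎

    factor-isField : IsField factor
    factor-isField = record
      { _≈?_ = λ x y → (v * (x - y)) ≟ 0#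
      ; 1≉0 = λ v[1-0]≈0 → v≉0 (trans (solve 1 (λ v → v := v :* (con (+ 1) :- con (+ 0))) refl v) v[1-0]≈0)
      ; inverse = λ x x≉0 → x ^ m , unitPart-≈1 x x≉0 }

    ≈⇒≈ᶠ : ∀ {x y} → x ≈ y → x F.≈ y
    ≈⇒≈ᶠ = Factor.≈⇒∼

module IntegersModulo (p : ℕ) where
  open import Data.Integer as ℤ using (ℤ; +_)
  open import Data.Nat using (NonZero)
  open import Data.Integer.Properties using (+-*-commutativeRing)
  open import Data.Integer.Divisibility.Signed using (∣m∣n⇒∣m+n; ∣n⇒∣m*n; _∣?_; ∣ᵤ⇒∣; divides; ∣⇒∣ᵤ; ∣-refl) renaming (_∣_ to _∣ᶻ_)
  open import Data.Nat.Divisibility using (_∣0; ∣1⇒≡1)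
  open import Data.Nat.Primality using (¬prime[1])
  open import Relation.Binary.PropositionalEquality using (refl; sym; trans; cong; subst)
  open Quotient +-*-commutativeRing (λ i → + p ∣ᶻ i) (subst (+ p ∣ᶻ_)) (∣ᵤ⇒∣ (p ∣0)) ∣m∣n⇒∣m+n
    (λ i p∣j → ∣n⇒∣m*n i p∣j) public using (≈⇒∼) renaming (quotient to ℤ/p)

  open CommutativeRing ℤ/p using (_≈_; 0#; 1#; semiring)
  open import Algebra.Properties.Semiring.Mult semiring using () renaming (_×_ to _×ᴬ_)

  _≈?ᴬ_ : Decidable _≈_
  i ≈?ᴬ j = + p ∣? (i ℤ.- j)

  ×1≡ : ∀ n → n ×ᴬ 1# ≡ + n
  ×1≡ zero = refl
  ×1≡ (suc n) = cong (λ i → + 1 ℤ.+ i) (×1≡ n)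

  p×1≈0 : p ×ᴬ 1# ≈ 0#
  p×1≈0 rewrite ×1≡ p = subst (+ p ∣ᶻ_) (sym (Data.Integer.Properties.+-identityʳ (+ p))) ∣-refl
    where import Data.Integer.Properties

  1≉ᴬ0 : Prime p → ¬ 1# ≈ 0#
  1≉ᴬ0 p-prime p∣1 = ¬prime[1] (subst Prime (∣1⇒≡1 (∣⇒∣ᵤ p∣1)) p-prime)

  -- This makes the group ring enumerable, and every element of it a sum of natural multiples of
  -- group elements.
  residue : .{{_ : NonZero p}} → ∀ i → ∃[ r ] toℕ {p} r ×ᴬ 1# ≈ i
  residue i = fromℕ< (n%ℕd<d i p) , subst (λ j → + p ∣ᶻ j ℤ.- i)
    (sym (trans (×1≡ _) (cong +_ (toℕ-fromℕ< (n%ℕd<d i p)))))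
    (divides (ℤ.- (i ℤ./ℕ p)) (begin
      + r ℤ.- i ≡⟨ cong (λ j → + r ℤ.- j) (a≡a%ℕn+[a/ℕn]*n i p) ⟩
      + r ℤ.- (+ r ℤ.+ (i ℤ./ℕ p) ℤ.* + p)
        ≡⟨ S.solve 3 (λ r k p → r S.:- (r S.:+ k S.:* p) S.:= (S.:- k) S.:* p) refl (+ r) (i ℤ./ℕ p) (+ p) ⟩
      (ℤ.- (i ℤ./ℕ p)) ℤ.* + p ∎))
    where
    open import Relation.Binary.PropositionalEquality using (module ≡-Reasoning)
    open ≡-Reasoning
    open import Data.Integer.DivMod using (a≡a%ℕn+[a/ℕn]*n; n%ℕd<d)
    open import Data.Fin using (fromℕ<)
    open import Data.Fin.Properties using (toℕ-fromℕ<)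
    module S = IntegerSolver +-*-commutativeRing
    r = i ℤ.%ℕ p

-- The generator of a cyclic group ring and the element that guards its order

module CyclicGroupRing (A : CommutativeRing 0ℓ 0ℓ) (n : ℕ) where
  open CyclicGroup n public
  open GroupRing A isAbelianGroup public
  open CommutativeRing groupRing hiding (zero)
  open IntegerSolver groupRing
  private module A = CommutativeRing A
  open import Algebra.Properties.Ring A.ring using (-0#≈0#)
  open import Algebra.Properties.Semiring.Exp semiring using (_^_)
  open import Data.Nat as ℕ using (_≤_; _<_; z≤n; _%_)
  open import Data.Nat.DivMod using (_mod_; %-distribˡ-*; m%n%n≡m%n; n%n≡0)
  open import Data.Nat.Divisibility
    using (_∣_; divides; _∣?_; ∣-trans; ∣m∣n⇒∣m+n; %-presˡ-∣; ∣n∣m%n⇒∣m; ∣⇒≤; ∣1⇒≡1; ∣m+n∣m⇒∣n)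
  import Data.Nat.Properties as ℕ
  open import Data.Nat.Primality using (prime?; euclidsLemma; ¬prime[0]; ¬prime[1])
  open import Data.Fin using (toℕ)
  open import Data.Fin.Properties using (toℕ-injective; toℕ<n; _≟_)
  open import Data.Integer using (+_)
  open import Data.Sum using (_⊎_; inj₁; inj₂)
  open import Data.Empty using (⊥-elim)
  open import Function using (_∘_)
  open import Relation.Nullary using (yes; no)
  import Relation.Binary.PropositionalEquality as ≡

  δ-∙ : ∀ i j → δ i * δ j ≈ δ (i ∙ j)
  δ-∙ i j k with (i ∙ j) ≟ k
  ... | yes ij≡k = A.trans (δ-⊛ i (δ j) k)
    (A.trans (A.reflexive (≡.cong (δ j) (≡.trans (≡.cong (_∕ i) (≡.trans (≡.sym ij≡k) (∙-comm i j))) (∙-∕-cancel j i)))) (δ-same j))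
  ... | no ij≢k = A.trans (δ-⊛ i (δ j) k)
    (δ-other {j} {k ∕ i} (λ j≡k/i → ij≢k (≡.trans (∙-comm i j) (≡.trans (≡.cong (_∙ i) j≡k/i) (∕-cancel k i)))))

  δ-^ : ∀ i m → δ i ^ m ≈ δ ((m ℕ.* toℕ i) mod N)
  δ-^ i zero = refl
  δ-^ i (suc m) = trans (*-congˡ {δ i} (δ-^ i m)) (trans (δ-∙ i ((m ℕ.* toℕ i) mod N))
    (reflexive (≡.cong δ (toℕ-injective (≡.trans (toℕ-∙ i ((m ℕ.* toℕ i) mod N)) (≡.trans
      (≡.cong (λ c → (toℕ i ℕ.+ c) % N) (toℕ-mod (m ℕ.* toℕ i)))
      (≡.trans (%-absorbʳ (toℕ i) (m ℕ.* toℕ i)) (≡.sym (toℕ-mod (toℕ i ℕ.+ m ℕ.* toℕ i))))))))))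

  module _ {w} (w∣N : w ∣ N) where

    ∣-mod : ∀ {m} → w ∣ m → w ∣ toℕ (m mod N)
    ∣-mod {m} w∣m = ≡.subst (w ∣_) (≡.sym (toℕ-mod m)) (%-presˡ-∣ w∣m w∣N)

    mod-∣ : ∀ {m} → w ∣ toℕ (m mod N) → w ∣ m
    mod-∣ {m} w∣ = ∣n∣m%n⇒∣m w∣N (≡.subst (w ∣_) (toℕ-mod m) w∣)

    ∣-∙ : ∀ i j → w ∣ toℕ i → w ∣ toℕ j → w ∣ toℕ (i ∙ j)
    ∣-∙ i j w∣i w∣j = ∣-mod (∣m∣n⇒∣m+n w∣i w∣j)

    ∣-⁻¹ : ∀ i → w ∣ toℕ i → w ∣ toℕ (i ⁻¹)
    ∣-⁻¹ i w∣i = ∣-mod (∣m+n∣m⇒∣n (≡.subst (w ∣_)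
      (≡.sym (≡.trans (ℕ.+-comm (toℕ i) _) (ℕ.m∸n+n≡m (ℕ.<⇒≤ (toℕ<n i))))) w∣N) w∣i)

    ∣-∕ : ∀ i j → w ∣ toℕ i → w ∣ toℕ j → w ∣ toℕ (i ∕ j)
    ∣-∕ i j w∣i w∣j = ∣-∙ i (j ⁻¹) w∣i (∣-⁻¹ j w∣j)

  -- f is the product of the 1 - x^(N/ℓ) over the primes ℓ ≤ k dividing N.  It is supported on the
  -- multiples of w = N/m, where m is the product of these primes; the next shift, by N/ℓ, is not a
  -- multiple of w, so the constant coefficient stays 1.
  record Separator (k : ℕ) : Set where
    field
      f : Element
      m w : ℕ
      mw≡N : m ℕ.* w ≡ N
      constant : f zero A.≈ A.1#
      support : ∀ j → ¬ w ∣ toℕ j → f j A.≈ A.0#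
      coprime : ∀ ℓ → Prime ℓ → k < ℓ → ¬ ℓ ∣ m
      divisor : ∀ ℓ c → Prime ℓ → ℓ ≤ k → N ≡ ℓ ℕ.* c → ∃[ g ] f ≈ (1# - δ (c mod N)) * g

  separator-zero : Separator 0
  separator-zero = record
    { f = 1# ; m = 1 ; w = N ; mw≡N = ℕ.*-identityˡ N ; constant = δ-same zero
    ; support = λ j N∤j → δ-other (λ 0≡j → N∤j (≡.subst (λ j → N ∣ toℕ j) 0≡j (divides 0 ≡.refl)))
    ; coprime = λ ℓ ℓ-prime _ ℓ∣1 → ¬prime[1] (≡.subst Prime (∣1⇒≡1 ℓ∣1) ℓ-prime)
    ; divisor = λ { zero c ℓ-prime z≤n → ⊥-elim (¬prime[0] ℓ-prime) } }

  module _ {k} (s : Separator k) where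
    open Separator s

    separator-skip : ¬ (Prime (suc k) × suc k ∣ N) → Separator (suc k)
    separator-skip skip = record
      { f = f ; m = m ; w = w ; mw≡N = mw≡N ; constant = constant ; support = support
      ; coprime = λ ℓ ℓ-prime k<ℓ → coprime ℓ ℓ-prime (ℕ.<⇒≤ k<ℓ)
      ; divisor = λ ℓ c ℓ-prime ℓ≤1+k N≡ℓc → divisor ℓ c ℓ-prime
          (ℕ.s≤s⁻¹ (ℕ.≤∧≢⇒< ℓ≤1+k (λ ℓ≡1+k → skip
            (≡.subst Prime ℓ≡1+k ℓ-prime , divides c (≡.trans N≡ℓc (≡.trans (≡.cong (ℕ._* c) ℓ≡1+k) (ℕ.*-comm (suc k) c)))))))
          N≡ℓc }

    separator-extend : Prime (suc k) → suc k ∣ N → Separator (suc k)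
    separator-extend ℓ-prime (divides c N≡cℓ) = record
      { f = (1# - δ i) * f ; m = m ℕ.* ℓ ; w = w′
      ; mw≡N = ≡.trans (ℕ.*-assoc m ℓ w′) (≡.trans (≡.cong (m ℕ.*_) (≡.sym w≡ℓw′)) mw≡N)
      ; constant = A.trans (shifted zero) (A.trans (A.+-congˡ (A.trans (A.-‿cong (support (zero ∕ i) w∤0/i)) -0#≈0#))
          (A.trans (A.+-identityʳ _) constant))
      ; support = λ j w′∤j → A.trans (shifted j) (A.trans (A.+-cong
          (support j (w′∤j ∘ ∣-trans w′∣w))
          (A.-‿cong (support (j ∕ i) (λ w∣j/i → w′∤j (≡.subst (λ j → w′ ∣ toℕ j) (∕-cancel j i)
            (∣-∙ w′∣N (j ∕ i) i (∣-trans w′∣w w∣j/i) (∣-mod w′∣N w′∣c)))))))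
          (A.-‿inverseʳ A.0#))
      ; coprime = λ ℓ′ ℓ′-prime 1+k<ℓ′ ℓ′∣mℓ → coprime′ ℓ′ 1+k<ℓ′ (euclidsLemma m ℓ ℓ′-prime ℓ′∣mℓ) ℓ′-prime
      ; divisor = λ ℓ′ c′ ℓ′-prime ℓ′≤ℓ N≡ℓ′c′ → divisor′ ℓ′ c′ ℓ′-prime (ℕ.m≤n⇒m<n∨m≡n ℓ′≤ℓ) N≡ℓ′c′ }
      where
      ℓ = suc k
      i = c mod N
      ℓ∤m : ¬ ℓ ∣ m
      ℓ∤m = coprime ℓ ℓ-prime ℕ.≤-refl
      ℓ∣w : ℓ ∣ w
      ℓ∣w with euclidsLemma m w ℓ-prime (divides c (≡.trans mw≡N N≡cℓ))
      ... | inj₁ ℓ∣m = ⊥-elim (ℓ∤m ℓ∣m)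
      ... | inj₂ ℓ∣w = ℓ∣w
      w′ = _∣_.quotient ℓ∣w
      w≡w′ℓ : w ≡ w′ ℕ.* ℓ
      w≡w′ℓ = _∣_.equality ℓ∣w
      w≡ℓw′ : w ≡ ℓ ℕ.* w′
      w≡ℓw′ = ≡.trans w≡w′ℓ (ℕ.*-comm w′ ℓ)
      w′∣w : w′ ∣ w
      w′∣w = divides ℓ w≡ℓw′
      w∣N : w ∣ N
      w∣N = divides m (≡.sym mw≡N)
      w′∣N : w′ ∣ N
      w′∣N = ∣-trans w′∣w w∣N
      c≡mw′ : c ≡ m ℕ.* w′
      c≡mw′ = ℕ.*-cancelʳ-≡ c (m ℕ.* w′) ℓ (≡.trans (≡.sym N≡cℓ) (≡.trans (≡.sym mw≡N)
        (≡.trans (≡.cong (m ℕ.*_) w≡w′ℓ) (≡.sym (ℕ.*-assoc m w′ ℓ)))))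
      w′∣c : w′ ∣ c
      w′∣c = divides m c≡mw′
      w′≢0 : ℕ.NonZero w′
      w′≢0 = ℕ.≢-nonZero λ w′≡0 → ℕ.0≢1+n (≡.trans (≡.sym (ℕ.*-zeroʳ m)) (≡.trans
        (≡.cong (m ℕ.*_) (≡.sym (≡.trans w≡w′ℓ (≡.cong (ℕ._* ℓ) w′≡0)))) mw≡N))
      -- Since `c = m w′` and `w = ℓ w′`, divisibility would force `ℓ` to divide `m`, a product of
      -- smaller primes.
      w∤c : ¬ w ∣ c
      w∤c (divides q c≡qw) = ℓ∤m (divides q (ℕ.*-cancelʳ-≡ m (q ℕ.* ℓ) w′ {{w′≢0}} (≡.trans (≡.sym c≡mw′)
        (≡.trans c≡qw (≡.trans (≡.cong (q ℕ.*_) w≡ℓw′) (≡.sym (ℕ.*-assoc q ℓ w′)))))))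
      w∤0/i : ¬ w ∣ toℕ (zero ∕ i)
      w∤0/i w∣0/i = w∤c (mod-∣ w∣N (≡.subst (λ j → w ∣ toℕ j) (∕-involutive zero i)
        (∣-∕ w∣N zero (zero ∕ i) (divides 0 ≡.refl) w∣0/i)))
      shifted : ∀ j → ((1# - δ i) * f) j A.≈ f j A.- f (j ∕ i)
      shifted j = A.trans
        (solve 2 (λ d f → (con (+ 1) :- d) :* f := f :- d :* f) refl (δ i) f j)
        (A.+-congˡ (A.-‿cong (δ-⊛ i f j)))
      coprime′ : ∀ ℓ′ → ℓ < ℓ′ → ℓ′ ∣ m ⊎ ℓ′ ∣ ℓ → ¬ Prime ℓ′
      coprime′ ℓ′ ℓ<ℓ′ (inj₁ ℓ′∣m) ℓ′-prime = coprime ℓ′ ℓ′-prime (ℕ.<⇒≤ ℓ<ℓ′) ℓ′∣m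
      coprime′ ℓ′ ℓ<ℓ′ (inj₂ ℓ′∣ℓ) ℓ′-prime = ℕ.<⇒≱ ℓ<ℓ′ (∣⇒≤ ℓ′∣ℓ)
      divisor′ : ∀ ℓ′ c′ → Prime ℓ′ → ℓ′ < ℓ ⊎ ℓ′ ≡ ℓ → N ≡ ℓ′ ℕ.* c′ →
        ∃[ g ] (1# - δ i) * f ≈ (1# - δ (c′ mod N)) * g
      divisor′ ℓ′ c′ ℓ′-prime (inj₁ ℓ′<ℓ) N≡ℓ′c′ =
        let g , f≈ = divisor ℓ′ c′ ℓ′-prime (ℕ.s≤s⁻¹ ℓ′<ℓ) N≡ℓ′c′
        in (1# - δ i) * g , trans (*-congˡ {1# - δ i} f≈)
             (solve 3 (λ a b g → a :* (b :* g) := b :* (a :* g)) refl (1# - δ i) (1# - δ (c′ mod N)) g)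
      divisor′ ℓ′ c′ ℓ′-prime (inj₂ ≡.refl) N≡ℓc′ = f ,
        reflexive (≡.cong (λ c → (1# - δ (c mod N)) * f)
          (ℕ.*-cancelˡ-≡ c c′ ℓ (≡.trans (ℕ.*-comm ℓ c) (≡.trans (≡.sym N≡cℓ) N≡ℓc′))))

  separator : ∀ k → Separator k
  separator zero = separator-zero
  separator (suc k) with prime? (suc k) | suc k ∣? N
  ... | yes ℓ-prime | yes ℓ∣N = separator-extend (separator k) ℓ-prime ℓ∣N
  ... | no ¬prime | _ = separator-skip (separator k) (λ { (ℓ-prime , _) → ¬prime ℓ-prime })
  ... | _ | no ℓ∤N = separator-skip (separator k) (λ { (_ , ℓ∣N) → ℓ∤N ℓ∣N })

  separator-≉0 : ¬ A.1# A.≈ A.0# → ¬ Separator.f (separator N) ≈ 0#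
  separator-≉0 1≉0 f≈0 = 1≉0 (A.trans (A.sym (Separator.constant (separator N))) (f≈0 zero))

  -- The reduction modulo `N` allows for the trivial group, `N = 1`.
  ζ : Element
  ζ = δ (1 mod N)

  ζ^≈δ : ∀ k → ζ ^ k ≈ δ (k mod N)
  ζ^≈δ k = trans (δ-^ (1 mod N) k) (reflexive (≡.cong δ (toℕ-injective (begin
    toℕ ((k ℕ.* toℕ (1 mod N)) mod N) ≡⟨ toℕ-mod (k ℕ.* toℕ (1 mod N)) ⟩
    (k ℕ.* toℕ (1 mod N)) % N ≡⟨ ≡.cong (λ c → (k ℕ.* c) % N) (toℕ-mod 1) ⟩
    (k ℕ.* (1 % N)) % N ≡⟨ %-distribˡ-* k (1 % N) N ⟩
    (k % N ℕ.* (1 % N % N)) % N ≡⟨ ≡.cong (λ c → (k % N ℕ.* c) % N) (m%n%n≡m%n 1 N) ⟩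
    (k % N ℕ.* (1 % N)) % N ≡⟨ %-distribˡ-* k 1 N ⟨
    (k ℕ.* 1) % N ≡⟨ ≡.cong (_% N) (ℕ.*-identityʳ k) ⟩
    k % N ≡⟨ toℕ-mod k ⟨
    toℕ (k mod N) ∎))))
    where open ≡.≡-Reasoning

  ζ^N≈1 : ζ ^ N ≈ 1#
  ζ^N≈1 = trans (ζ^≈δ N) (reflexive (≡.cong δ (toℕ-injective (≡.trans (toℕ-mod N) (n%n≡0 N)))))

  separator-divisor : ∀ ℓ c → Prime ℓ → N ≡ ℓ ℕ.* c → ∃[ g ] Separator.f (separator N) ≈ (1# - ζ ^ c) * g
  separator-divisor ℓ c ℓ-prime N≡ℓc =
    let g , f≈ = Separator.divisor (separator N) ℓ c ℓ-prime
          (∣⇒≤ (divides c (≡.trans N≡ℓc (ℕ.*-comm ℓ c)))) N≡ℓc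
    in g , trans f≈ (*-congʳ {g} (+-congˡ {1#} (-‿cong (sym (ζ^≈δ c)))))

-- Roots of unity and their order

module RootOfUnity (R : CommutativeRing 0ℓ 0ℓ) (ζ : CommutativeRing.Carrier R) (n : ℕ)
  (ζ^N≈1 : CommutativeRing._≈_ R (Algebra.Properties.Semiring.Exp._^_ (CommutativeRing.semiring R) ζ (suc n))
    (CommutativeRing.1# R)) where
  open CommutativeRing R hiding (zero)
  open import Relation.Binary.Reasoning.Setoid setoid
  open Algebra.Properties.Semiring.Exp semiring using (_^_; ^-congˡ; ^-homo-*; ^-assocʳ)
  open import Data.Nat as ℕ using (_%_; _/_)
  open import Data.Nat.DivMod using (m≡m%n+[m/n]*n; %-remove-+ʳ; %-remove-+ˡ)
  open import Data.Nat.Divisibility using (divides; n∣m*n)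
  import Data.Nat.Properties as ℕ
  import Relation.Binary.PropositionalEquality as ≡

  private N = suc n

  1^ : ∀ k → 1# ^ k ≈ 1#
  1^ zero = refl
  1^ (suc k) = trans (*-identityˡ _) (1^ k)

  ζ^∣≈1 : ∀ {k} → N ∣ k → ζ ^ k ≈ 1#
  ζ^∣≈1 {k} (divides q k≡qN) = begin
    ζ ^ k ≡⟨ ≡.cong (ζ ^_) (≡.trans k≡qN (ℕ.*-comm q N)) ⟩
    ζ ^ (N ℕ.* q) ≈⟨ ^-assocʳ ζ N q ⟨
    (ζ ^ N) ^ q ≈⟨ ^-congˡ q ζ^N≈1 ⟩
    1# ^ q ≈⟨ 1^ q ⟩
    1# ∎

  ζ^-% : ∀ k → ζ ^ k ≈ ζ ^ (k % N)
  ζ^-% k = begin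
    ζ ^ k ≡⟨ ≡.cong (ζ ^_) (m≡m%n+[m/n]*n k N) ⟩
    ζ ^ (k % N ℕ.+ k / N ℕ.* N) ≈⟨ ^-homo-* ζ (k % N) (k / N ℕ.* N) ⟩
    ζ ^ (k % N) * ζ ^ (k / N ℕ.* N) ≈⟨ *-congˡ (ζ^∣≈1 (n∣m*n (k / N))) ⟩
    ζ ^ (k % N) * 1# ≈⟨ *-identityʳ _ ⟩
    ζ ^ (k % N) ∎

  ζ^-cong : ∀ i j → i % N ≡ j % N → ζ ^ i ≈ ζ ^ j
  ζ^-cong i j i≡j = trans (ζ^-% i) (trans (reflexive (≡.cong (ζ ^_) i≡j)) (sym (ζ^-% j)))

  -- As `n` is -1 modulo `N`, the exponent `i + j n` stands for the difference of `i` and `j`,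
  -- without subtraction.
  ζ^-injective : (∀ k → ζ ^ k ≈ 1# → N ∣ k) → ∀ i j → ζ ^ i ≈ ζ ^ j → i % N ≡ j % N
  ζ^-injective order i j ζⁱ≈ζʲ = ≡.trans (≡.sym (%-remove-+ʳ i (n∣m*n j)))
    (≡.trans (≡.cong (_% N) rearrange) (%-remove-+ˡ j N∣i+jn))
    where
    N∣i+jn : N ∣ i ℕ.+ j ℕ.* n
    N∣i+jn = order (i ℕ.+ j ℕ.* n) (begin
      ζ ^ (i ℕ.+ j ℕ.* n) ≈⟨ ^-homo-* ζ i (j ℕ.* n) ⟩
      ζ ^ i * ζ ^ (j ℕ.* n) ≈⟨ *-congʳ ζⁱ≈ζʲ ⟩
      ζ ^ j * ζ ^ (j ℕ.* n) ≈⟨ ^-homo-* ζ j (j ℕ.* n) ⟨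
      ζ ^ (j ℕ.+ j ℕ.* n) ≡⟨ ≡.cong (ζ ^_) (ℕ.*-suc j n) ⟨
      ζ ^ (j ℕ.* N) ≈⟨ ζ^∣≈1 (n∣m*n j) ⟩
      1# ∎)
    rearrange : i ℕ.+ j ℕ.* N ≡ i ℕ.+ j ℕ.* n ℕ.+ j
    rearrange = ≡.trans (≡.cong (i ℕ.+_) (≡.trans (ℕ.*-suc j n) (ℕ.+-comm j (j ℕ.* n)))) (≡.sym (ℕ.+-assoc i (j ℕ.* n) j))

  -- By Bézout `ζ ^ g ≈ 1#` for `g = gcd k N`. If `g` were a proper divisor of `N`, a prime `ℓ`
  -- dividing the cofactor would make the power N/ℓ of `ζ` trivial.
  order-from-primes : (∀ ℓ c → Prime ℓ → N ≡ ℓ ℕ.* c → ¬ ζ ^ c ≈ 1#) → ∀ k → ζ ^ k ≈ 1# → N ∣ k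
  order-from-primes primes k ζ^k≈1 = ≡.subst (_∣ k) (≡.sym N≡g) (gcd[m,n]∣m k N)
    where
    open import Data.Nat.GCD using (gcd; gcd-GCD; gcd[m,n]∣m; gcd[m,n]∣n; module Bézout)
    open import Data.Nat.Primality.Factorisation using (factorise; PrimeFactorisation)
    open import Data.List using ([]; _∷_)
    open import Data.Nat.ListAction using (product)
    open import Data.List.Relation.Unary.All using (All; []; _∷_)
    open import Data.Empty using (⊥-elim)
    g = gcd k N
    unit : ∀ {u v w} → u * v ≈ w → v ≈ 1# → w ≈ 1# → u ≈ 1#
    unit {u} uv≈w v≈1 w≈1 = trans (sym (trans (*-congˡ v≈1) (*-identityʳ u))) (trans uv≈w w≈1)
    ζ^*≈1 : ∀ x {m} → ζ ^ m ≈ 1# → ζ ^ (x ℕ.* m) ≈ 1#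
    ζ^*≈1 x {m} ζ^m≈1 = trans (reflexive (≡.cong (ζ ^_) (ℕ.*-comm x m)))
      (trans (sym (^-assocʳ ζ m x)) (trans (^-congˡ x ζ^m≈1) (1^ x)))
    ζ^g≈1 : ζ ^ g ≈ 1#
    ζ^g≈1 with Bézout.identity (gcd-GCD k N)
    ... | Bézout.+- x y eq = unit (sym (^-homo-* ζ g (y ℕ.* N))) (ζ^*≈1 y ζ^N≈1)
            (trans (reflexive (≡.cong (ζ ^_) eq)) (ζ^*≈1 x ζ^k≈1))
    ... | Bézout.-+ x y eq = unit (sym (^-homo-* ζ g (x ℕ.* k))) (ζ^*≈1 x ζ^k≈1)
            (trans (reflexive (≡.cong (ζ ^_) eq)) (ζ^*≈1 y ζ^N≈1))
    proper : ∀ c → N ≡ c ℕ.* g → (ps : _) → c ≡ product ps → All Prime ps → N ≡ g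
    proper c N≡cg [] c≡1 _ = ≡.trans N≡cg (≡.trans (≡.cong (ℕ._* g) c≡1) (ℕ.*-identityˡ g))
    proper c N≡cg (ℓ ∷ ps) c≡ℓπ (ℓ-prime ∷ _) = ⊥-elim (primes ℓ (product ps ℕ.* g) ℓ-prime
      (≡.trans N≡cg (≡.trans (≡.cong (ℕ._* g) c≡ℓπ) (ℕ.*-assoc ℓ (product ps) g)))
      (ζ^*≈1 (product ps) ζ^g≈1))
    N≡g : N ≡ g
    N≡g with gcd[m,n]∣n k N
    ... | divides zero ()
    ... | divides c@(suc _) N≡cg = proper c N≡cg F.factors F.isFactorisation F.factorsPrime
      where module F = PrimeFactorisation (factorise c)

-- The field with `n + 2` elements. Finiteness is expressed through `ζ-generates`, which lists the
-- nonzero elements as powers of `ζ`, because the construction works with discrete logarithms.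
record FiniteField (p n : ℕ) : Set₁ where
  field
    ring : CommutativeRing 0ℓ 0ℓ
    isField : IsField ring
  open CommutativeRing ring hiding (zero; ring)
  open Algebra.Properties.Semiring.Exp semiring using (_^_)
  open Algebra.Properties.Semiring.Mult semiring using () renaming (_×_ to _×ᴿ_)
  field
    characteristic : p ×ᴿ 1# ≈ 0#
    ζ : Carrier
    ζ^N≈1 : ζ ^ suc n ≈ 1#
    ζ-order : ∀ k → ζ ^ k ≈ 1# → suc n ∣ k
    ζ-generates : ∀ y → ¬ y ≈ 0# → ∃[ i ] y ≈ ζ ^ toℕ {suc n} i

-- Fields as factors of rings in which y^Q = y

module FieldFromRing (R : CommutativeRing 0ℓ 0ℓ) (_≟ᴿ_ : Decidable (CommutativeRing._≈_ R)) (n : ℕ)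
  (all-fixed : ∀ y → CommutativeRing._≈_ R (Algebra.Properties.Semiring.Exp._^_ (CommutativeRing.semiring R) y (suc (suc n))) y)
  where
  open CommutativeRing R hiding (zero)
  open Algebra.Properties.Semiring.Exp semiring using (_^_)
  open Algebra.Properties.Semiring.Mult semiring using () renaming (_×_ to _×ᴿ_)
  open import Data.Nat.DivMod using (m<n⇒m%n≡m)
  import Data.Nat as ℕ
  import Data.Nat.Properties as ℕ
  open import Data.Nat.Divisibility using (divides)
  open import Data.Integer using (+_)
  open import Data.Fin using (cast)
  open import Data.Fin.Properties using (any?; toℕ-injective; toℕ<n; cast-involutive)
  open import Relation.Nullary.Decidable using (decidable-stable)
  import Relation.Binary.PropositionalEquality as ≡
  open IdempotentSplitting R _≟ᴿ_ n all-fixed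
  private
    N = suc n
    module R = IntegerSolver R

  module _ {p k} (p×1≈ᴿ0 : p ×ᴿ 1# ≈ 0#)
    (elements : Fin k → Carrier) (elements-surjective : ∀ f → ∃[ j ] elements j ≈ f)
    (f : Carrier) (f≉0 : ¬ f ≈ 0#) (ζ : Carrier) (ζ^N≈ᴿ1 : ζ ^ suc n ≈ 1#)
    (divisor : ∀ ℓ c → Prime ℓ → suc n ≡ ℓ ℕ.* c → ∃[ g ] f ≈ (1# - ζ ^ c) * g) where

    private
      split : ∃[ v ] ¬ v ≈ 0# × v * unitPart f ≈ v × (∀ i → SplitBy v (elements i))
      split = splitting elements f f≉0

    v : Carrier
    v = proj₁ split

    v≉0 : ¬ v ≈ 0#
    v≉0 = proj₁ (proj₂ split)

    v*unitPart-f : v * unitPart f ≈ v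
    v*unitPart-f = proj₁ (proj₂ (proj₂ split))

    splits : ∀ y → SplitBy v y
    splits y = let j , eⱼ≈y = elements-surjective y in split-resp eⱼ≈y (proj₂ (proj₂ (proj₂ split)) j)

    open LocalFactor v≉0 splits

    private module K = CommutativeRing factor

    -- The powers taken in R and in its quotient agree, but only propositionally, since the equality
    -- relation is an argument of the library's exponentiation.
    open Algebra.Properties.Semiring.Exp K.semiring using (^-assocʳ) renaming (_^_ to _^ᴷ_)
    open Algebra.Properties.Semiring.Mult K.semiring using () renaming (_×_ to _×ᴷ_)

    ^ᴷ≡^ : ∀ x k → x ^ᴷ k ≡ x ^ k
    ^ᴷ≡^ x zero = ≡.refl
    ^ᴷ≡^ x (suc k) = ≡.cong (x *_) (^ᴷ≡^ x k)

    ×ᴷ≡× : ∀ k x → k ×ᴷ x ≡ k ×ᴿ x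
    ×ᴷ≡× zero x = ≡.refl
    ×ᴷ≡× (suc k) x = ≡.cong (_+_ x) (×ᴷ≡× k x)

    ζ^N≈1 : ζ ^ᴷ N K.≈ 1#
    ζ^N≈1 = ≡.subst (K._≈ 1#) (≡.sym (^ᴷ≡^ ζ N)) (≈⇒≈ᶠ {ζ ^ N} {1#} ζ^N≈ᴿ1)

    -- `f` is a multiple of `1# - ζ ^ c`, so it would vanish on the factor, where it is invertible
    -- by the choice of `v`.
    ζ-primes : ∀ ℓ c → Prime ℓ → N ≡ ℓ ℕ.* c → ¬ ζ ^ c K.≈ 1#
    ζ-primes ℓ c ℓ-prime N≡ℓc v[ζᶜ-1]≈0 = v≉0 (begin
      v ≈⟨ v*unitPart-f ⟨
      v * (f * f ^ n) ≈⟨ *-congˡ (*-congʳ f≈) ⟩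
      v * ((1# - ζ ^ c) * g * f ^ n)
        ≈⟨ R.solve 4 (λ v z g h → v R.:* ((R.con (+ 1) R.:- z) R.:* g R.:* h)
             R.:= (v R.:* (z R.:- R.con (+ 1))) R.:* (R.:- (g R.:* h))) refl v (ζ ^ c) g (f ^ n) ⟩
      v * (ζ ^ c - 1#) * - (g * f ^ n) ≈⟨ *-congʳ v[ζᶜ-1]≈0 ⟩
      0# * - (g * f ^ n) ≈⟨ zeroˡ (- (g * f ^ n)) ⟩
      0# ∎)
      where
      open import Relation.Binary.Reasoning.Setoid setoid
      g : Carrier
      g = proj₁ (divisor ℓ c ℓ-prime N≡ℓc)
      f≈ : f ≈ (1# - ζ ^ c) * g
      f≈ = proj₂ (divisor ℓ c ℓ-prime N≡ℓc)

    open RootOfUnity factor ζ n ζ^N≈1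

    ζ-order : ∀ k → ζ ^ᴷ k K.≈ 1# → N ∣ k
    ζ-order = order-from-primes (λ ℓ c ℓ-prime N≡ℓc ζᶜ≈1 → ζ-primes ℓ c ℓ-prime N≡ℓc (≡.subst (K._≈ 1#) (^ᴷ≡^ ζ c) ζᶜ≈1))

    -- Together with the powers of `ζ`, `y` would give `N + 1` distinct solutions of X^N = 1. With
    -- no further conjugates, `fiber-bound` is the usual bound of the number of roots by the degree.
    too-many-roots : ∀ y → ¬ y K.≈ 0# → ¬ (∀ i → ¬ y K.≈ ζ ^ᴷ toℕ {N} i)
    too-many-roots y y≉0 y≉ζ^ = fiber-bound {0} n x₀ (λ ()) (λ _ → K.0#) (λ ()) (λ _ → x₀) (λ ())
        (λ _ s → K.sym (K.trans (K.*-identityʳ (x₀ s K.- K.0#)) (Kr.solve 1 (λ x → x Kr.:- Kr.con (+ 0) Kr.:= x) K.refl (x₀ s))))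
        (λ _ → K.1# , λ s → root^N (cast L≡ s))
        (λ s s′ s≢s′ → roots-distinct (cast L≡ s) (cast L≡ s′)
          (λ eq → s≢s′ (≡.trans (≡.sym (cast-involutive (≡.sym L≡) L≡ s)) (≡.trans (≡.cong (cast (≡.sym L≡)) eq) (cast-involutive (≡.sym L≡) L≡ s′)))))
      where
      open FiberBound factor factor-isField
      module Kr = IntegerSolver factor
      L≡ : suc (1 ℕ.* suc n ℕ.^ 1) ≡ suc N
      L≡ = ≡.cong suc (≡.trans (ℕ.*-identityˡ (suc n ℕ.^ 1)) (ℕ.*-identityʳ (suc n)))
      roots : Fin (suc N) → Carrier
      roots zero = y
      roots (suc i) = ζ ^ᴷ toℕ i
      x₀ : Fin (suc (1 ℕ.* suc n ℕ.^ 1)) → Carrier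
      x₀ s = roots (cast L≡ s)
      root^N : ∀ s → roots s ^ᴷ N K.≈ 1#
      root^N zero = ≡.subst (K._≈ 1#) (≡.sym (^ᴷ≡^ y N)) (unitPart-≈1 y y≉0)
      root^N (suc i) = K.trans (^-assocʳ ζ (toℕ i) N) (ζ^∣≈1 (divides (toℕ i) ≡.refl))
      roots-distinct : ∀ s s′ → ¬ s ≡ s′ → ¬ roots s K.≈ roots s′
      roots-distinct zero zero s≢s′ _ = s≢s′ ≡.refl
      roots-distinct zero (suc i) _ y≈ζⁱ = y≉ζ^ i y≈ζⁱ
      roots-distinct (suc i) zero _ ζⁱ≈y = y≉ζ^ i (K.sym {ζ ^ᴷ toℕ i} {y} ζⁱ≈y)
      roots-distinct (suc i) (suc j) i≢j ζⁱ≈ζʲ = i≢j (≡.cong suc (toℕ-injective (≡.trans (≡.sym (m<n⇒m%n≡m (toℕ<n i)))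
        (≡.trans (ζ^-injective ζ-order (toℕ i) (toℕ j) ζⁱ≈ζʲ) (m<n⇒m%n≡m (toℕ<n j))))))

    ζ-generates : ∀ y → ¬ y K.≈ 0# → ∃[ i ] y K.≈ ζ ^ᴷ toℕ {N} i
    ζ-generates y y≉0 = decidable-stable (any? (λ i → IsField._≈?_ factor-isField y (ζ ^ᴷ toℕ {N} i)))
      (λ y≉ζ^ → too-many-roots y y≉0 (λ i y≈ζⁱ → y≉ζ^ (i , y≈ζⁱ)))

    fieldFromRing : FiniteField p n
    fieldFromRing = record
      { ring = factor ; isField = factor-isField ; characteristic = ≡.subst (K._≈ 0#) (≡.sym (×ᴷ≡× p 1#)) (≈⇒≈ᶠ {p ×ᴿ 1#} {0#} p×1≈ᴿ0) ; ζ = ζ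
      ; ζ^N≈1 = ζ^N≈1 ; ζ-order = ζ-order ; ζ-generates = ζ-generates }

module FieldFromGroupRing (A : CommutativeRing 0ℓ 0ℓ) (_≈?ᴬ_ : Decidable (CommutativeRing._≈_ A))
  (1≉ᴬ0 : ¬ CommutativeRing._≈_ A (CommutativeRing.1# A) (CommutativeRing.0# A)) {p : ℕ} (p-prime : Prime p)
  (residue : ∀ c → ∃[ r ] CommutativeRing._≈_ A
    (Algebra.Properties.Semiring.Mult._×_ (CommutativeRing.semiring A) (toℕ {p} r) (CommutativeRing.1# A)) c)
  (p×1≈0 : CommutativeRing._≈_ A
    (Algebra.Properties.Semiring.Mult._×_ (CommutativeRing.semiring A) p (CommutativeRing.1# A)) (CommutativeRing.0# A))
  (e n : ℕ) (p^e≡Q : p Data.Nat.^ e ≡ suc (suc n)) where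
  open import Data.Nat as ℕ using (_%_)
  open import Data.Nat.DivMod using (m<n⇒m%n≡m; [m+kn]%n≡m%n)
  import Data.Nat.Properties as ℕ
  open import Data.Nat.Divisibility using (∣-refl)
  open import Data.Fin using (finToFun; funToFin; punchIn)
  open import Data.Fin.Properties
    using (all?; finToFun-funToFin; toℕ-injective; toℕ<n; punchInᵢ≢i)
  open import Function using (_∘_)
  open import Relation.Binary.Definitions using (Decidable)
  import Relation.Binary.PropositionalEquality as ≡
  open CyclicGroupRing A n
  open CommutativeRing groupRing hiding (zero)
  open Algebra.Properties.Semiring.Exp semiring using (_^_; ^-congˡ)
  open Algebra.Properties.Semiring.Mult semiring using () renaming (_×_ to _×ᴿ_)
  open Algebra.Properties.Semiring.Sum semiring using () renaming (sum to sumᴿ)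
  private
    module A = CommutativeRing A
    module FA = Frobenius A
    module FR = Frobenius groupRing
    module R = IntegerSolver groupRing
  open Algebra.Properties.Semiring.Mult A.semiring using () renaming (_×_ to _×ᴬ_; ×-congʳ to ×ᴬ-congʳ)
  open Algebra.Properties.Semiring.Sum A.semiring using (sum; sum-cong-≋; sum-remove; sum-replicate-zero)

  ×-pointwise : ∀ m f k → (m ×ᴿ f) k ≡ m ×ᴬ f k
  ×-pointwise zero f k = ≡.refl
  ×-pointwise (suc m) f k = ≡.cong (f k A.+_) (×-pointwise m f k)

  sum-pointwise : ∀ {m} (F : Fin m → Element) k → sumᴿ F k ≡ sum (λ i → F i k)
  sum-pointwise {zero} F k = ≡.refl
  sum-pointwise {suc m} F k = ≡.cong (F zero k A.+_) (sum-pointwise (F ∘ suc) k)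

  p×1≈ᴿ0 : p ×ᴿ 1# ≈ 0#
  p×1≈ᴿ0 k = A.trans (A.reflexive (×-pointwise p 1# k)) (FA.×-zero p (1# k) p×1≈0 ∣-refl)

  _≟ᴿ_ : Decidable _≈_
  f ≟ᴿ g = all? (λ k → f k ≈?ᴬ g k)

  Q : ℕ
  Q = suc (suc n)

  Fixed : Element → Set
  Fixed y = y ^ Q ≈ y

  fixed-+ : ∀ {y z} → Fixed y → Fixed z → Fixed (y + z)
  fixed-+ {y} {z} y-fixed z-fixed = trans
    (≡.subst (λ q → (y + z) ^ q ≈ y ^ q + z ^ q) p^e≡Q (FR.frobenius^-+ p-prime p×1≈ᴿ0 e y z))
    (+-cong y-fixed z-fixed)

  fixed-resp : ∀ {y z} → y ≈ z → Fixed y → Fixed z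
  fixed-resp y≈z y-fixed = trans (^-congˡ Q (sym y≈z)) (trans y-fixed y≈z)

  fixed-zero : Fixed 0#
  fixed-zero = zeroˡ (0# ^ suc n)

  fixed-× : ∀ m {y} → Fixed y → Fixed (m ×ᴿ y)
  fixed-× zero y-fixed = fixed-zero
  fixed-× (suc m) y-fixed = fixed-+ y-fixed (fixed-× m y-fixed)

  fixed-sum : ∀ {m} (F : Fin m → Element) → (∀ i → Fixed (F i)) → Fixed (sumᴿ F)
  fixed-sum {zero} F fixed = fixed-zero
  fixed-sum {suc m} F fixed = fixed-+ (fixed zero) (fixed-sum (F ∘ suc) (fixed ∘ suc))

  fixed-δ : ∀ i → Fixed (δ i)
  fixed-δ i = trans (δ-^ i Q) (reflexive (≡.cong δ (toℕ-injective (≡.trans (toℕ-mod (Q ℕ.* toℕ i))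
    (≡.trans (≡.cong (λ c → (toℕ i ℕ.+ c) % N) (ℕ.*-comm N (toℕ i)))
      (≡.trans ([m+kn]%n≡m%n (toℕ i) (toℕ i) N) (m<n⇒m%n≡m (toℕ<n i))))))))

  digit : Element → Fin N → ℕ
  digit f i = toℕ (proj₁ (residue (f i)))

  digit-≈ : ∀ f i → digit f i ×ᴬ A.1# A.≈ f i
  digit-≈ f i = proj₂ (residue (f i))

  coordinates : ∀ f → sumᴿ (λ i → digit f i ×ᴿ δ i) ≈ f
  coordinates f k = begin
    sumᴿ F k ≡⟨ sum-pointwise F k ⟩
    sum (λ i → F i k) ≈⟨ sum-remove {i = k} (λ i → F i k) ⟩
    F k k A.+ sum (λ i → F (punchIn k i) k)
      ≈⟨ A.+-cong
           (A.trans (A.reflexive (×-pointwise (digit f k) (δ k) k)) (A.trans (×ᴬ-congʳ (digit f k) (δ-same k)) (digit-≈ f k)))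
           (A.trans (sum-cong-≋ {n} {λ i → F (punchIn k i) k} {λ _ → A.0#} vanish) (sum-replicate-zero n)) ⟩
    f k A.+ A.0# ≈⟨ A.+-identityʳ (f k) ⟩
    f k ∎
    where
    open import Relation.Binary.Reasoning.Setoid A.setoid
    F : Fin N → Element
    F i = digit f i ×ᴿ δ i
    ×ᴬ-zero : ∀ m → m ×ᴬ A.0# A.≈ A.0#
    ×ᴬ-zero zero = A.refl
    ×ᴬ-zero (suc m) = A.trans (A.+-identityˡ (m ×ᴬ A.0#)) (×ᴬ-zero m)
    vanish : ∀ i → F (punchIn k i) k A.≈ A.0#
    vanish i = A.trans (A.reflexive (×-pointwise m (δ (punchIn k i)) k))
      (A.trans (×ᴬ-congʳ m (δ-other {punchIn k i} {k} (punchInᵢ≢i k i))) (×ᴬ-zero m))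
      where m = digit f (punchIn k i)

  -- The `Q`-th power map is additive, as `Q` is a power of `p`, and fixes every group element, as
  -- the group has order `Q - 1`; the group elements generate the ring additively.
  all-fixed : ∀ y → y ^ Q ≈ y
  all-fixed y = fixed-resp (coordinates y) (fixed-sum _ (λ i → fixed-× (digit y i) (fixed-δ i)))

  elements : Fin (p ℕ.^ N) → Element
  elements j k = toℕ (finToFun {p} {N} j k) ×ᴬ A.1#

  elements-surjective : ∀ f → ∃[ j ] elements j ≈ f
  elements-surjective f = funToFin digits , λ k → A.trans
    (A.reflexive (≡.cong (λ r → toℕ r ×ᴬ A.1#) (finToFun-funToFin digits k))) (digit-≈ f k)
    where
    digits : Fin N → Fin p
    digits k = proj₁ (residue (f k))

  fieldFromGroupRing : FiniteField p n
  fieldFromGroupRing = FieldFromRing.fieldFromRing groupRing _≟ᴿ_ n all-fixed p×1≈ᴿ0 elements elements-surjective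
    (Separator.f (separator N)) (separator-≉0 1≉ᴬ0) ζ ζ^N≈1 separator-divisor

finiteField : ∀ {p} → Prime p → ∀ e n → p Data.Nat.^ e ≡ suc (suc n) → FiniteField p n
finiteField {p} p-prime = FieldFromGroupRing.fieldFromGroupRing ℤ/p _≈?ᴬ_ (1≉ᴬ0 p-prime) p-prime
  (residue {{prime⇒nonZero p-prime}}) p×1≈0
  where
  open IntegersModulo p
  open import Data.Nat.Primality using (prime⇒nonZero)

-- Norm graphs

-- This is 1 + q + ... + q^(k-1), the exponent of the norm from the field with q^k elements to the
-- field with q elements. The Horner form fits the recursion of `conjugate`.
geometric : ℕ → ℕ → ℕ
geometric q zero = 0
geometric q (suc k) = suc (q Data.Nat.* geometric q k)

module NormEquations {p n : ℕ} (p-prime : Prime p) (𝔽 : FiniteField p n) (e : ℕ) where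
  open FiniteField 𝔽 using (isField; characteristic)
  open CommutativeRing (FiniteField.ring 𝔽) hiding (zero)
  open Algebra.Properties.CommutativeSemiring.Exp commutativeSemiring
    using (_^_; ^-congˡ; ^-assocʳ; ^-distrib-*)
  open FieldProperties (FiniteField.ring 𝔽) isField
  open FiberBound (FiniteField.ring 𝔽) isField
  open IntegerSolver (FiniteField.ring 𝔽)
  open Frobenius (FiniteField.ring 𝔽)
  open import Relation.Binary.Reasoning.Setoid setoid
  open import Data.Nat as ℕ using (_!)
  open import Data.Fin.Properties using (suc-injective)
  open import Function using (_∘_)
  open import Relation.Binary.PropositionalEquality as ≡ using (_≢_)

  q : ℕ
  q = p ℕ.^ e

  ^-≉0 : ∀ {x} k → ¬ x ≈ 0# → ¬ x ^ k ≈ 0#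
  ^-≉0 zero x≉0 = 1≉0
  ^-≉0 (suc k) x≉0 = *-≉0 x≉0 (^-≉0 k x≉0)

  inverse-injective : ∀ {x x′ y y′} → x * y ≈ 1# → x′ * y′ ≈ 1# → y ≈ y′ → x ≈ x′
  inverse-injective {x} {x′} {y} {y′} xy≈1 x′y′≈1 y≈y′ = begin
    x ≈⟨ *-identityʳ x ⟨
    x * 1# ≈⟨ *-congˡ x′y′≈1 ⟨
    x * (x′ * y′) ≈⟨ solve 3 (λ x x′ y → x :* (x′ :* y) := x :* y :* x′) refl x x′ y′ ⟩
    x * y′ * x′ ≈⟨ *-congʳ (*-congˡ y≈y′) ⟨
    x * y * x′ ≈⟨ *-congʳ xy≈1 ⟩
    1# * x′ ≈⟨ *-identityˡ x′ ⟩
    x′ ∎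

  conjugate : ℕ → Carrier → Carrier
  conjugate zero x = x
  conjugate (suc j) x = conjugate j (x ^ q)

  conjugate-cong : ∀ j {x y} → x ≈ y → conjugate j x ≈ conjugate j y
  conjugate-cong zero x≈y = x≈y
  conjugate-cong (suc j) x≈y = conjugate-cong j (^-congˡ q x≈y)

  conjugate-sub : ∀ j x y → conjugate j (x - y) ≈ conjugate j x - conjugate j y
  conjugate-sub zero x y = refl
  conjugate-sub (suc j) x y =
    trans (conjugate-cong j (frobenius^-sub p-prime characteristic e x y)) (conjugate-sub j (x ^ q) (y ^ q))

  conjugate-≉0 : ∀ j {x} → ¬ x ≈ 0# → ¬ conjugate j x ≈ 0#
  conjugate-≉0 zero x≉0 = x≉0
  conjugate-≉0 (suc j) x≉0 = conjugate-≉0 j (^-≉0 q x≉0)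

  -- Conjugation respects differences and kills no nonzero element. The double negation is enough,
  -- since the result only serves to transport distinctness.
  conjugate-injective : ∀ j {x y} → conjugate j x ≈ conjugate j y → ¬ ¬ x ≈ y
  conjugate-injective j {x} {y} eq x≉y = conjugate-≉0 j (x≉y ∘ x-y≈0⇒x≈y)
    (trans (conjugate-sub j x y) (x≈y⇒x-y≈0 eq))

  norm-conjugates : ∀ k x → x ^ geometric q k ≈ product (λ j → conjugate (toℕ {k} j) x)
  norm-conjugates zero x = refl
  norm-conjugates (suc k) x = *-congˡ (trans (sym (^-assocʳ x q (geometric q k))) (norm-conjugates k (x ^ q)))

  module _ (m d : ℕ) where
    private
      D E t s : ℕ
      D = suc d
      E = geometric q (suc m)
      t = suc (suc m)
      s = suc ((suc m) ! ℕ.* D ℕ.^ suc m)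

    -- Inverting about B₀ turns the t equations into t - 1 equations for X = 1/(A - B₀) with constant
    -- right-hand sides: X - 1/(B - B₀) = -(A - B) · X · 1/(B - B₀).
    norm-equations-bound : (A w : Fin s → Carrier) (B g : Fin t → Carrier) →
      (∀ i j → i ≢ j → ¬ A i ≈ A j) → (∀ i j → i ≢ j → ¬ B i ≈ B j) →
      (∀ i → ¬ w i ≈ 0#) → (∀ j → ¬ g j ≈ 0#) →
      ¬ (∀ i j → ((A i - B j) ^ E) ^ D ≈ w i * g j)
    norm-equations-bound A w B g A-distinct B-distinct w≉0 g≉0 norms =
      fiber-bound d X x C a y a-distinct y≋ y^D≈
        (λ i j i≢j Xᵢ≈Xⱼ → A-distinct i j i≢j (-‿injective (inverse-injective (uX≈1 i) (uX≈1 j) Xᵢ≈Xⱼ)))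
      where
      -‿injective : ∀ {a b c} → a - c ≈ b - c → a ≈ b
      -‿injective {a} {b} {c} eq = x-y≈0⇒x≈y (trans
        (solve 3 (λ a b c → a :- b := (a :- c) :- (b :- c)) refl a b c) (x≈y⇒x-y≈0 eq))
      u : Fin s → Carrier
      u i = A i - B zero
      u≉0 : ∀ i → ¬ u i ≈ 0#
      u≉0 i u≈0 = *-≉0 (w≉0 i) (g≉0 zero) (begin
        w i * g zero ≈⟨ norms i zero ⟨
        (u i ^ E) ^ D ≈⟨ ^-congˡ D (trans (*-congʳ u≈0) (zeroˡ _)) ⟩
        0# ^ D ≈⟨ zeroˡ _ ⟩
        0# ∎)
      X : Fin s → Carrier
      X i = proj₁ (inverse (u i) (u≉0 i))
      uX≈1 : ∀ i → u i * X i ≈ 1#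
      uX≈1 i = proj₂ (inverse (u i) (u≉0 i))
      b : Fin (suc m) → Carrier
      b j = B (suc j) - B zero
      b≉0 : ∀ j → ¬ b j ≈ 0#
      b≉0 j b≈0 = B-distinct (suc j) zero (λ ()) (x-y≈0⇒x≈y b≈0)
      C : Fin (suc m) → Carrier
      C j = proj₁ (inverse (b j) (b≉0 j))
      bC≈1 : ∀ j → b j * C j ≈ 1#
      bC≈1 j = proj₂ (inverse (b j) (b≉0 j))
      C-distinct : ∀ j k → j ≢ k → ¬ C j ≈ C k
      C-distinct j k j≢k Cⱼ≈Cₖ = B-distinct (suc j) (suc k) (j≢k ∘ suc-injective)
        (-‿injective (inverse-injective (bC≈1 j) (bC≈1 k) Cⱼ≈Cₖ))
      x : Fin m → Fin s → Carrier
      x l i = conjugate (toℕ l) (X i ^ q)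
      a : Fin m → Fin (suc m) → Carrier
      a l j = conjugate (toℕ l) (C j ^ q)
      a-distinct : ∀ l j k → j ≢ k → ¬ a l j ≈ a l k
      a-distinct l j k j≢k eq = conjugate-injective (suc (toℕ l)) eq (C-distinct j k j≢k)
      y : Fin (suc m) → Fin s → Carrier
      y j i = (X i - C j) ^ E
      y≋ : ∀ j i → y j i ≈ (X i - C j) * product (λ l → x l i - a l j)
      y≋ j i = trans (norm-conjugates (suc m) (X i - C j))
        (*-congˡ (product-cong {m} (λ l → conjugate-sub (suc (toℕ l)) (X i) (C j))))
      g₀⁻¹ : Carrier
      g₀⁻¹ = proj₁ (inverse (g zero) (g≉0 zero))
      -- The weight `w i` varies with the solution. The equation at `B zero` identifies
      -- `w i * g zero` with a power of `u i`, which the same power of its inverse `X i` cancels.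
      wX≈ : ∀ i → w i * (X i ^ E) ^ D ≈ g₀⁻¹
      wX≈ i = *-cancelˡ-≉0 (g≉0 zero) (begin
        g zero * (w i * (X i ^ E) ^ D)
          ≈⟨ solve 3 (λ g w x → g :* (w :* x) := w :* g :* x) refl (g zero) (w i) ((X i ^ E) ^ D) ⟩
        w i * g zero * (X i ^ E) ^ D ≈⟨ *-congʳ (norms i zero) ⟨
        (u i ^ E) ^ D * (X i ^ E) ^ D ≈⟨ ^-distrib-* (u i ^ E) (X i ^ E) D ⟨
        (u i ^ E * X i ^ E) ^ D ≈⟨ ^-congˡ D (^-distrib-* (u i) (X i) E) ⟨
        ((u i * X i) ^ E) ^ D ≈⟨ ^-congˡ D (^-congˡ E (uX≈1 i)) ⟩
        (1# ^ E) ^ D ≈⟨ trans (^-congˡ D (1^ E)) (1^ D) ⟩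
        1# ≈⟨ proj₂ (inverse (g zero) (g≉0 zero)) ⟨
        g zero * g₀⁻¹ ∎)
        where
        1^ : ∀ k → 1# ^ k ≈ 1#
        1^ zero = refl
        1^ (suc k) = trans (*-identityˡ _) (1^ k)
      X-C≈ : ∀ i j → X i - C j ≈ (- C j) * ((A i - B (suc j)) * X i)
      X-C≈ i j = begin
        X i - C j ≈⟨ +-cong (*-identityˡ (X i)) (-‿cong (*-identityˡ (C j))) ⟨
        1# * X i - 1# * C j ≈⟨ +-cong (*-congʳ (bC≈1 j)) (-‿cong (*-congʳ (uX≈1 i))) ⟨
        b j * C j * X i - u i * X i * C j
          ≈⟨ solve 5 (λ A B₀ B X C → (B :- B₀) :* C :* X :- (A :- B₀) :* X :* C := (:- C) :* ((A :- B) :* X))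
               refl (A i) (B zero) (B (suc j)) (X i) (C j) ⟩
        (- C j) * ((A i - B (suc j)) * X i) ∎
      y^D≈ : ∀ j → ∃[ c ] (∀ i → y j i ^ D ≈ c)
      y^D≈ j = ((- C j) ^ E) ^ D * (g (suc j) * g₀⁻¹) , λ i →
        let v = A i - B (suc j) in begin
        ((X i - C j) ^ E) ^ D ≈⟨ ^-congˡ D (^-congˡ E (X-C≈ i j)) ⟩
        (((- C j) * (v * X i)) ^ E) ^ D ≈⟨ power-* (- C j) (v * X i) ⟩
        ((- C j) ^ E) ^ D * ((v * X i) ^ E) ^ D ≈⟨ *-congˡ (power-* v (X i)) ⟩
        ((- C j) ^ E) ^ D * ((v ^ E) ^ D * (X i ^ E) ^ D) ≈⟨ *-congˡ (*-congʳ (norms i (suc j))) ⟩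
        ((- C j) ^ E) ^ D * (w i * g (suc j) * (X i ^ E) ^ D)
          ≈⟨ *-congˡ (solve 3 (λ w g x → w :* g :* x := g :* (w :* x)) refl (w i) (g (suc j)) ((X i ^ E) ^ D)) ⟩
        ((- C j) ^ E) ^ D * (g (suc j) * (w i * (X i ^ E) ^ D)) ≈⟨ *-congˡ (*-congˡ (wX≈ i)) ⟩
        ((- C j) ^ E) ^ D * (g (suc j) * g₀⁻¹) ∎
        where
        power-* : ∀ a b → ((a * b) ^ E) ^ D ≈ (a ^ E) ^ D * (b ^ E) ^ D
        power-* a b = trans (^-congˡ D (^-distrib-* a b E)) (^-distrib-* (a ^ E) (b ^ E) D)

InjectivePair : {I X Y : Set} → (I → X) → (I → Y) → Set
InjectivePair f g = ∀ i j → f i ≡ f j → g i ≡ g j → i ≡ j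

-- The bipartite projective norm graph with vertices (A, x), where A ranges over F_Q and x over the
-- cyclic group of order M, taken additively.
record NormRelation (Q M s t : ℕ) : Set₁ where
  open Data.Nat using (_+_; _<_; _%_; NonZero)
  field
    Rel : Fin Q → ℕ → Fin Q → ℕ → Set
    cover : .{{_ : NonZero M}} → ∀ A B → A ≢ B → ∃[ ρ ] ∀ x z → (x + z) % M ≡ ρ % M → Rel A x B z
    -- The `s` vertices of a forbidden subgraph may lie on either side of the bipartition, whence
    -- the two conditions; `Rel` is not assumed symmetric.
    freeʳ : (A : Fin s → Fin Q) (x : Fin s → ℕ) (B : Fin t → Fin Q) (z : Fin t → ℕ) →
      (∀ i → x i < M) → (∀ j → z j < M) → InjectivePair A x → InjectivePair B z →
      ¬ (∀ i j → Rel (A i) (x i) (B j) (z j))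
    freeˡ : (A : Fin s → Fin Q) (x : Fin s → ℕ) (B : Fin t → Fin Q) (z : Fin t → ℕ) →
      (∀ i → x i < M) → (∀ j → z j < M) → InjectivePair A x → InjectivePair B z →
      ¬ (∀ i j → Rel (B j) (z j) (A i) (x i))

module NormRelationConstruction {p n : ℕ} (p-prime : Prime p) (𝔽 : FiniteField p n) (e m d M′ : ℕ)
  (q≡ : p Data.Nat.^ e ≡ suc (suc M′ Data.Nat.* suc d))
  (Q≡ : (p Data.Nat.^ e) Data.Nat.^ suc m ≡ suc (suc n)) where
  open FiniteField 𝔽 using (isField; ζ; ζ^N≈1; ζ-order; ζ-generates)
  open CommutativeRing (FiniteField.ring 𝔽) hiding (zero)
  open Algebra.Properties.CommutativeSemiring.Exp commutativeSemiring
    using (_^_; ^-congˡ; ^-homo-*; ^-assocʳ)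
  open FieldProperties (FiniteField.ring 𝔽) isField
  open NormEquations p-prime 𝔽 e
  open IntegerSolver (FiniteField.ring 𝔽)
  open import Relation.Binary.Reasoning.Setoid setoid
  open import Data.Nat as ℕ using (_!; _%_)
  import Data.Nat.Properties as ℕ
  open import Data.Nat.DivMod using (m<n⇒m%n≡m)
  open import Data.Nat.Divisibility using (*-cancelˡ-∣)
  open import Data.Fin.Properties using (toℕ-injective; toℕ<n)
  open import Data.Empty using (⊥-elim)
  open import Function using (_∘_)
  import Relation.Binary.PropositionalEquality as ≡
  private
    D M E : ℕ
    D = suc d
    M = suc M′
    E = geometric q (suc m)
    module ζ = RootOfUnity (FiniteField.ring 𝔽) ζ n ζ^N≈1

  geometric-sum : ∀ k → suc (geometric q k ℕ.* (M ℕ.* D)) ≡ q ℕ.^ k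
  geometric-sum zero = ≡.refl
  geometric-sum (suc k) = ≡.trans (≡.cong (λ a → suc (r ℕ.+ a)) (ℕ.*-assoc q (geometric q k) r))
    (≡.trans (≡.cong (λ a → a ℕ.+ q ℕ.* (geometric q k ℕ.* r)) (≡.sym q≡))
      (≡.trans (≡.sym (ℕ.*-suc q (geometric q k ℕ.* r))) (≡.cong (q ℕ.*_) (geometric-sum k))))
    where r = M ℕ.* D

  N≡EDM : suc n ≡ E ℕ.* D ℕ.* M
  N≡EDM = ≡.trans (ℕ.suc-injective (≡.trans (≡.sym Q≡) (≡.sym (geometric-sum (suc m)))))
    (≡.trans (≡.cong (E ℕ.*_) (ℕ.*-comm M D)) (≡.sym (ℕ.*-assoc E D M)))

  -- It generates the subgroup of `E D`-th powers, which has order `M` and contains every N(A - B)^D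
  -- with A and B distinct.
  γ : Carrier
  γ = ζ ^ (E ℕ.* D)

  γ^M≈1 : γ ^ M ≈ 1#
  γ^M≈1 = trans (^-assocʳ ζ (E ℕ.* D) M) (trans (reflexive (≡.cong (ζ ^_) (≡.sym N≡EDM))) ζ^N≈1)

  private module γ = RootOfUnity (FiniteField.ring 𝔽) γ M′ γ^M≈1

  γ-order : ∀ k → γ ^ k ≈ 1# → M ∣ k
  γ-order k γ^k≈1 = *-cancelˡ-∣ (E ℕ.* D) (≡.subst (_∣ (E ℕ.* D ℕ.* k)) N≡EDM
    (ζ-order (E ℕ.* D ℕ.* k) (trans (sym (^-assocʳ ζ (E ℕ.* D) k)) γ^k≈1)))

  ζ≉0 : ¬ ζ ≈ 0#
  ζ≉0 ζ≈0 = 1≉0 (trans (sym ζ^N≈1) (trans (*-congʳ ζ≈0) (zeroˡ _)))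

  γ^≉0 : ∀ k → ¬ γ ^ k ≈ 0#
  γ^≉0 k = ^-≉0 k (^-≉0 (E ℕ.* D) ζ≉0)

  element : Fin (suc (suc n)) → Carrier
  element zero = 0#
  element (suc i) = ζ ^ toℕ i

  element-injective : ∀ i j → element i ≈ element j → i ≡ j
  element-injective zero zero _ = ≡.refl
  element-injective zero (suc j) 0≈ζʲ = ⊥-elim (^-≉0 (toℕ j) ζ≉0 (sym 0≈ζʲ))
  element-injective (suc i) zero ζⁱ≈0 = ⊥-elim (^-≉0 (toℕ i) ζ≉0 ζⁱ≈0)
  element-injective (suc i) (suc j) ζⁱ≈ζʲ = ≡.cong suc (toℕ-injective
    (≡.trans (≡.sym (m<n⇒m%n≡m (toℕ<n i))) (≡.trans (ζ.ζ^-injective ζ-order (toℕ i) (toℕ j) ζⁱ≈ζʲ) (m<n⇒m%n≡m (toℕ<n j)))))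

  Rel : Fin (suc (suc n)) → ℕ → Fin (suc (suc n)) → ℕ → Set
  Rel A x B z = ((element A - element B) ^ E) ^ D ≈ γ ^ (x ℕ.+ z)

  -- `ρ` is the discrete logarithm of the difference to base `ζ`; raising to the power `E D` turns
  -- it into an exponent of `γ`.
  cover : ∀ A B → A ≢ B → ∃[ ρ ] ∀ x z → (x ℕ.+ z) % M ≡ ρ % M → Rel A x B z
  cover A B A≢B =
    let i , A-B≈ζⁱ = ζ-generates (element A - element B) (A≢B ∘ element-injective A B ∘ x-y≈0⇒x≈y)
    in toℕ i , λ x z x+z≡i → begin
      ((element A - element B) ^ E) ^ D ≈⟨ ^-assocʳ _ E D ⟩
      (element A - element B) ^ (E ℕ.* D) ≈⟨ ^-congˡ (E ℕ.* D) A-B≈ζⁱ ⟩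
      (ζ ^ toℕ i) ^ (E ℕ.* D) ≈⟨ ^-assocʳ ζ (toℕ i) (E ℕ.* D) ⟩
      ζ ^ (toℕ i ℕ.* (E ℕ.* D)) ≡⟨ ≡.cong (ζ ^_) (ℕ.*-comm (toℕ i) (E ℕ.* D)) ⟩
      ζ ^ (E ℕ.* D ℕ.* toℕ i) ≈⟨ ^-assocʳ ζ (E ℕ.* D) (toℕ i) ⟨
      γ ^ toℕ i ≈⟨ γ.ζ^-cong (x ℕ.+ z) (toℕ i) x+z≡i ⟨
      γ ^ (x ℕ.+ z) ∎

  module _ (α : Fin (suc (suc n)) → Carrier) (α-injective : ∀ i j → α i ≈ α j → i ≡ j) where

    -- Over one field element, vertices with a common neighbour have the same exponent, because `γ`
    -- has order `M`. So the vertices on one side of a complete bipartite subgraph lie over distinct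
    -- field elements, as the norm equations require.
    pairs-distinct : ∀ {k} (A : Fin k → Fin (suc (suc n))) (x : Fin k → ℕ) → (∀ i → x i ℕ.< M) →
      InjectivePair A x → ∀ {β g} →
      ¬ g ≈ 0# → (∀ i → ((α (A i) - β) ^ E) ^ D ≈ γ ^ x i * g) →
      ∀ i j → i ≢ j → ¬ α (A i) ≈ α (A j)
    pairs-distinct A x x<M injective {β} {g} g≉0 eqs i j i≢j αAᵢ≈αAⱼ =
      i≢j (injective i j (α-injective (A i) (A j) αAᵢ≈αAⱼ) (≡.trans (≡.sym (m<n⇒m%n≡m (x<M i)))
        (≡.trans (γ.ζ^-injective γ-order (x i) (x j) (*-cancelˡ-≉0 g≉0 (begin
          g * γ ^ x i ≈⟨ *-comm _ _ ⟩
          γ ^ x i * g ≈⟨ eqs i ⟨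
          ((α (A i) - β) ^ E) ^ D ≈⟨ ^-congˡ D (^-congˡ E (+-congʳ αAᵢ≈αAⱼ)) ⟩
          ((α (A j) - β) ^ E) ^ D ≈⟨ eqs j ⟩
          γ ^ x j * g ≈⟨ *-comm _ _ ⟩
          g * γ ^ x j ∎))) (m<n⇒m%n≡m (x<M j)))))

    -- A general injective `α` serves both orientations: the second is the first with all field
    -- elements negated, as (-A) - (-B) = B - A.
    free : let s = suc ((suc m) ! ℕ.* D ℕ.^ suc m); t = suc (suc m) in
      (A : Fin s → Fin (suc (suc n))) (x : Fin s → ℕ) (B : Fin t → Fin (suc (suc n))) (z : Fin t → ℕ) →
      (∀ i → x i ℕ.< M) → (∀ j → z j ℕ.< M) → InjectivePair A x → InjectivePair B z →
      ¬ (∀ i j → ((α (A i) - α (B j)) ^ E) ^ D ≈ γ ^ (x i ℕ.+ z j))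
    free A x B z x<M z<M A-injective B-injective eqs = norm-equations-bound m d
      (λ i → α (A i)) (λ i → γ ^ x i) (λ j → α (B j)) (λ j → γ ^ z j)
      (pairs-distinct A x x<M A-injective (γ^≉0 (z zero)) (λ i → split i zero))
      (λ i j i≢j αBᵢ≈αBⱼ → pairs-distinct′ i j i≢j αBᵢ≈αBⱼ)
      (λ i → γ^≉0 (x i)) (λ j → γ^≉0 (z j)) split
      where
      split : ∀ i j → ((α (A i) - α (B j)) ^ E) ^ D ≈ γ ^ x i * γ ^ z j
      split i j = trans (eqs i j) (^-homo-* γ (x i) (z j))
      pairs-distinct′ : ∀ i j → i ≢ j → ¬ α (B i) ≈ α (B j)
      pairs-distinct′ i j i≢j αBᵢ≈αBⱼ =
        i≢j (B-injective i j (α-injective (B i) (B j) αBᵢ≈αBⱼ) (≡.trans (≡.sym (m<n⇒m%n≡m (z<M i)))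
          (≡.trans (γ.ζ^-injective γ-order (z i) (z j) (*-cancelˡ-≉0 (γ^≉0 (x zero)) (begin
            γ ^ x zero * γ ^ z i ≈⟨ split zero i ⟨
            ((α (A zero) - α (B i)) ^ E) ^ D ≈⟨ ^-congˡ D (^-congˡ E (+-congˡ (-‿cong αBᵢ≈αBⱼ))) ⟩
            ((α (A zero) - α (B j)) ^ E) ^ D ≈⟨ split zero j ⟩
            γ ^ x zero * γ ^ z j ∎))) (m<n⇒m%n≡m (z<M j)))))

  normRelation′ : NormRelation (suc (suc n)) M (suc ((suc m) ! ℕ.* D ℕ.^ suc m)) (suc (suc m))
  normRelation′ = record
    { Rel = Rel
    ; cover = cover
    ; freeʳ = free element element-injective
    ; freeˡ = λ A x B z x<M z<M A-injective B-injective eqs →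
        free (λ i → - element i)
          (λ i j -i≈-j → element-injective i j (trans (sym (-‿involutive _)) (trans (-‿cong -i≈-j) (-‿involutive _))))
          A x B z x<M z<M A-injective B-injective
          (λ i j → trans (^-congˡ D (^-congˡ E (solve 2 (λ a b → (:- a) :- (:- b) := b :- a) refl (element (A i)) (element (B j)))))
            (trans (eqs i j) (reflexive (≡.cong (γ ^_) (ℕ.+-comm (z j) (x i))))))
    }
    where open import Algebra.Properties.Ring (CommutativeRing.ring (FiniteField.ring 𝔽)) using (-‿involutive)

normRelation : ∀ {p} → Prime p → ∀ e m d M → let open Data.Nat using (_^_; _*_; _!) in
  p ^ e ≡ suc (suc M * suc d) →
  NormRelation ((p ^ e) ^ suc m) (suc M) (suc ((suc m) ! * suc d ^ suc m)) (suc (suc m))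
normRelation {p} p-prime e m d M q≡ = ≡.subst (λ Q → NormRelation Q (suc M) (suc ((suc m) ! * suc d ^ suc m)) (suc (suc m)))
  (≡.sym Q≡) (NormRelationConstruction.normRelation′ p-prime 𝔽 e m d M q≡ Q≡)
  where
  open import Data.Nat
  open import Data.Nat.Properties
  import Relation.Binary.PropositionalEquality as ≡
  q = p ^ e
  n = q ^ suc m ∸ 2
  2≤q : 2 ≤ q
  2≤q = ≡.subst (2 ≤_) (≡.sym q≡) (s≤s (s≤s z≤n))
  Q≡ : q ^ suc m ≡ 2 + n
  Q≡ = ≡.sym (m+[n∸m]≡n (≤-trans 2≤q (m≤m*n q (q ^ m) {{m^n≢0 q m {{>-nonZero (≤-trans (s≤s z≤n) 2≤q)}}}})))
  𝔽 : FiniteField p n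
  𝔽 = finiteField p-prime (e * suc m) n (≡.trans (≡.sym (^-*-assoc p e (suc m))) Q≡)

-- Graphs with equal parts

-- Arbitrary index types let products and sums stand until the end, where they become `Fin`.
-- Disjointness of the two sides in `free` follows from irreflexivity.
record PartGraph (I S : Set) (k l : ℕ) : Set₁ where
  field
    E : I × S → I × S → Set
    E-sym : ∀ {u v} → E u v → E v u
    E-irrefl : ∀ {v} → ¬ E v v
    linked : ∀ i j → i ≢ j → ∃[ u ] ∃[ v ] E (i , u) (j , v)
    free : (A : Fin k → I × S) (B : Fin l → I × S) → Injective _≡_ _≡_ A → Injective _≡_ _≡_ B →
      ¬ (∀ i j → E (A i) (B j))

module PartGraphs where
  open PartGraph
  open import Data.Nat using (_+_; _*_; _∸_; _%_; _/_; _≤_; _<_; NonZero)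
  open import Data.Nat.Properties
  open import Data.Fin using (fromℕ<; inject≤)
  open import Data.Fin.Properties
    using (inject≤-injective; combine-injective; toℕ-combine; toℕ<n; toℕ-injective; toℕ-fromℕ<;
      combine-remQuot; remQuot-combine; injective⇒≤)
  open import Data.Empty using (⊥; ⊥-elim)
  open import Function using (_∘_)
  open import Data.Nat.DivMod using (%-distribˡ-+; m%n%n≡m%n)
  open import Data.List using (List; lookup; filter; allFin)
  open import Data.List.Membership.Propositional.Properties using (∈-lookup)
  open import Data.List.Relation.Unary.All using () renaming (lookup to lookupᴬ)
  open import Data.List.Relation.Unary.All.Properties using (all-filter)
  open import Data.List.Relation.Unary.AllPairs using (_∷_)
  open import Data.List.Relation.Unary.Unique.Propositional using (Unique)
  open import Data.List.Relation.Unary.Unique.Propositional.Properties using (allFin⁺; filter⁺)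
  open import Function.Bundles using (_↔_; Inverse)
  open import Relation.Nullary using (yes; no)
  open import Relation.Binary.PropositionalEquality

  reindex : ∀ {I I′ S S′ k l} (f : I′ → I) → Injective _≡_ _≡_ f → S′ ↔ S →
    PartGraph I S k l → PartGraph I′ S′ k l
  reindex {I} {I′} {S} {S′} f f-injective S′↔S G = record
    { E = λ u v → E G (vertex u) (vertex v)
    ; E-sym = E-sym G
    ; E-irrefl = E-irrefl G
    ; linked = λ i j i≢j →
        let u , v , uv = linked G (f i) (f j) (i≢j ∘ f-injective)
        in from u , from v , subst₂ (λ u v → E G (f i , u) (f j , v)) (sym (strictlyInverseˡ u)) (sym (strictlyInverseˡ v)) uv
    ; free = λ A B A-injective B-injective →
        free G (vertex ∘ A) (vertex ∘ B) (A-injective ∘ vertex-injective) (B-injective ∘ vertex-injective) }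
    where
    open Inverse S′↔S using (to; from; strictlyInverseˡ; strictlyInverseʳ)
    vertex : I′ × S′ → I × S
    vertex (i , u) = f i , to u
    vertex-injective : ∀ {u v} → vertex u ≡ vertex v → u ≡ v
    vertex-injective {i , u} {j , v} eq = cong₂ _,_ (f-injective (cong proj₁ eq))
      (trans (sym (strictlyInverseʳ u)) (trans (cong from (cong proj₂ eq)) (strictlyInverseʳ v)))

  weaken : ∀ {I S k k′ l l′} → k ≤ k′ → l ≤ l′ → PartGraph I S k l → PartGraph I S k′ l′
  weaken k≤k′ l≤l′ G = record
    { E = E G ; E-sym = E-sym G ; E-irrefl = E-irrefl G ; linked = linked G
    ; free = λ A B A-injective B-injective complete →
        free G (λ i → A (inject≤ i k≤k′)) (λ j → B (inject≤ j l≤l′))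
          (λ eq → inject≤-injective k≤k′ k≤k′ _ _ (A-injective eq))
          (λ eq → inject≤-injective l≤l′ l≤l′ _ _ (B-injective eq))
          (λ i j → complete (inject≤ i k≤k′) (inject≤ j l≤l′)) }

  -- Vertex `(i , u)` is the end in part `i` of the edge to part `u`, so every vertex has at most
  -- one neighbour.
  matching : ∀ a → PartGraph (Fin a) (Fin a) 2 2
  matching a = record
    { E = λ { (i , u) (j , v) → i ≢ j × u ≡ j × v ≡ i }
    ; E-sym = λ { (i≢j , u≡j , v≡i) → ≢-sym i≢j , v≡i , u≡j }
    ; E-irrefl = λ { (i≢i , _) → i≢i refl }
    ; linked = λ i j i≢j → j , i , i≢j , refl , refl
    ; free = λ A B _ B-injective complete →
        let _ , u≡j₀ , v₀≡i = complete zero zero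
            _ , u≡j₁ , v₁≡i = complete zero (suc zero)
        in 0≢1 (B-injective (cong₂ _,_ (trans (sym u≡j₀) u≡j₁) (trans v₀≡i (sym v₁≡i)))) }
    where
    0≢1 : zero ≢ suc {1} zero
    0≢1 ()

  %-+ˡ : ∀ a b n .{{_ : NonZero n}} → (a % n + b) % n ≡ (a + b) % n
  %-+ˡ a b n = trans (%-distribˡ-+ (a % n) b n)
    (trans (cong (λ c → (c + b % n) % n) (m%n%n≡m%n a n)) (sym (%-distribˡ-+ a b n)))

  -- Modulo h a, a coset of the subgroup generated by a and an interval of length a sum to everything.
  cosets-cover : ∀ h a .{{_ : NonZero h}} .{{_ : NonZero a}} .{{_ : NonZero (h * a)}} i b ρ → i ≤ a →
    Σ (Fin h) λ x → Σ (Fin a) λ z → (a * toℕ x + i + (a * b + toℕ z)) % (h * a) ≡ ρ % (h * a)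
  cosets-cover h a i b ρ i≤a = fromℕ< (m%n<n (τ / a) h) , fromℕ< (m%n<n (ρ + (a ∸ i)) a) , (begin
    (a * toℕ (fromℕ< (m%n<n (τ / a) h)) + i + (a * b + toℕ (fromℕ< (m%n<n (ρ + (a ∸ i)) a)))) % M
      ≡⟨ cong₂ (λ x z → (a * x + i + (a * b + z)) % M) (toℕ-fromℕ< (m%n<n (τ / a) h)) (toℕ-fromℕ< (m%n<n (ρ + (a ∸ i)) a)) ⟩
    (a * (τ / a % h) + i + (a * b + z)) % M
      ≡⟨ cong (_% M) (S.solve 4 (λ x i ab z → x S.:+ i S.:+ (ab S.:+ z) S.:= x S.:+ (i S.:+ z S.:+ ab)) refl (a * (τ / a % h)) i (a * b) z) ⟩
    (a * (τ / a % h) + σ) % M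
      ≡⟨ cong (λ c → (c + σ) % M) (trans (*-comm a (τ / a % h)) (trans (m%n*o≡m*o%[n*o] (τ / a) h a) (cong (_% M) (m/n*n≡m a∣τ)))) ⟩
    (τ % M + σ) % M ≡⟨ %-+ˡ τ σ M ⟩
    (ρ + (M ∸ 1) * σ + σ) % M ≡⟨ cong (_% M) (trans (+-assoc ρ _ σ) (cong (ρ +_) [M-1]σ+σ)) ⟩
    (ρ + σ * M) % M ≡⟨ [m+kn]%n≡m%n ρ σ M ⟩
    ρ % M ∎)
    where
    open ≡-Reasoning
    open import Data.Nat.DivMod
    open import Data.Nat.Divisibility using (_∣_; m%n≡0⇒n∣m; n∣m⇒m%n≡0; ∣n⇒∣m*n; n∣m*n)
    open import Data.Nat.Solver using (module +-*-Solver)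
    module S = +-*-Solver
    M = h * a
    -- Chosen so that `i + z` agrees with `ρ` modulo `a`; then `ρ - σ` is a multiple of `a`, which
    -- the coset can supply.
    z = (ρ + (a ∸ i)) % a
    σ = i + z + a * b
    -- This is `ρ - σ` modulo `M`, with `M ∸ 1` in the role of -1.
    τ = ρ + (M ∸ 1) * σ
    [M-1]σ+σ : (M ∸ 1) * σ + σ ≡ σ * M
    [M-1]σ+σ = trans (+-comm _ σ) (trans (cong (_* σ) (suc-pred M)) (*-comm M σ))
    σ≡ρ : σ % a ≡ ρ % a
    σ≡ρ = begin
      (i + z + a * b) % a ≡⟨ cong (λ c → (i + z + c) % a) (*-comm a b) ⟩
      (i + z + b * a) % a ≡⟨ [m+kn]%n≡m%n (i + z) b a ⟩
      (i + z) % a ≡⟨ cong (_% a) (+-comm i z) ⟩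
      (z + i) % a ≡⟨ %-+ˡ (ρ + (a ∸ i)) i a ⟩
      (ρ + (a ∸ i) + i) % a ≡⟨ cong (_% a) (trans (+-assoc ρ _ i) (cong (ρ +_) (m∸n+n≡m i≤a))) ⟩
      (ρ + a) % a ≡⟨ [m+n]%n≡m%n ρ a ⟩
      ρ % a ∎
    a∣τ : a ∣ τ
    a∣τ = m%n≡0⇒n∣m τ a (begin
      (ρ + (M ∸ 1) * σ) % a ≡⟨ %-+ˡ ρ _ a ⟨
      (ρ % a + (M ∸ 1) * σ) % a ≡⟨ cong (λ c → (c + (M ∸ 1) * σ) % a) σ≡ρ ⟨
      (σ % a + (M ∸ 1) * σ) % a ≡⟨ %-+ˡ σ _ a ⟩
      (σ + (M ∸ 1) * σ) % a ≡⟨ cong (_% a) (trans (+-comm σ _) [M-1]σ+σ) ⟩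
      σ * M % a ≡⟨ n∣m⇒m%n≡0 (σ * M) a (∣n⇒∣m*n σ (n∣m*n h)) ⟩
      0 ∎)

  module _ {Q h a s t : ℕ} (a≤h : a ≤ h) .{{h≢0 : NonZero h}} .{{a≢0 : NonZero a}}
    (𝒩 : NormRelation Q (h * a) (suc s) (suc t)) {S : Set} (G : PartGraph (Fin a) S (suc t) (suc s)) where
    open NormRelation 𝒩

    private
      Vertex : Set
      Vertex = (Fin Q × Fin a) × (Fin h ⊎ (Fin a ⊎ S))

      pattern left A i x = ((A , i) , inj₁ x)
      pattern right A i z = ((A , i) , inj₂ (inj₁ z))
      pattern extra A i u = ((A , i) , inj₂ (inj₂ u))

      -- The order of the arguments of `combine` matters: here it gives `a x + i`, a coset of the
      -- multiples of `a`, and in `rightCode` it gives `a i + z`, an interval that stays below `h a`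
      -- because `a ≤ h`.
      leftCode : Fin a → Fin h → ℕ
      leftCode i x = toℕ (combine x i)

      rightCode : Fin a → Fin a → ℕ
      rightCode i z = toℕ (combine i z)

      Adjacent : Vertex → Vertex → Set
      Adjacent (left A i x) (right B j z) = Rel A (leftCode i x) B (rightCode j z)
      Adjacent (right B j z) (left A i x) = Rel A (leftCode i x) B (rightCode j z)
      Adjacent (extra A i u) (extra B j v) = A ≡ B × E G (i , u) (j , v)
      Adjacent _ _ = ⊥

      Adjacent-sym : ∀ {u v} → Adjacent u v → Adjacent v u
      Adjacent-sym {left _ _ _} {right _ _ _} uv = uv
      Adjacent-sym {right _ _ _} {left _ _ _} uv = uv
      Adjacent-sym {extra _ _ _} {extra _ _ _} (A≡B , uv) = sym A≡B , E-sym G uv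

      Adjacent-irrefl : ∀ {v} → ¬ Adjacent v v
      Adjacent-irrefl {extra _ _ _} (_ , vv) = E-irrefl G vv

      data Kind : Set where
        L R X : Kind

      L≢X : L ≢ X
      L≢X ()

      R≢X : R ≢ X
      R≢X ()

      kind : Vertex → Kind
      kind (left _ _ _) = L
      kind (right _ _ _) = R
      kind (extra _ _ _) = X

      field-of : Vertex → Fin Q
      field-of ((A , _) , _) = A

      code : Vertex → ℕ
      code (left A i x) = leftCode i x
      code (right A i z) = rightCode i z
      -- A dummy value; codes matter only for the kinds `L` and `R`.
      code (extra A i u) = 0

      code< : ∀ v → kind v ≢ X → code v < h * a
      code< (left A i x) _ = toℕ<n (combine x i)
      code< (right A i z) _ = ≤-trans (toℕ<n (combine i z)) (*-monoˡ-≤ a a≤h)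
      code< (extra A i u) X≢X = ⊥-elim (X≢X refl)

      code-injective : ∀ u v {k} → k ≢ X → kind u ≡ k → kind v ≡ k → field-of u ≡ field-of v → code u ≡ code v → u ≡ v
      code-injective (left A i x) (left .A j y) _ _ _ refl eq with combine-injective x i y j (toℕ-injective eq)
      ... | refl , refl = refl
      code-injective (right A i x) (right .A j y) _ _ _ refl eq with combine-injective i x j y (toℕ-injective eq)
      ... | refl , refl = refl
      code-injective (left _ _ _) (right _ _ _) _ refl ()
      code-injective (left _ _ _) (extra _ _ _) _ refl ()
      code-injective (right _ _ _) (left _ _ _) _ refl ()
      code-injective (right _ _ _) (extra _ _ _) _ refl ()
      code-injective (extra _ _ _) v X≢X refl _ = ⊥-elim (X≢X refl)

      from-left : ∀ {u v} → kind u ≡ L → Adjacent u v → kind v ≡ R × Rel (field-of u) (code u) (field-of v) (code v)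
      from-left {left _ _ _} {right _ _ _} _ uv = refl , uv
      from-left {left _ _ _} {left _ _ _} _ ()
      from-left {left _ _ _} {extra _ _ _} _ ()
      from-left {right _ _ _} ()
      from-left {extra _ _ _} ()

      from-right : ∀ {u v} → kind u ≡ R → Adjacent u v → kind v ≡ L × Rel (field-of v) (code v) (field-of u) (code u)
      from-right {right _ _ _} {left _ _ _} _ uv = refl , uv
      from-right {right _ _ _} {right _ _ _} _ ()
      from-right {right _ _ _} {extra _ _ _} _ ()
      from-right {left _ _ _} ()
      from-right {extra _ _ _} ()

      gadget : ∀ v → kind v ≡ X → Fin a × S
      gadget (extra A i u) _ = i , u

      gadget-injective : ∀ u v (u-extra : kind u ≡ X) (v-extra : kind v ≡ X) → field-of u ≡ field-of v →
        gadget u u-extra ≡ gadget v v-extra → u ≡ v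
      gadget-injective (extra A i u) (extra B j v) _ _ refl refl = refl

      from-extra : ∀ {u v} (u-extra : kind u ≡ X) → Adjacent u v →
        field-of u ≡ field-of v × Σ (kind v ≡ X) λ v-extra → E G (gadget u u-extra) (gadget v v-extra)
      from-extra {extra _ _ _} {extra _ _ _} _ (A≡B , uv) = A≡B , refl , uv
      from-extra {extra _ _ _} {left _ _ _} _ ()
      from-extra {extra _ _ _} {right _ _ _} _ ()
      from-extra {left _ _ _} ()
      from-extra {right _ _ _} ()

      E-irrelevant : ∀ u v (p p′ : kind u ≡ X) (r r′ : kind v ≡ X) →
        E G (gadget u p) (gadget v r) → E G (gadget u p′) (gadget v r′)
      E-irrelevant (extra _ _ _) (extra _ _ _) _ _ _ _ uv = uv

      -- Adjacency determines the kind of a neighbour, so the kind of `A zero` fixes all others: the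
      -- subgraph lies in the norm graph, in one of its two orientations, or in a single copy of
      -- `G`. The sizes are successors so that `A zero` and `B zero` exist.
      Adjacent-free : (A : Fin (suc t) → Vertex) (B : Fin (suc s) → Vertex) → Injective _≡_ _≡_ A → Injective _≡_ _≡_ B →
        ¬ (∀ i j → Adjacent (A i) (B j))
      Adjacent-free A B A-injective B-injective complete with kind (A zero) in eq
      ... | L = freeˡ (field-of ∘ B) (code ∘ B) (field-of ∘ A) (code ∘ A)
              (λ j → code< (B j) (λ X≡ → R≢X (trans (sym (B-kind j)) X≡))) (λ i → code< (A i) (λ X≡ → L≢X (trans (sym (A-kind i)) X≡)))
              (λ i j A≡ c≡ → B-injective (code-injective (B i) (B j) R≢X (B-kind i) (B-kind j) A≡ c≡))
              (λ i j A≡ c≡ → A-injective (code-injective (A i) (A j) L≢X (A-kind i) (A-kind j) A≡ c≡))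
              (λ j i → proj₂ (from-left (A-kind i) (complete i j)))
        where
        B-kind : ∀ j → kind (B j) ≡ R
        B-kind j = proj₁ (from-left eq (complete zero j))
        A-kind : ∀ i → kind (A i) ≡ L
        A-kind i = proj₁ (from-right (B-kind zero) (Adjacent-sym {A i} (complete i zero)))
      ... | R = freeʳ (field-of ∘ B) (code ∘ B) (field-of ∘ A) (code ∘ A)
              (λ j → code< (B j) (λ X≡ → L≢X (trans (sym (B-kind j)) X≡))) (λ i → code< (A i) (λ X≡ → R≢X (trans (sym (A-kind i)) X≡)))
              (λ i j A≡ c≡ → B-injective (code-injective (B i) (B j) L≢X (B-kind i) (B-kind j) A≡ c≡))
              (λ i j A≡ c≡ → A-injective (code-injective (A i) (A j) R≢X (A-kind i) (A-kind j) A≡ c≡))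
              (λ j i → proj₂ (from-right (A-kind i) (complete i j)))
        where
        B-kind : ∀ j → kind (B j) ≡ L
        B-kind j = proj₁ (from-right eq (complete zero j))
        A-kind : ∀ i → kind (A i) ≡ R
        A-kind i = proj₁ (from-left (B-kind zero) (Adjacent-sym {A i} (complete i zero)))
      ... | X = free G (λ i → gadget (A i) (A-kind i)) (λ j → gadget (B j) (B-kind j))
              (λ {i} {j} eq → A-injective (gadget-injective (A i) (A j) (A-kind i) (A-kind j) (trans (A-field i) (sym (A-field j))) eq))
              (λ {i} {j} eq → B-injective (gadget-injective (B i) (B j) (B-kind i) (B-kind j) (trans (sym (B-field i)) (B-field j)) eq))
              (λ i j → let _ , B-extra , ij = from-extra {A i} {B j} (A-kind i) (complete i j)
                       in E-irrelevant (A i) (B j) (A-kind i) (A-kind i) B-extra (B-kind j) ij)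
        where
        B-kind : ∀ j → kind (B j) ≡ X
        B-kind j = proj₁ (proj₂ (from-extra eq (complete zero j)))
        B-field : ∀ j → field-of (A zero) ≡ field-of (B j)
        B-field j = proj₁ (from-extra eq (complete zero j))
        A-kind : ∀ i → kind (A i) ≡ X
        A-kind i = proj₁ (proj₂ (from-extra (B-kind zero) (Adjacent-sym {A i} (complete i zero))))
        A-field : ∀ i → field-of (A i) ≡ field-of (B zero)
        A-field i = sym (proj₁ (from-extra (B-kind zero) (Adjacent-sym {A i} (complete i zero))))

    normGraph : PartGraph (Fin Q × Fin a) (Fin h ⊎ (Fin a ⊎ S)) (suc t) (suc s)
    normGraph = record
      { E = Adjacent ; E-sym = λ {u} {v} → Adjacent-sym {u} {v} ; E-irrefl = λ {v} → Adjacent-irrefl {v}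
      ; linked = link ; free = Adjacent-free }
      where
      instance
        ha≢0 : NonZero (h * a)
        ha≢0 = m*n≢0 h a
      link : ∀ i j → i ≢ j → ∃[ u ] ∃[ v ] Adjacent (i , u) (j , v)
      link (A , i) (B , j) Ai≢Bj with A Data.Fin.≟ B
      ... | yes refl = let u , v , uv = linked G i j (λ i≡j → Ai≢Bj (cong (A ,_) i≡j))
                       in inj₂ (inj₂ u) , inj₂ (inj₂ v) , refl , uv
      ... | no A≢B = let ρ , related = cover A B A≢B
                         x , z , sum≡ρ = cosets-cover h a (toℕ i) (toℕ j) ρ (<⇒≤ (toℕ<n i))
                     in inj₁ x , inj₂ (inj₁ z) , related (leftCode i x) (rightCode j z)
                          (trans (cong₂ (λ c c′ → (c + c′) % (h * a)) (toℕ-combine x i) (toℕ-combine j z)) sum≡ρ)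

  lookup-injective : ∀ {A : Set} {xs : List A} → Unique xs → ∀ i j → lookup xs i ≡ lookup xs j → i ≡ j
  lookup-injective (x∉xs ∷ _) zero zero _ = refl
  lookup-injective (x∉xs ∷ _) zero (suc j) x≡ = ⊥-elim (lookupᴬ x∉xs (∈-lookup j) x≡)
  lookup-injective (x∉xs ∷ _) (suc i) zero ≡x = ⊥-elim (lookupᴬ x∉xs (∈-lookup i) (sym ≡x))
  lookup-injective (_ ∷ unique) (suc i) (suc j) eq = cong suc (lookup-injective unique i j eq)

  existsKFree : ∀ {r k s t} → PartGraph (Fin r) (Fin k) s t → ExistsKFreeRK r k s t
  existsKFree {r} {k} G = r * k ,
    record { Adj = λ u v → E G (vertex u) (vertex v) ; sym = E-sym G ; irrefl = E-irrefl G } ,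
    part , (small , λ i j i≢j →
      let u , v , uv = linked G i j i≢j
      in combine i u , combine j v , cong proj₁ (remQuot-combine i u) , cong proj₁ (remQuot-combine j v) ,
         subst₂ (E G) (sym (remQuot-combine i u)) (sym (remQuot-combine j v)) uv) ,
    λ { (A , B , A-injective , B-injective , _ , complete) →
      free G (vertex ∘ A) (vertex ∘ B) (A-injective ∘ vertex-injective) (B-injective ∘ vertex-injective) complete }
    where
    vertex : Fin (r * k) → Fin r × Fin k
    vertex = remQuot k
    vertex-injective : ∀ {u v} → vertex u ≡ vertex v → u ≡ v
    vertex-injective {u} {v} eq = trans (sym (combine-remQuot {r} k u))
      (trans (cong (λ w → combine (proj₁ w) (proj₂ w)) eq) (combine-remQuot {r} k v))
    part : Fin (r * k) → Fin r
    part = proj₁ ∘ vertex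
    small : ∀ i → partSize part i ≤ k
    small i = injective⇒≤ {f = λ l → proj₂ (vertex (lookup members l))} (λ {l} {l′} eq →
      lookup-injective (filter⁺ (λ v → part v Data.Fin.≟ i) (allFin⁺ (r * k))) l l′
        (vertex-injective (cong₂ _,_ (trans (member l) (sym (member l′))) eq)))
      where
      members = filter (λ v → part v Data.Fin.≟ i) (allFin (r * k))
      member : ∀ l → part (lookup members l) ≡ i
      member l = lookupᴬ (all-filter (λ v → part v Data.Fin.≟ i) (allFin (r * k))) (∈-lookup l)

-- Choice of the small graph and numerical estimates

module Bounds where
  open import Data.Nat
  open import Data.Nat.Properties
  open import Data.Nat.Primality using (Prime; prime[2])
  open import Data.Nat.Solver using (module +-*-Solver)
  open import Data.Fin using (Fin; inject≤)
  open import Data.Fin.Properties using (inject≤-injective; +↔⊎; *↔×)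
  open import Data.Product using (_×_; _,_)
  open import Data.Sum.Function.Propositional using (_⊎-↔_)
  open import Data.Empty using (⊥-elim)
  open import Function.Bundles using (Inverse)
  open import Function.Properties.Inverse using (↔-refl; ↔-trans)
  open import Relation.Nullary using (yes; no)
  open import Relation.Binary.PropositionalEquality
  open PartGraphs

  normPartGraph : ∀ {p} → Prime p → ∀ e m d h a κ → 1 ≤ a → a ≤ h → p ^ e ≡ suc (h * a * suc d) →
    PartGraph (Fin a) (Fin κ) 2 2 →
    PartGraph (Fin ((p ^ e) ^ suc m * a)) (Fin (h + (a + κ))) (suc (suc m)) (suc ((suc m) ! * suc d ^ suc m))
  normPartGraph p-prime e m d h@(suc _) a@(suc _) κ _ a≤h q≡ G =
    reindex to (λ {i} {j} eq → trans (sym (strictlyInverseʳ i)) (trans (cong from eq) (strictlyInverseʳ j)))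
      (↔-trans +↔⊎ (↔-refl ⊎-↔ +↔⊎))
      -- Both sides of the excluded graph have at least two vertices, so freeness from K_{2,2} is
      -- enough for the copies of `G`.
      (normGraph a≤h (normRelation p-prime e m d _ q≡) (weaken (s≤s (s≤s z≤n)) 2≤s G))
    where
    open Inverse (*↔× {(_ ^ e) ^ suc m} {a}) using (to; from; strictlyInverseʳ)
    2≤s : 2 ≤ suc ((suc m) ! * suc d ^ suc m)
    2≤s = s≤s (*-mono-≤ (1≤n! (suc m)) (m^n>0 (suc d) (suc m)))

  -- Over the field with Z² elements, Z² - 1 = (Z + 1)(Z - 1).
  square-factors : ∀ y → suc (suc y) * suc (suc y) ≡ suc (suc (suc (suc y)) * suc y * 1)
  square-factors = solve 1 (λ y → (con 2 :+ y) :* (con 2 :+ y) := con 1 :+ (con 3 :+ y) :* (con 1 :+ y) :* con 1) refl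
    where open +-*-Solver

  -- The norm construction with t = 2 and d = 1, where the excluded graph is K_{2,2}. Here Z = y +
  -- 2, the coset has Z + 1 elements, and the interval and the matching contribute Z - 1 each.
  smallGadget : ∀ j y r → 2 ^ j ≡ suc (suc y) → r ≤ (2 ^ (j * 2)) ^ 1 * suc y →
    PartGraph (Fin r) (Fin (suc (suc (suc y)) + (suc y + suc y))) 2 2
  smallGadget j y r Z≡ r≤ = reindex (λ i → inject≤ i r≤) (inject≤-injective r≤ r≤ _ _) ↔-refl
    (normPartGraph prime[2] (j * 2) 0 0 (3 + y) (suc y) (suc y) (s≤s z≤n) (≤-trans (n≤1+n _) (n≤1+n _))
      (trans (sym (^-*-assoc 2 j 2)) (trans (cong₂ _*_ Z≡ (trans (*-identityʳ (2 ^ j)) Z≡)) (square-factors y)))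
      (matching (suc y)))

  -- `8 ^ j` is the cube of `2 ^ j`, so this selects a power of 2 within a factor 2 of a given cube
  -- root.
  power-of-8 : ∀ x → ∃[ j ] suc x ≤ 8 ^ j × 8 ^ j ≤ 8 * suc x
  power-of-8 zero = 0 , ≤-refl , s≤s z≤n
  power-of-8 (suc x) with power-of-8 x
  ... | j , x<8^j , 8^j≤ with suc (suc x) ≤? 8 ^ j
  ...   | yes x+1<8^j = j , x+1<8^j , ≤-trans 8^j≤ (*-monoʳ-≤ 8 (n≤1+n (suc x)))
  ...   | no x+1≮8^j = suc j ,
          ≤-trans (+-mono-≤ {1} (m^n>0 8 j) x<8^j) (+-monoʳ-≤ (8 ^ j) (m≤m+n (8 ^ j) (6 * 8 ^ j))) ,
          *-monoʳ-≤ 8 (≤-trans (s≤s⁻¹ (≰⇒> x+1≮8^j)) (n≤1+n (suc x)))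

  gadget : ∀ h a → a ≤ suc h → ∃[ j ] suc (suc (h + h)) ≤ 8 ^ j × 8 ^ j ≤ 8 * suc (suc (h + h)) →
    ∃[ κ ] PartGraph (Fin a) (Fin κ) 2 2 × κ ^ 5 ≤ 10 ^ 5 * suc h ^ 2
  -- The target is `2h` rather than `h`: this excludes `j = 0`, so that `Z` is at least 2, and pays
  -- for replacing `Z` by `2 (Z - 1)` in the count of parts.
  gadget h′ a a≤h (zero , s≤s () , _)
  gadget h′ a a≤h (j@(suc j′) , 2h≤8^j , 8^j≤) = κ , smallGadget j y a Z≡ a≤r , bound
    where
    open ≤-Reasoning
    module S = +-*-Solver
    h Z y κ : ℕ
    h = suc h′
    Z = 2 ^ j
    y = Z ∸ 2
    κ = suc (suc (suc y)) + (suc y + suc y)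
    Z≡ : Z ≡ suc (suc y)
    Z≡ = sym (m+[n∸m]≡n {2} (*-monoʳ-≤ 2 (m^n>0 2 j′)))
    8^j≡ : 8 ^ j ≡ Z * Z * Z
    8^j≡ = begin-equality
      8 ^ j ≡⟨ ^-*-assoc 2 3 j ⟩
      2 ^ (3 * j) ≡⟨ cong (2 ^_) (*-comm 3 j) ⟩
      2 ^ (j * 3) ≡⟨ ^-*-assoc 2 j 3 ⟨
      Z ^ 3 ≡⟨ S.solve 1 (λ z → z S.:^ 3 S.:= z S.:* z S.:* z) refl Z ⟩
      Z * Z * Z ∎
    2h≡ : suc (suc (h′ + h′)) ≡ 2 * h
    2h≡ = S.solve 1 (λ h → S.con 2 S.:+ (h S.:+ h) S.:= S.con 2 S.:* (S.con 1 S.:+ h)) refl h′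
    2a≤2r : 2 * a ≤ 2 * ((2 ^ (j * 2)) ^ 1 * suc y)
    2a≤2r = begin
      2 * a ≤⟨ *-monoʳ-≤ 2 a≤h ⟩
      2 * h ≡⟨ 2h≡ ⟨
      suc (suc (h′ + h′)) ≤⟨ 2h≤8^j ⟩
      8 ^ j ≡⟨ 8^j≡ ⟩
      Z * Z * Z ≤⟨ *-monoʳ-≤ (Z * Z) (begin
        Z ≡⟨ Z≡ ⟩
        2 + y ≤⟨ m≤m+n (2 + y) y ⟩
        2 + y + y ≡⟨ S.solve 1 (λ y → S.con 2 S.:+ y S.:+ y S.:= S.con 2 S.:* (S.con 1 S.:+ y)) refl y ⟩
        2 * suc y ∎) ⟩
      Z * Z * (2 * suc y) ≡⟨ S.solve 2 (λ z y → z S.:* z S.:* (S.con 2 S.:* y) S.:= S.con 2 S.:* ((z S.:^ 2) S.:^ 1 S.:* y)) refl Z (suc y) ⟩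
      2 * ((Z ^ 2) ^ 1 * suc y) ≡⟨ cong (λ q → 2 * (q ^ 1 * suc y)) (^-*-assoc 2 j 2) ⟩
      2 * ((2 ^ (j * 2)) ^ 1 * suc y) ∎
    a≤r : a ≤ (2 ^ (j * 2)) ^ 1 * suc y
    a≤r = *-cancelˡ-≤ 2 2a≤2r
    κ≤3Z : κ ≤ 3 * Z
    κ≤3Z = begin
      κ ≤⟨ n≤1+n κ ⟩
      suc κ ≡⟨ S.solve 1 (λ y → S.con 4 S.:+ (y S.:+ (S.con 1 S.:+ y S.:+ (S.con 1 S.:+ y))) S.:= S.con 3 S.:* (S.con 2 S.:+ y)) refl y ⟩
      3 * suc (suc y) ≡⟨ cong (3 *_) Z≡ ⟨
      3 * Z ∎
    bound : κ ^ 5 ≤ 10 ^ 5 * h ^ 2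
    bound = begin
      κ ^ 5 ≤⟨ ^-monoˡ-≤ 5 κ≤3Z ⟩
      -- The extra factor `Z` completes the square of `Z * Z * Z = 8 ^ j`, which is at most `16 h`.
      (3 * Z) ^ 5 ≤⟨ m≤m*n ((3 * Z) ^ 5) Z {{m^n≢0 2 j}} ⟩
      (3 * Z) ^ 5 * Z ≡⟨ S.solve 1 (λ z → (S.con 3 S.:* z) S.:^ 5 S.:* z S.:= S.con 243 S.:* ((z S.:* z S.:* z) S.:* (z S.:* z S.:* z))) refl Z ⟩
      243 * (Z * Z * Z * (Z * Z * Z)) ≡⟨ cong (λ c → 243 * (c * c)) 8^j≡ ⟨
      243 * (8 ^ j * 8 ^ j) ≤⟨ *-monoʳ-≤ 243 (*-mono-≤ 8^j≤ 8^j≤) ⟩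
      243 * (8 * suc (suc (h′ + h′)) * (8 * suc (suc (h′ + h′)))) ≡⟨ cong (λ c → 243 * (8 * c * (8 * c))) 2h≡ ⟩
      243 * (8 * (2 * h) * (8 * (2 * h)))
        ≡⟨ S.solve 1 (λ h → S.con 243 S.:* (S.con 8 S.:* (S.con 2 S.:* h) S.:* (S.con 8 S.:* (S.con 2 S.:* h))) S.:= S.con 62208 S.:* h S.:^ 2) refl h ⟩
      -- Here 62208 is 3^5 times 16^2; the next fifth power of a round number is 10^5, whence the
      -- constant 10.
      62208 * h ^ 2 ≤⟨ *-monoˡ-≤ (h ^ 2) (≤ᵇ⇒≤ 62208 (10 ^ 5) _) ⟩
      10 ^ 5 * h ^ 2 ∎

-- From part graphs to the bound on f

open import Data.Nat using (z≤n; s≤s; _+_; _*_; _∸_; _^_; _≤_; _!)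
open import Data.Nat.Properties using (+-comm; +-assoc; ≤-refl; m+n∸m≡n; <⇒≱)
open import Relation.Binary.PropositionalEquality using (refl; cong; subst; sym; trans)
open import Data.Empty using (⊥-elim)
open Bounds

theorem3p1 : ∀ (t d : ℕ) → 2 ≤ t → 1 ≤ d →
    ∃[ C ] ∀ (q a h : ℕ) → EvenPowerOfOddPrime q → d ∣ q ∸ 1 →
    1 ≤ a → a ≤ h → h * a * d ≡ q ∸ 1 →
    ∃[ k ] (fK≤ (q ^ (t ∸ 1) * a) t ((t ∸ 1) ! * d ^ (t ∸ 1) + 1) k
    × (k ∸ (a + h)) ^ 5 ≤ C ^ 5 * h ^ 2)
theorem3p1 (suc (suc m)) (suc d) (s≤s (s≤s z≤n)) (s≤s z≤n) = 10 , construction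
  where
  construction : ∀ (q a h : ℕ) → EvenPowerOfOddPrime q → suc d ∣ q ∸ 1 →
    1 ≤ a → a ≤ h → h * a * suc d ≡ q ∸ 1 →
    ∃[ k ] (fK≤ (q ^ suc m * a) (suc (suc m)) ((suc m) ! * suc d ^ suc m + 1) k
    × (k ∸ (a + h)) ^ 5 ≤ 10 ^ 5 * h ^ 2)
  construction 0 (suc a) (suc h) _ _ _ _ ()
  construction (suc q′) a zero _ _ 1≤a a≤0 _ = ⊥-elim (<⇒≱ 1≤a a≤0)
  construction q@(suc q′) a h@(suc h′) (p , e , p-prime , _ , _ , q≡p^2e) _ 1≤a a≤h had≡ =
    let κ , G , κ-bound = gadget h′ a a≤h (power-of-8 (suc (h′ + h′)))
        s = (suc m) ! * suc d ^ suc m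
        H = normPartGraph p-prime (2 * e) m d h a κ 1≤a a≤h
              (trans (sym q≡p^2e) (cong suc (sym had≡))) G
        k∸≡κ = trans (cong (_∸ (a + h)) (trans (sym (+-assoc h a κ)) (cong (_+ κ) (+-comm h a)))) (m+n∸m≡n (a + h) κ)
    in h + (a + κ) ,
       (h + (a + κ) , ≤-refl ,
        subst (λ q → ExistsKFreeRK (q ^ suc m * a) (h + (a + κ)) (suc (suc m)) (s + 1)) (sym q≡p^2e)
          (subst (ExistsKFreeRK _ (h + (a + κ)) (suc (suc m))) (+-comm 1 s) (PartGraphs.existsKFree H))) ,
       subst (λ κ → κ ^ 5 ≤ 10 ^ 5 * h ^ 2) (sym k∸≡κ) κ-bound
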